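{- Let $q = p^r$, where $p$ is prime and $r$ is a positive integer, and let $k$ be an integer with $2 \leq k \leq q$. Suppose that either $q$ is odd, or $q$ is even and $k \notin \{3, q-1\}$. Consider the following statements (1)-(5) about the fixed pair $(k,q)$. (1) The maximum width $n$ of a $k \times n$ MDS code with entries in $\mathbb{F}_q$ is $q+1$, unless $q$ is even and $k \in \{3,q-1\}$, in which case the maximum width is $q+2$. (2) For every $k \times (q+2)$ matrix $M'$ with entries in $\mathbb{F}_q$, some nontrivial $\mathbb{F}_q$-linear combination of the rows of $M'$ has at least $k$ zero entries. (3) For every $k \times (q+2)$ matrix $M'$ with entries in $\mathbb{F}_q$ whose first two columns are $[1,0,\ldots,0]^{\top}$ and $[0,1,0,\ldots,0]^{\top}$, some nontrivial $\mathbb{F}_q$-linear combination of the rows of $M'$ has at least $k$ zero entries. (4) There do not exist distinct $\mathbb{F}_q$-linear subspaces $Y$ and $Z$ of $\mathcal{P}_q$ such that all of the following hold: (a) $\dim(\langle Y, Z \rangle) = k$; (b) $\dim(Y) = \dim(Z) = k-1$; (c) $\langle Y, Z \rangle \subseteq \mathcal{O}_{k-1}$; (d) $Y \cup Z \subseteq \mathcal{O}_{k-2}$; (e) $Y \cap Z \subseteq \mathcal{O}_{k-3}$. (5) There is no integer $s$ with $k < s \leq q$ such that $s-k+2$ columns $\mathcal{B} = \{b_1,\ldots,b_{s-k+2}\}$, with $b_i \in \mathbb{F}_q^s$, can be added to the Reed-Solomon code $\mathcal{R}$ of dimension $s$ with entries in $\mathbb{F}_q$ in such a way that both of the following hold: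 (a) every $s \times s$ submatrix of $\mathcal{R} \cup \mathcal{B}$ (the $s \times (q+s-k+2)$ matrix whose columns are those of $\mathcal{R}$ together with $b_1,\ldots,b_{s-k+2}$) that contains the first $s-k$ columns $b_1,\ldots,b_{s-k}$ of $\mathcal{B}$ has non-zero determinant; (b) the $s-k+3$ columns $b_1,\ldots,b_{s-k+2},[0,0,\ldots,0,1]^{\top}$ are linearly independent over $\mathbb{F}_q$. Then: (Part A) statements (1), (2), (3) and (5) are equivalent; (Part B) statement (3) implies statement (4).
   Context: $\mathbb{F}_q$ is the finite field with $q$ elements. All matrices have entries in $\mathbb{F}_q$. A $k \times n$ maximum distance separable (MDS) code is a $k \times n$ matrix with entries in $\mathbb{F}_q$ such that every set of $k$ columns is linearly independent; $n$ is its width. A nontrivial linear combination of the rows of a $k \times n$ matrix $M$ is a row vector $\vec{L}M$ with $\vec{L} \in \mathbb{F}_q^k \setminus \{\vec{0}\}$ (that is, the coefficients are not all zero). $\mathcal{P}_q$ denotes the ring $\mathbb{F}_q[x]/(x^q-x)$ of polynomial functions over $\mathbb{F}_q$, viewed as a vector space over $\mathbb{F}_q$. For an integer $n$, $\mathcal{O}_n \subseteq \mathcal{P}_q$ is the set of elements of $\mathcal{P}_q$ that are either zero or have at most $n$ distinct roots in $\mathbb{F}_q$; in particular $\mathcal{O}_n = \mathcal{P}_q$ if $n \geq q$, and $\mathcal{O}_{ -1} = \{0\}$. For subspaces $Y, Z$ of $\mathcal{P}_q$, $\langle Y, Z \rangle$ denotes the subspace of $\mathcal{P}_q$ generated by the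 elements of $Y$ and $Z$. The Reed-Solomon code of dimension $s$ with entries in $\mathbb{F}_q$ is the $s \times q$ matrix whose columns are the vectors $[1,a,a^2,\ldots,a^{s-1}]^{\top}$, one for each $a \in \mathbb{F}_q$ (with $a^0=1$ for all $a$). -}

module Defs where

open import Algebra.Bundles using (CommutativeRing; Ring)
open import Algebra.Module.Bundles using (LeftModule)
import Algebra.Definitions.RawMonoid as Summation
import Algebra.Properties.AbelianGroup as AbelianGroupProperties
import Algebra.Properties.CommutativeSemigroup as CommutativeSemigroupProperties
import Algebra.Properties.Ring as RingProperties
import Algebra.Properties.Semiring.Exp as Exponentiation
open import Data.Bool.Base using (if_then_else_)
open import Data.Fin.Base as Fin using (Fin; zero; suc; toℕ; _↑ˡ_; _↑ʳ_)
import Data.Fin.Properties as Fin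
open import Data.Integer.Base as ℤ using (ℤ; +_; _⊖_)
open import Data.List.Base as List using (List; []; _∷_)
open import Data.Nat.Base as ℕ using (ℕ; zero; suc; _∸_)
import Data.Nat.Properties as ℕ
open import Data.Nat.Divisibility using (_∣_)
open import Data.Product.Base using (_×_; _,_; ∃; ∃₂)
open import Data.Sum.Base using (_⊎_)
import Data.Vec.Base as Vec
open import Data.Vec.Functional as Vector using (Vector; transpose; removeAt; _++_)
open import Function.Bundles using (Inverse)
import Function.Properties.Inverse as Inverse
open import Level using (Level; _⊔_) renaming (suc to lsuc)
open import Relation.Binary.Core using (Rel; _Preserves_⟶_)
open import Relation.Binary.Definitions using (Decidable)
open import Relation.Binary.PropositionalEquality.Core using (_≡_)
import Relation.Binary.PropositionalEquality.Properties as ≡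
import Relation.Binary.Reasoning.Setoid as SetoidReasoning
open import Relation.Nullary.Decidable using (does; via-injection)
open import Relation.Nullary.Negation.Core using (¬_)
open import Relation.Unary using (Pred; _∈_; _⊆_; _∪_; _∩_; _≐_)

-- The library's HeytingField carries an arbitrary apartness relation, from
-- which x ≉ 0# does not yield an inverse.
record FiniteField c ℓ (q : ℕ) : Set (lsuc (c ⊔ ℓ)) where
  field
    commutativeRing : CommutativeRing c ℓ

  open CommutativeRing commutativeRing public

  field
    0≉1         : ¬ (0# ≈ 1#)
    invertible  : ∀ x → ¬ (x ≈ 0#) → ∃ λ y → x * y ≈ 1#
    enumeration : Inverse (≡.setoid (Fin q)) setoid

  element : Fin q → Carrier
  element = Inverse.to enumeration

  infix 4 _≟_

  _≟_ : Decidable _≈_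
  _≟_ = via-injection (Inverse.Inverse⇒Injection (Inverse.sym enumeration)) Fin._≟_

module LinearAlgebra {c ℓ m ℓm} {R : Ring c ℓ} (V : LeftModule R m ℓm) where
  open Ring R using (Carrier; _≈_; 0#)
  open LeftModule V

  combination : ∀ {n} → Vector Carrier n → Vector Carrierᴹ n → Carrierᴹ
  combination a v = Summation.sum +ᴹ-rawMonoid (λ i → a i *ₗ v i)

  LinearlyIndependent : ∀ {n} → Vector Carrierᴹ n → Set (c ⊔ ℓ ⊔ ℓm)
  LinearlyIndependent v = ∀ a → combination a v ≈ᴹ 0ᴹ → ∀ i → a i ≈ 0#

  record IsSubspace {p} (Y : Pred Carrierᴹ p) : Set (c ⊔ m ⊔ ℓm ⊔ p) where
    field
      respects    : ∀ {u v} → u ≈ᴹ v → u ∈ Y → v ∈ Y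
      0-closed    : 0ᴹ ∈ Y
      +-closed    : ∀ {u v} → u ∈ Y → v ∈ Y → u +ᴹ v ∈ Y
      *ₗ-closed   : ∀ a {v} → v ∈ Y → a *ₗ v ∈ Y

  Span : ∀ {p} → Pred Carrierᴹ p → Pred Carrierᴹ (c ⊔ m ⊔ ℓm ⊔ p)
  Span S u = ∃ λ n → ∃₂ λ (a : Vector Carrier n) (v : Vector Carrierᴹ n) →
    (∀ i → v i ∈ S) × u ≈ᴹ combination a v

  HasDimension : ∀ {p} → Pred Carrierᴹ p → ℕ → Set (c ⊔ ℓ ⊔ m ⊔ ℓm ⊔ p)
  HasDimension Y d = ∃ λ (b : Vector Carrierᴹ d) →
    (∀ i → b i ∈ Y) ×
    LinearlyIndependent b ×
    (∀ {u} → u ∈ Y → ∃ λ a → u ≈ᴹ combination a b)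

-- Polynomials are coefficient lists, constant coefficient first; lists that
-- differ by trailing zeros are identified by _≋_.
module Polynomials {c ℓ} (R : CommutativeRing c ℓ) where
  open CommutativeRing R

  Poly : Set c
  Poly = List Carrier

  coeff : Poly → ℕ → Carrier
  coeff []      n       = 0#
  coeff (a ∷ f) zero    = a
  coeff (a ∷ f) (suc n) = coeff f n

  infix 4 _≋_

  _≋_ : Rel Poly ℓ
  f ≋ g = ∀ n → coeff f n ≈ coeff g n

  infixl 6 _⊕_
  infixl 7 _⊗_
  infixr 7 _·_
  infix  8 ⊝_

  _⊕_ : Poly → Poly → Poly
  []      ⊕ g       = g
  (a ∷ f) ⊕ []      = a ∷ f
  (a ∷ f) ⊕ (b ∷ g) = (a + b) ∷ (f ⊕ g)

  _·_ : Carrier → Poly → Poly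
  a · f = List.map (a *_) f

  ⊝_ : Poly → Poly
  ⊝ f = List.map -_ f

  _⊗_ : Poly → Poly → Poly
  []      ⊗ g = []
  (a ∷ f) ⊗ g = a · g ⊕ (0# ∷ f ⊗ g)

  X^_ : ℕ → Poly
  X^ zero  = 1# ∷ []
  X^ suc n = 0# ∷ X^ n

  eval : Poly → Carrier → Carrier
  eval f x = List.foldr (λ a y → a + x * y) 0# f

  private
    open RingProperties ring using (-‿distribˡ-*; -0#≈0#)
    open AbelianGroupProperties +-abelianGroup using (⁻¹-∙-comm)
    open CommutativeSemigroupProperties +-commutativeSemigroup using (interchange)
    open SetoidReasoning setoid

    coeff-⊕ : ∀ f g n → coeff (f ⊕ g) n ≈ coeff f n + coeff g n
    coeff-⊕ []      g       n       = sym (+-identityˡ _)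
    coeff-⊕ (a ∷ f) []      n       = sym (+-identityʳ _)
    coeff-⊕ (a ∷ f) (b ∷ g) zero    = refl
    coeff-⊕ (a ∷ f) (b ∷ g) (suc n) = coeff-⊕ f g n

    coeff-· : ∀ a f n → coeff (a · f) n ≈ a * coeff f n
    coeff-· a []      n       = sym (zeroʳ a)
    coeff-· a (b ∷ f) zero    = refl
    coeff-· a (b ∷ f) (suc n) = coeff-· a f n

    coeff-⊝ : ∀ f n → coeff (⊝ f) n ≈ - coeff f n
    coeff-⊝ []      n       = sym -0#≈0#
    coeff-⊝ (b ∷ f) zero    = refl
    coeff-⊝ (b ∷ f) (suc n) = coeff-⊝ f n

    ∷-cong : ∀ {a b f g} → a ≈ b → f ≋ g → a ∷ f ≋ b ∷ g
    ∷-cong a≈b f≋g zero    = a≈b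
    ∷-cong a≈b f≋g (suc n) = f≋g n

    coeff-⊗ : ∀ a f g n → coeff ((a ∷ f) ⊗ g) n ≈ a * coeff g n + coeff (0# ∷ f ⊗ g) n
    coeff-⊗ a f g n = trans (coeff-⊕ (a · g) (0# ∷ f ⊗ g) n) (+-congʳ (coeff-· a g n))

    ⊗-distribʳ : ∀ h f g → (f ⊕ g) ⊗ h ≋ f ⊗ h ⊕ g ⊗ h
    ⊗-distribʳ h []      g       n = refl
    ⊗-distribʳ h (a ∷ f) []      n = begin
      coeff ((a ∷ f) ⊗ h) n          ≈⟨ +-identityʳ _ ⟨
      coeff ((a ∷ f) ⊗ h) n + 0#     ≈⟨ coeff-⊕ ((a ∷ f) ⊗ h) [] n ⟨
      coeff ((a ∷ f) ⊗ h ⊕ []) n     ∎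
    ⊗-distribʳ h (a ∷ f) (b ∷ g) n = begin
      coeff ((a + b ∷ f ⊕ g) ⊗ h) n
        ≈⟨ coeff-⊗ (a + b) (f ⊕ g) h n ⟩
      (a + b) * coeff h n + coeff (0# ∷ (f ⊕ g) ⊗ h) n
        ≈⟨ +-cong (distribʳ _ a b)
                  (∷-cong (sym (+-identityˡ 0#)) (⊗-distribʳ h f g) n) ⟩
      (a * coeff h n + b * coeff h n) + coeff ((0# ∷ f ⊗ h) ⊕ (0# ∷ g ⊗ h)) n
        ≈⟨ +-congˡ (coeff-⊕ (0# ∷ f ⊗ h) (0# ∷ g ⊗ h) n) ⟩
      (a * coeff h n + b * coeff h n) + (coeff (0# ∷ f ⊗ h) n + coeff (0# ∷ g ⊗ h) n)
        ≈⟨ interchange _ _ _ _ ⟩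
      (a * coeff h n + coeff (0# ∷ f ⊗ h) n) + (b * coeff h n + coeff (0# ∷ g ⊗ h) n)
        ≈⟨ +-cong (coeff-⊗ a f h n) (coeff-⊗ b g h n) ⟨
      coeff ((a ∷ f) ⊗ h) n + coeff ((b ∷ g) ⊗ h) n
        ≈⟨ coeff-⊕ ((a ∷ f) ⊗ h) ((b ∷ g) ⊗ h) n ⟨
      coeff ((a ∷ f) ⊗ h ⊕ (b ∷ g) ⊗ h) n ∎

    ·-⊗ : ∀ a f g → (a · f) ⊗ g ≋ a · (f ⊗ g)
    ·-⊗ a []      g n = refl
    ·-⊗ a (b ∷ f) g n = begin
      coeff ((a * b ∷ a · f) ⊗ g) n
        ≈⟨ coeff-⊗ (a * b) (a · f) g n ⟩
      a * b * coeff g n + coeff (0# ∷ (a · f) ⊗ g) n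
        ≈⟨ +-cong (*-assoc a b _) (∷-cong (sym (zeroʳ a)) (·-⊗ a f g) n) ⟩
      a * (b * coeff g n) + coeff (a · (0# ∷ f ⊗ g)) n
        ≈⟨ +-congˡ (coeff-· a (0# ∷ f ⊗ g) n) ⟩
      a * (b * coeff g n) + a * coeff (0# ∷ f ⊗ g) n
        ≈⟨ distribˡ a _ _ ⟨
      a * (b * coeff g n + coeff (0# ∷ f ⊗ g) n)
        ≈⟨ *-congˡ (coeff-⊗ b f g n) ⟨
      a * coeff ((b ∷ f) ⊗ g) n
        ≈⟨ coeff-· a ((b ∷ f) ⊗ g) n ⟨
      coeff (a · ((b ∷ f) ⊗ g)) n ∎

    ⊝-⊗ : ∀ f g → (⊝ f) ⊗ g ≋ ⊝ (f ⊗ g)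
    ⊝-⊗ []      g n = refl
    ⊝-⊗ (b ∷ f) g n = begin
      coeff ((- b ∷ ⊝ f) ⊗ g) n
        ≈⟨ coeff-⊗ (- b) (⊝ f) g n ⟩
      - b * coeff g n + coeff (0# ∷ (⊝ f) ⊗ g) n
        ≈⟨ +-cong (sym (-‿distribˡ-* b _)) (∷-cong (sym -0#≈0#) (⊝-⊗ f g) n) ⟩
      - (b * coeff g n) + coeff (⊝ (0# ∷ f ⊗ g)) n
        ≈⟨ +-congˡ (coeff-⊝ (0# ∷ f ⊗ g) n) ⟩
      - (b * coeff g n) + - coeff (0# ∷ f ⊗ g) n
        ≈⟨ ⁻¹-∙-comm _ _ ⟩
      - (b * coeff g n + coeff (0# ∷ f ⊗ g) n)
        ≈⟨ -‿cong (coeff-⊗ b f g n) ⟨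
      - coeff ((b ∷ f) ⊗ g) n
        ≈⟨ coeff-⊝ ((b ∷ f) ⊗ g) n ⟨
      coeff (⊝ ((b ∷ f) ⊗ g)) n ∎

  record _≈_mod_ (f g m : Poly) : Set (c ⊔ ℓ) where
    constructor congruent
    field
      multiplier : Poly
      equation   : f ≋ g ⊕ multiplier ⊗ m

  -- The quotient of the polynomials by the ideal (m), as a module.
  quotient : Poly → LeftModule ring c (c ⊔ ℓ)
  quotient m = record
    { Carrierᴹ     = Poly
    ; _≈ᴹ_         = λ f g → f ≈ g mod m
    ; _+ᴹ_         = _⊕_
    ; _*ₗ_         = _·_
    ; 0ᴹ           = []
    ; -ᴹ_          = ⊝_
    ; isLeftModule = record
      { isLeftSemimodule = record
        { +ᴹ-isCommutativeMonoid = record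
          { isMonoid = record
            { isSemigroup = record
              { isMagma = record
                { isEquivalence = record
                  { refl = λ {f} → lift f f λ n → refl ; sym = mod-sym ; trans = mod-trans }
                ; ∙-cong = ⊕-cong
                }
              ; assoc = λ f g h → lift (f ⊕ g ⊕ h) (f ⊕ (g ⊕ h)) (⊕-assoc f g h)
              }
            ; identity = (λ f → lift ([] ⊕ f) f λ n → refl)
                       , (λ f → lift (f ⊕ []) f (⊕-identityʳ f))
            }
          ; comm = λ f g → lift (f ⊕ g) (g ⊕ f) (⊕-comm f g)
          }
        ; isPreleftSemimodule = record
          { *ₗ-cong      = ·-cong
          ; *ₗ-zeroˡ     = λ f → lift (0# · f) [] λ n → trans (coeff-· 0# f n) (zeroˡ _)
          ; *ₗ-distribʳ  = λ f a b → lift ((a + b) · f) (a · f ⊕ b · f) (·-distribʳ f a b)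
          ; *ₗ-identityˡ = λ f → lift (1# · f) f λ n → trans (coeff-· 1# f n) (*-identityˡ _)
          ; *ₗ-assoc     = λ a b f → lift ((a * b) · f) (a · b · f) (·-assoc a b f)
          ; *ₗ-zeroʳ     = λ a → lift [] [] λ n → refl
          ; *ₗ-distribˡ  = λ a f g → lift (a · (f ⊕ g)) (a · f ⊕ a · g) (·-distribˡ a f g)
          }
        }
      ; -ᴹ‿cong    = ⊝-cong
      ; -ᴹ‿inverse = (λ f → lift (⊝ f ⊕ f) [] (⊝-inverseˡ f))
                   , (λ f → lift (f ⊕ ⊝ f) [] (⊝-inverseʳ f))
      }
    }
    where
    ⊕-identityʳ : ∀ f → f ⊕ [] ≋ f
    ⊕-identityʳ f n = trans (coeff-⊕ f [] n) (+-identityʳ _)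

    lift : ∀ f g → f ≋ g → f ≈ g mod m
    lift f g f≋g = congruent [] λ n → trans (f≋g n) (sym (⊕-identityʳ g n))

    split : ∀ {f g} h → f ≋ g ⊕ h ⊗ m → ∀ n → coeff f n ≈ coeff g n + coeff (h ⊗ m) n
    split {g = g} h eq n = trans (eq n) (coeff-⊕ g (h ⊗ m) n)

    join : ∀ {f g} h → (∀ n → coeff f n ≈ coeff g n + coeff (h ⊗ m) n) → f ≈ g mod m
    join {g = g} h eq = congruent h λ n → trans (eq n) (sym (coeff-⊕ g (h ⊗ m) n))

    mod-sym : ∀ {f g} → f ≈ g mod m → g ≈ f mod m
    mod-sym {f} {g} (congruent h eq) = join {g} {f} (⊝ h) λ n → begin
      coeff g n
        ≈⟨ +-identityʳ _ ⟨
      coeff g n + 0#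
        ≈⟨ +-congˡ (-‿inverseʳ _) ⟨
      coeff g n + (coeff (h ⊗ m) n + - coeff (h ⊗ m) n)
        ≈⟨ +-assoc _ _ _ ⟨
      coeff g n + coeff (h ⊗ m) n + - coeff (h ⊗ m) n
        ≈⟨ +-cong (split {f} {g} h eq n) (trans (⊝-⊗ h m n) (coeff-⊝ (h ⊗ m) n)) ⟨
      coeff f n + coeff ((⊝ h) ⊗ m) n ∎

    mod-trans : ∀ {f g k} → f ≈ g mod m → g ≈ k mod m → f ≈ k mod m
    mod-trans {f} {g} {k} (congruent h eq) (congruent h′ eq′) = join {f} {k} (h′ ⊕ h) λ n → begin
      coeff f n
        ≈⟨ split {f} {g} h eq n ⟩
      coeff g n + coeff (h ⊗ m) n
        ≈⟨ +-congʳ (split {g} {k} h′ eq′ n) ⟩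
      coeff k n + coeff (h′ ⊗ m) n + coeff (h ⊗ m) n
        ≈⟨ +-assoc _ _ _ ⟩
      coeff k n + (coeff (h′ ⊗ m) n + coeff (h ⊗ m) n)
        ≈⟨ +-congˡ (trans (⊗-distribʳ m h′ h n) (coeff-⊕ (h′ ⊗ m) (h ⊗ m) n)) ⟨
      coeff k n + coeff ((h′ ⊕ h) ⊗ m) n ∎

    ⊕-cong : ∀ {f f′ g g′} → f ≈ f′ mod m → g ≈ g′ mod m → (f ⊕ g) ≈ (f′ ⊕ g′) mod m
    ⊕-cong {f} {f′} {g} {g′} (congruent h eq) (congruent h′ eq′) =
      join {f ⊕ g} {f′ ⊕ g′} (h ⊕ h′) λ n → begin
      coeff (f ⊕ g) n
        ≈⟨ coeff-⊕ f g n ⟩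
      coeff f n + coeff g n
        ≈⟨ +-cong (split {f} {f′} h eq n) (split {g} {g′} h′ eq′ n) ⟩
      (coeff f′ n + coeff (h ⊗ m) n) + (coeff g′ n + coeff (h′ ⊗ m) n)
        ≈⟨ interchange _ _ _ _ ⟩
      (coeff f′ n + coeff g′ n) + (coeff (h ⊗ m) n + coeff (h′ ⊗ m) n)
        ≈⟨ +-cong (coeff-⊕ f′ g′ n)
                  (trans (⊗-distribʳ m h h′ n) (coeff-⊕ (h ⊗ m) (h′ ⊗ m) n)) ⟨
      coeff (f′ ⊕ g′) n + coeff ((h ⊕ h′) ⊗ m) n ∎

    ⊝-cong : ∀ {f g} → f ≈ g mod m → (⊝ f) ≈ (⊝ g) mod m
    ⊝-cong {f} {g} (congruent h eq) = join {⊝ f} {⊝ g} (⊝ h) λ n → begin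
      coeff (⊝ f) n
        ≈⟨ coeff-⊝ f n ⟩
      - coeff f n
        ≈⟨ -‿cong (split {f} {g} h eq n) ⟩
      - (coeff g n + coeff (h ⊗ m) n)
        ≈⟨ ⁻¹-∙-comm _ _ ⟨
      - coeff g n + - coeff (h ⊗ m) n
        ≈⟨ +-cong (coeff-⊝ g n) (trans (⊝-⊗ h m n) (coeff-⊝ (h ⊗ m) n)) ⟨
      coeff (⊝ g) n + coeff ((⊝ h) ⊗ m) n ∎

    ·-cong : ∀ {a b f g} → a ≈ b → f ≈ g mod m → (a · f) ≈ (b · g) mod m
    ·-cong {a} {b} {f} {g} a≈b (congruent h eq) = join {a · f} {b · g} (b · h) λ n → begin
      coeff (a · f) n
        ≈⟨ coeff-· a f n ⟩
      a * coeff f n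
        ≈⟨ *-cong a≈b (split {f} {g} h eq n) ⟩
      b * (coeff g n + coeff (h ⊗ m) n)
        ≈⟨ distribˡ b _ _ ⟩
      b * coeff g n + b * coeff (h ⊗ m) n
        ≈⟨ +-cong (coeff-· b g n) (trans (·-⊗ b h m n) (coeff-· b (h ⊗ m) n)) ⟨
      coeff (b · g) n + coeff ((b · h) ⊗ m) n ∎

    ⊕-assoc : ∀ f g h → f ⊕ g ⊕ h ≋ f ⊕ (g ⊕ h)
    ⊕-assoc f g h n = begin
      coeff (f ⊕ g ⊕ h) n                     ≈⟨ coeff-⊕ (f ⊕ g) h n ⟩
      coeff (f ⊕ g) n + coeff h n             ≈⟨ +-congʳ (coeff-⊕ f g n) ⟩
      coeff f n + coeff g n + coeff h n       ≈⟨ +-assoc _ _ _ ⟩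
      coeff f n + (coeff g n + coeff h n)     ≈⟨ +-congˡ (coeff-⊕ g h n) ⟨
      coeff f n + coeff (g ⊕ h) n             ≈⟨ coeff-⊕ f (g ⊕ h) n ⟨
      coeff (f ⊕ (g ⊕ h)) n                   ∎

    ⊕-comm : ∀ f g → f ⊕ g ≋ g ⊕ f
    ⊕-comm f g n = begin
      coeff (f ⊕ g) n         ≈⟨ coeff-⊕ f g n ⟩
      coeff f n + coeff g n   ≈⟨ +-comm _ _ ⟩
      coeff g n + coeff f n   ≈⟨ coeff-⊕ g f n ⟨
      coeff (g ⊕ f) n         ∎

    ⊝-inverseˡ : ∀ f → ⊝ f ⊕ f ≋ []
    ⊝-inverseˡ f n = begin
      coeff (⊝ f ⊕ f) n         ≈⟨ coeff-⊕ (⊝ f) f n ⟩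
      coeff (⊝ f) n + coeff f n ≈⟨ +-congʳ (coeff-⊝ f n) ⟩
      - coeff f n + coeff f n   ≈⟨ -‿inverseˡ _ ⟩
      0#                        ∎

    ⊝-inverseʳ : ∀ f → f ⊕ ⊝ f ≋ []
    ⊝-inverseʳ f n = trans (⊕-comm f (⊝ f) n) (⊝-inverseˡ f n)

    ·-assoc : ∀ a b f → (a * b) · f ≋ a · b · f
    ·-assoc a b f n = begin
      coeff ((a * b) · f) n   ≈⟨ coeff-· (a * b) f n ⟩
      a * b * coeff f n       ≈⟨ *-assoc a b _ ⟩
      a * (b * coeff f n)     ≈⟨ *-congˡ (coeff-· b f n) ⟨
      a * coeff (b · f) n     ≈⟨ coeff-· a (b · f) n ⟨
      coeff (a · b · f) n     ∎

    ·-distribʳ : ∀ f a b → (a + b) · f ≋ a · f ⊕ b · f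
    ·-distribʳ f a b n = begin
      coeff ((a + b) · f) n                 ≈⟨ coeff-· (a + b) f n ⟩
      (a + b) * coeff f n                   ≈⟨ distribʳ _ a b ⟩
      a * coeff f n + b * coeff f n         ≈⟨ +-cong (coeff-· a f n) (coeff-· b f n) ⟨
      coeff (a · f) n + coeff (b · f) n     ≈⟨ coeff-⊕ (a · f) (b · f) n ⟨
      coeff (a · f ⊕ b · f) n               ∎

    ·-distribˡ : ∀ a f g → a · (f ⊕ g) ≋ a · f ⊕ a · g
    ·-distribˡ a f g n = begin
      coeff (a · (f ⊕ g)) n                 ≈⟨ coeff-· a (f ⊕ g) n ⟩
      a * coeff (f ⊕ g) n                   ≈⟨ *-congˡ (coeff-⊕ f g n) ⟩
      a * (coeff f n + coeff g n)           ≈⟨ distribˡ a _ _ ⟩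
      a * coeff f n + a * coeff g n         ≈⟨ +-cong (coeff-· a f n) (coeff-· a g n) ⟨
      coeff (a · f) n + coeff (a · g) n     ≈⟨ coeff-⊕ (a · f) (a · g) n ⟨
      coeff (a · f ⊕ a · g) n               ∎

module Codes {c ℓ q} (F : FiniteField c ℓ q) where
  open FiniteField F hiding (zero)
  open Summation +-rawMonoid using (sum)
  open Exponentiation semiring using (_^_)

  Matrix : ℕ → ℕ → Set c
  Matrix m n = Vector (Vector Carrier n) m

  columnSpace : ℕ → LeftModule ring c ℓ
  columnSpace n = record
    { Carrierᴹ     = Vector Carrier n
    ; _≈ᴹ_         = λ u v → ∀ i → u i ≈ v i
    ; _+ᴹ_         = λ u v i → u i + v i
    ; _*ₗ_         = λ a v i → a * v i
    ; 0ᴹ           = λ i → 0#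
    ; -ᴹ_          = λ v i → - v i
    ; isLeftModule = record
      { isLeftSemimodule = record
        { +ᴹ-isCommutativeMonoid = record
          { isMonoid = record
            { isSemigroup = record
              { isMagma = record
                { isEquivalence = record
                  { refl  = λ i → refl
                  ; sym   = λ u≈v i → sym (u≈v i)
                  ; trans = λ u≈v v≈w i → trans (u≈v i) (v≈w i)
                  }
                ; ∙-cong = λ u≈v w≈x i → +-cong (u≈v i) (w≈x i)
                }
              ; assoc = λ u v w i → +-assoc (u i) (v i) (w i)
              }
            ; identity = (λ v i → +-identityˡ (v i)) , (λ v i → +-identityʳ (v i))
            }
          ; comm = λ u v i → +-comm (u i) (v i)
          }
        ; isPreleftSemimodule = record
          { *ₗ-cong      = λ a≈b u≈v i → *-cong a≈b (u≈v i)
          ; *ₗ-zeroˡ     = λ v i → zeroˡ (v i)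
          ; *ₗ-distribʳ  = λ v a b i → distribʳ (v i) a b
          ; *ₗ-identityˡ = λ v i → *-identityˡ (v i)
          ; *ₗ-assoc     = λ a b v i → *-assoc a b (v i)
          ; *ₗ-zeroʳ     = λ a i → zeroʳ a
          ; *ₗ-distribˡ  = λ a u v i → distribˡ a (u i) (v i)
          }
        }
      ; -ᴹ‿cong    = λ u≈v i → -‿cong (u≈v i)
      ; -ᴹ‿inverse = (λ v i → -‿inverseˡ (v i)) , (λ v i → -‿inverseʳ (v i))
      }
    }

  -- A set of m out of n columns, listed in increasing order.
  StrictlyIncreasing : ∀ {m n} → (Fin m → Fin n) → Set
  StrictlyIncreasing f = f Preserves Fin._<_ ⟶ Fin._<_

  IsMDS : ∀ {k n} → Matrix k n → Set (c ⊔ ℓ)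
  IsMDS {k} {n} M = (f : Fin k → Fin n) → StrictlyIncreasing f →
    LinearAlgebra.LinearlyIndependent (columnSpace k) (λ j → transpose M (f j))

  MaximumWidth : ℕ → ℕ → Set (c ⊔ ℓ)
  MaximumWidth k n =
    (∃ λ (M : Matrix k n) → IsMDS M) ×
    (∀ n′ (M : Matrix k n′) → IsMDS M → n′ ℕ.≤ n)

  infixl 7 _ᵥ*_

  _ᵥ*_ : ∀ {k n} → Vector Carrier k → Matrix k n → Vector Carrier n
  (L ᵥ* M) j = sum (λ i → L i * M i j)

  zeros : ∀ {n} → Vector Carrier n → ℕ
  zeros v = Vec.count (_≟ 0#) (Vec.tabulate v)

  HasCombinationWithZeros : ∀ {k n} → Matrix k n → ℕ → Set (c ⊔ ℓ)
  HasCombinationWithZeros {k} M z = ∃ λ (L : Vector Carrier k) →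
    ¬ (∀ i → L i ≈ 0#) × z ℕ.≤ zeros (L ᵥ* M)

  -- The entry with (zero-based) index j is 1#, the others are 0#.
  unit : ∀ {n} → ℕ → Vector Carrier n
  unit j i = if does (toℕ i ℕ.≟ j) then 1# else 0#

  -- Laplace expansion along the first row.
  det : ∀ {n} → Matrix n n → Carrier
  det {zero}  M = 1#
  det {suc n} M =
    sum (λ j → (- 1#) ^ toℕ j * M zero j * det (λ i → removeAt (M (suc i)) j))

  reedSolomon : ∀ s → Matrix s q
  reedSolomon s i j = element j ^ toℕ i

  𝒫 : LeftModule ring c (c ⊔ ℓ)
  𝒫 = quotient (X^ q ⊕ ⊝ X^ 1)
    where open Polynomials commutativeRing

  open LeftModule 𝒫 using (Carrierᴹ; _≈ᴹ_; 0ᴹ)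
  open Polynomials commutativeRing using (eval)

  -- Each root is counted once, as the elements of F are enumerated without
  -- repetition; the count is independent of the representative f of a class of
  -- 𝒫 because every element of F is a root of x^q − x.
  roots : Carrierᴹ → ℕ
  roots f = zeros (λ j → eval f (element j))

  𝒪 : ℤ → Pred Carrierᴹ (c ⊔ ℓ)
  𝒪 n f = f ≈ᴹ 0ᴹ ⊎ + roots f ℤ.≤ n

  module _ (k : ℕ) where

    Exceptional : Set
    Exceptional = 2 ∣ q × (k ≡ 3 ⊎ k ≡ q ∸ 1)

    Statement₁ : Set (c ⊔ ℓ)
    Statement₁ =
      (¬ Exceptional → MaximumWidth k (1 ℕ.+ q)) ×
      (Exceptional → MaximumWidth k (2 ℕ.+ q))

    Statement₂ : Set (c ⊔ ℓ)
    Statement₂ = (M′ : Matrix k (2 ℕ.+ q)) → HasCombinationWithZeros M′ k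

    Statement₃ : Set (c ⊔ ℓ)
    Statement₃ = (M′ : Matrix k (2 ℕ.+ q)) →
      (∀ i → M′ i zero ≈ unit 0 i) →
      (∀ i → M′ i (suc zero) ≈ unit 1 i) →
      HasCombinationWithZeros M′ k

    -- m ⊖ n is the integer difference of the natural numbers m and n.
    Statement₄ : ∀ p → Set (c ⊔ ℓ ⊔ lsuc p)
    Statement₄ p = ¬ (∃₂ λ (Y Z : Pred Carrierᴹ p) →
      IsSubspace Y × IsSubspace Z × ¬ (Y ≐ Z) ×
      HasDimension (Span (Y ∪ Z)) k ×
      HasDimension Y (k ∸ 1) × HasDimension Z (k ∸ 1) ×
      Span (Y ∪ Z) ⊆ 𝒪 (k ⊖ 1) ×
      (Y ∪ Z) ⊆ 𝒪 (k ⊖ 2) ×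
      (Y ∩ Z) ⊆ 𝒪 (k ⊖ 3))
      where open LinearAlgebra 𝒫

    Statement₅ : Set (c ⊔ ℓ)
    Statement₅ = ¬ (∃ λ s → k ℕ.< s × s ℕ.≤ q ×
      ∃ λ (b : Vector (Vector Carrier s) (s ∸ k ℕ.+ 2)) →
        let R∪B = transpose (transpose (reedSolomon s) ++ b) in
        ((f : Fin s → Fin (q ℕ.+ (s ∸ k ℕ.+ 2))) → StrictlyIncreasing f →
          (∀ (i : Fin (s ∸ k)) → ∃ λ j → f j ≡ q ↑ʳ (i ↑ˡ 2)) →
          ¬ (det (λ i j → R∪B i (f j)) ≈ 0#)) ×
        LinearAlgebra.LinearlyIndependent (columnSpace s)
          (b ++ (unit (s ∸ 1) Vector.∷ Vector.[])))

{-# OPTIONS --safe #-}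

-- A k × n matrix is MDS iff no nontrivial combination of its rows has k zeros, so (1), (2) and (3)
-- all say that no k × (q + 2) matrix is MDS; the extended Reed-Solomon code has width q + 1.
--
-- (2) ⇒ (5): a basis of the vectors orthogonal to b₁, …, b_{s−k} projects the other q + 2 columns of
-- R ∪ B to F^k. A combination with k zeros lifts to a row vanishing on s columns of R ∪ B.
--
-- (5) ⇒ (2): for k = 2 and k = q the q nonzero ratios of two entries cannot be distinct. Otherwise
-- take s = q. The rows of an MDS matrix, restricted to the last q columns, are the values of
-- polynomials which span a k-dimensional space W. Let b₁, …, b_{s−k} be a basis of the
-- annihilator of W, and let b_{s−k+1}, b_{s−k+2} represent the functionals on W given by the first
-- two columns. Condition (b) says that these functionals and the leading coefficient are
-- independent on W, which is achieved by scaling one column of the matrix.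
--
-- (2) ⇒ (4): Y and Z are the kernels of functionals η and ζ on W = ⟨Y, Z⟩. Apply (2) to the matrix
-- with columns η, ζ and the values of a basis of W.
module Submission where

open import Defs
open import Algebra.Bundles using (CommutativeMonoid)
open import Algebra.Module.Bundles using (LeftModule)
import Algebra.Properties.CommutativeSemigroup as CommutativeSemigroupProperties
import Algebra.Properties.Group as GroupProperties
import Algebra.Properties.Ring as RingProperties
import Algebra.Properties.Semiring.Exp as Exponentiation
import Algebra.Properties.Semiring.Sum as SemiringSum
import Algebra.Solver.Ring.NaturalCoefficients.Default as SemiringSolver
open import Data.Bool.Base using (if_then_else_)
open import Data.Empty using (⊥)
open import Data.Fin.Base as Fin using (Fin; zero; suc; toℕ; fromℕ; fromℕ<; inject₁; inject≤;
  splitAt; cast; _↑ˡ_; _↑ʳ_; punchIn; punchOut; funToFin; finToFun)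
open import Data.Fin.Induction using (>-weakInduction)
import Data.Fin.Permutation.Components as Permutation
import Data.Fin.Properties as Fin
open import Data.Integer.Base as ℤ using (+_; _⊖_)
import Data.Integer.Properties as ℤ
open import Data.List.Base using (_∷_; [])
open import Data.Nat.Base as ℕ using (ℕ; zero; suc; z≤n; s≤s)
open import Data.Nat.Divisibility using (_∣_)
open import Data.Nat.Primality using (Prime)
import Data.Nat.Properties as ℕ
open import Data.Product.Base using (_×_; _,_; ∃; ∃₂; proj₁; proj₂)
open import Data.Sum.Base as Sum using (_⊎_; inj₁; inj₂; [_,_]′)
open import Data.Sum.Properties using (inj₁-injective; inj₂-injective)
import Data.Vec.Base as Vec
open import Data.Vec.Functional as Vector using (Vector; transpose; removeAt; _++_)
open import Data.Vec.Functional.Properties using (lookup-++ˡ; lookup-++ʳ)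
open import Function.Base using (_∘_)
open import Function.Bundles using (Inverse; _⇔_; mk⇔)
open import Function.Definitions using (Injective)
open import Level using (Level; _⊔_)
open import Relation.Binary.Core using (_Preserves_⟶_)
open import Relation.Binary.Definitions using (tri<; tri≈; tri>)
open import Relation.Binary.PropositionalEquality as ≡ using (_≡_; _≢_)
import Relation.Binary.Reasoning.Setoid as SetoidReasoning
open import Relation.Nullary.Decidable using (Dec; does; yes; no; map′; ¬?; _×-dec_;
  decidable-stable; dec-true; dec-false)
open import Relation.Nullary.Negation using (¬_; contradiction)
open import Relation.Unary using (Pred; Decidable; _∈_; _⊆_; _∪_; _∩_)

-- For k = 2 and k = q statement (5) holds vacuously: condition (b) asks for s + 1 independent
-- vectors of length s, or there is no s at all. This is why (2) is proved outright in these two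
-- cases.
--
-- For 2 < k < q, the choice s = q makes R invertible, so any k rows of length q are the values of
-- polynomials. The obstacle is (b), since the leading coefficient may depend on the first two
-- functionals. Multiplying columns by nonzero factors keeps the zeros of every combination but
-- changes the polynomials; a factor other than 0 and 1 exists because q > k ≥ 3. Condition (a) is a
-- matter of annihilators: a row that kills b₁, ..., b_{s-k} lies in W again, so a vanishing minor
-- is a combination of the MDS matrix with too many zeros.
--
-- Everything is constructive. Equality in F is decidable and vectors of a given length can be
-- searched, so a combination is obtained by refuting its absence, and kernels come from the
-- pigeonhole principle. Determinants enter only through the fact that they vanish exactly for
-- singular matrices.

-- Increasing enumerations and sorting in finite sets.

increasing⇒injective : ∀ {m n} {f : Fin m → Fin n} →
  f Preserves Fin._<_ ⟶ Fin._<_ → Injective _≡_ _≡_ f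
increasing⇒injective f-mono {x} {y} fx≡fy with Fin.<-cmp x y
... | tri< x<y _ _ = contradiction fx≡fy (Fin.<⇒≢ (f-mono x<y))
... | tri≈ _ x≡y _ = x≡y
... | tri> _ _ y<x = contradiction (≡.sym fx≡fy) (Fin.<⇒≢ (f-mono y<x))

-- A count such as `zeros` is only a number. This recovers the counted positions, in increasing
-- order because `IsMDS` and the minors of (5) list columns that way.
record Enumeration {p n} (P : Pred (Fin n) p) (z : ℕ) : Set p where
  field
    position   : Fin z → Fin n
    increasing : position Preserves Fin._<_ ⟶ Fin._<_
    sound      : ∀ i → P (position i)
    complete   : ∀ j → P j → ∃ λ i → position i ≡ j

  injective : Injective _≡_ _≡_ position
  injective = increasing⇒injective increasing

  ≥-injective : ∀ {m} {g : Fin m → Fin n} → Injective _≡_ _≡_ g → (∀ i → P (g i)) → m ℕ.≤ z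
  ≥-injective {g = g} g-inj Pg = Fin.injective⇒≤ {f = λ i → proj₁ (complete (g i) (Pg i))} λ {i} {j} eq →
    g-inj (≡.trans (≡.sym (proj₂ (complete (g i) (Pg i))))
          (≡.trans (≡.cong position eq) (proj₂ (complete (g j) (Pg j)))))

count-enumeration : ∀ {a p} {A : Set a} {P : Pred A p} (P? : Decidable P) {n} (v : Vector A n) →
  Enumeration (P ∘ v) (Vec.count P? (Vec.tabulate v))
count-enumeration P? {zero} v = record
  { position = λ () ; increasing = λ { {()} } ; sound = λ () ; complete = λ () }
count-enumeration P? {suc n} v with P? (v zero) | count-enumeration P? (v ∘ suc)
... | yes Pv₀ | e = record
  { position   = λ { zero → zero ; (suc i) → suc (position i) }
  ; increasing = λ { {zero} {suc j} _ → s≤s z≤n ; {suc i} {suc j} (s≤s i<j) → s≤s (increasing i<j) }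
  ; sound      = λ { zero → Pv₀ ; (suc i) → sound i }
  ; complete   = λ { zero _ → zero , ≡.refl
                   ; (suc j) Pj → let i , eq = complete j Pj in suc i , ≡.cong suc eq }
  }
  where open Enumeration e
... | no ¬Pv₀ | e = record
  { position   = suc ∘ position
  ; increasing = s≤s ∘ increasing
  ; sound      = sound
  ; complete   = λ { zero Pv₀ → contradiction Pv₀ ¬Pv₀
                   ; (suc j) Pj → let i , eq = complete j Pj in i , ≡.cong suc eq }
  }
  where open Enumeration e

Sorting : ∀ {m n} → (Fin m → Fin n) → Set
Sorting {m} {n} g = ∃ λ (f : Fin m → Fin n) → f Preserves Fin._<_ ⟶ Fin._<_ ×
  (∀ i → ∃ λ j → g j ≡ f i) × (∀ j → ∃ λ i → f i ≡ g j)

-- The image of `g` is enumerated in increasing order by some `Fin z`. Choosing preimages injects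
-- `Fin z` into `Fin m`, and `g` itself gives an injection back, so z = m.
sort : ∀ {m n} (g : Fin m → Fin n) → Injective _≡_ _≡_ g → Sorting g
sort {m} {n} g g-inj = reindex (ℕ.≤-antisym (Fin.injective⇒≤ {f = preimage} preimage-injective)
                                            (≥-injective g-inj (λ i → i , ≡.refl))) e
  where
  image? : Decidable (λ k → ∃ λ j → g j ≡ k)
  image? k = Fin.any? (λ j → g j Fin.≟ k)

  e = count-enumeration image? {n} (λ k → k)
  open Enumeration e using (sound; injective; ≥-injective)

  preimage = proj₁ ∘ sound

  preimage-injective : Injective _≡_ _≡_ preimage
  preimage-injective {i} {j} eq =
    injective (≡.trans (≡.sym (proj₂ (sound i))) (≡.trans (≡.cong g eq) (proj₂ (sound j))))

  reindex : ∀ {z} → z ≡ m → Enumeration (λ k → ∃ λ j → g j ≡ k) z → Sorting g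
  reindex ≡.refl e′ = position , increasing , sound′ , λ j → complete (g j) (j , ≡.refl)
    where open Enumeration e′ renaming (sound to sound′)

funToFin-cong : ∀ {m n} {f g : Fin m → Fin n} → (∀ i → f i ≡ g i) → funToFin f ≡ funToFin g
funToFin-cong {zero}  f≗g = ≡.refl
funToFin-cong {suc m} f≗g = ≡.cong₂ Fin.combine (f≗g zero) (funToFin-cong (f≗g ∘ suc))

-- Finite fields: indices of elements, cancellation and coinciding ratios.

module FieldProperties {c ℓ q} (F : FiniteField c ℓ q) where
  open FiniteField F hiding (zero)
  open SetoidReasoning setoid

  index : Carrier → Fin q
  index = Inverse.from enumeration

  element-index : ∀ x → element (index x) ≈ x
  element-index = Inverse.strictlyInverseˡ enumeration

  index-element : ∀ a → index (element a) ≡ a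
  index-element = Inverse.strictlyInverseʳ enumeration

  element-injective : ∀ {a b} → element a ≈ element b → a ≡ b
  element-injective {a} {b} eq = ≡.trans (≡.sym (index-element a))
    (≡.trans (Inverse.from-cong enumeration eq) (index-element b))

  index-injective : ∀ {x y} → index x ≡ index y → x ≈ y
  index-injective {x} {y} eq = begin
    x                  ≈⟨ element-index x ⟨
    element (index x)  ≡⟨ ≡.cong element eq ⟩
    element (index y)  ≈⟨ element-index y ⟩
    y                  ∎

  1<q : 1 ℕ.< q
  1<q = ℕ.≰⇒> λ q≤1 → 0≉1 (index-injective (irrelevant q≤1 (index 0#) (index 1#)))
    where
    irrelevant : ∀ {m} → m ℕ.≤ 1 → (a b : Fin m) → a ≡ b
    irrelevant (s≤s z≤n) zero zero = ≡.refl

  *-cancel-0 : ∀ {x y} → ¬ (x ≈ 0#) → x * y ≈ 0# → y ≈ 0#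
  *-cancel-0 {x} {y} x≉0 xy≈0 = let x⁻¹ , xx⁻¹≈1 = invertible x x≉0 in begin
    y                ≈⟨ *-identityˡ y ⟨
    1# * y           ≈⟨ *-congʳ (trans (*-comm x⁻¹ x) xx⁻¹≈1) ⟨
    x⁻¹ * x * y      ≈⟨ *-assoc x⁻¹ x y ⟩
    x⁻¹ * (x * y)    ≈⟨ *-congˡ xy≈0 ⟩
    x⁻¹ * 0#         ≈⟨ zeroʳ x⁻¹ ⟩
    0#               ∎

  *-nonzero : ∀ {x y} → ¬ (x ≈ 0#) → ¬ (y ≈ 0#) → ¬ (x * y ≈ 0#)
  *-nonzero x≉0 y≉0 xy≈0 = y≉0 (*-cancel-0 x≉0 xy≈0)

  x+y≈0⇒y≈0 : ∀ {x y} → x ≈ 0# → x + y ≈ 0# → y ≈ 0#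
  x+y≈0⇒y≈0 {x} {y} x≈0 eq = trans (sym (+-identityˡ y)) (trans (+-congʳ (sym x≈0)) eq)

  x+y≈0⇒x≈0 : ∀ {x y} → y ≈ 0# → x + y ≈ 0# → x ≈ 0#
  x+y≈0⇒x≈0 {x} {y} y≈0 eq = x+y≈0⇒y≈0 y≈0 (trans (+-comm y x) eq)

  -- The q ratios x i / y i are nonzero, so they take at most q − 1 values.
  equal-ratios : (x y : Vector Carrier q) → (∀ i → ¬ (x i ≈ 0#)) → (∀ i → ¬ (y i ≈ 0#)) →
    ∃ λ i → ∃ λ j → i ≢ j × x i * y j ≈ x j * y i
  equal-ratios x y x≉0 y≉0 with Fin.pigeonhole ℕ.≤-refl (index ∘ (0# Vector.∷ ratio))
    where
    ratio : Vector Carrier q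
    ratio i = x i * proj₁ (invertible (y i) (y≉0 i))
  ... | zero  , suc j , _ , eq = contradiction ratio≈0 (*-nonzero (x≉0 j) y⁻¹≉0)
    where
    ratio≈0 = sym (index-injective eq)
    y⁻¹≉0 : ¬ (proj₁ (invertible (y j) (y≉0 j)) ≈ 0#)
    y⁻¹≉0 y⁻¹≈0 = 0≉1 (begin
      0#        ≈⟨ zeroʳ (y j) ⟨
      y j * 0#  ≈⟨ *-congˡ y⁻¹≈0 ⟨
      y j * _   ≈⟨ proj₂ (invertible (y j) (y≉0 j)) ⟩
      1#        ∎)
  ... | suc i , suc j , s≤s i<j , eq = i , j , Fin.<⇒≢ i<j , (begin
    x i * y j                      ≈⟨ *-identityʳ _ ⟨
    x i * y j * 1#                 ≈⟨ *-congˡ yᵢyᵢ⁻¹≈1 ⟨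
    x i * y j * (y i * yᵢ⁻¹)       ≈⟨ solve 4 (λ a b c d → a :* b :* (c :* d) := a :* d :* (b :* c)) refl _ _ _ _ ⟩
    x i * yᵢ⁻¹ * (y j * y i)       ≈⟨ *-congʳ (index-injective eq) ⟩
    x j * yⱼ⁻¹ * (y j * y i)       ≈⟨ solve 4 (λ a b c d → a :* b :* (c :* d) := a :* d :* (c :* b)) refl _ _ _ _ ⟩
    x j * y i * (y j * yⱼ⁻¹)       ≈⟨ *-congˡ yⱼyⱼ⁻¹≈1 ⟩
    x j * y i * 1#                 ≈⟨ *-identityʳ _ ⟩
    x j * y i                      ∎)
    where
    open SemiringSolver commutativeSemiring
    yᵢ⁻¹ = proj₁ (invertible (y i) (y≉0 i))
    yⱼ⁻¹ = proj₁ (invertible (y j) (y≉0 j))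
    yᵢyᵢ⁻¹≈1 = proj₂ (invertible (y i) (y≉0 i))
    yⱼyⱼ⁻¹≈1 = proj₂ (invertible (y j) (y≉0 j))

-- Linear algebra over a finite field, with all existence results drawn from `kernel`.

module MatrixProperties {c ℓ q} (F : FiniteField c ℓ q) where
  open FiniteField F hiding (zero)
  open Codes F
  open FieldProperties F
  open SemiringSum semiring using (sum; sum-cong-≋; sum-replicate-zero; sum-remove; ∑-comm; ∑-distrib-+;
    *-distribˡ-sum; *-distribʳ-sum)
  open GroupProperties +-group using (inverseʳ-unique; x∙y⁻¹≈ε⇒x≈y)
  open RingProperties ring using (-‿distribˡ-*; -‿distribʳ-*)
  open SetoidReasoning setoid

  sum-0 : ∀ {n} {v : Vector Carrier n} → (∀ i → v i ≈ 0#) → sum v ≈ 0#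
  sum-0 {n} v≈0 = trans (sum-cong-≋ v≈0) (sum-replicate-zero n)

  sum-split : ∀ m {n} (v : Vector Carrier (m ℕ.+ n)) →
    sum v ≈ sum (v ∘ (_↑ˡ n)) + sum (v ∘ (m ↑ʳ_))
  sum-split zero    v = sym (+-identityˡ _)
  sum-split (suc m) v = trans (+-congˡ (sum-split m (v ∘ suc))) (sym (+-assoc _ _ _))

  sum-only : ∀ {n} (i : Fin n) (v : Vector Carrier n) → (∀ j → j ≢ i → v j ≈ 0#) → sum v ≈ v i
  sum-only {suc n} i v v≈0 = begin
    sum v                          ≈⟨ sum-remove {i = i} v ⟩
    v i + sum (v ∘ punchIn i)      ≈⟨ +-congˡ (sum-0 λ j → v≈0 (punchIn i j) (Fin.punchInᵢ≢i i j)) ⟩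
    v i + 0#                       ≈⟨ +-identityʳ _ ⟩
    v i                            ∎

  ⟨_,_⟩ : ∀ {n} → Vector Carrier n → Vector Carrier n → Carrier
  ⟨ u , v ⟩ = sum (λ i → u i * v i)

  ⟨⟩-cong : ∀ {n} {u u′ v v′ : Vector Carrier n} →
    (∀ i → u i ≈ u′ i) → (∀ i → v i ≈ v′ i) → ⟨ u , v ⟩ ≈ ⟨ u′ , v′ ⟩
  ⟨⟩-cong u≈u′ v≈v′ = sum-cong-≋ λ i → *-cong (u≈u′ i) (v≈v′ i)

  ⟨⟩-congˡ : ∀ {n} (u : Vector Carrier n) {v v′} → (∀ i → v i ≈ v′ i) → ⟨ u , v ⟩ ≈ ⟨ u , v′ ⟩
  ⟨⟩-congˡ u = ⟨⟩-cong {u = u} (λ i → refl)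

  ⟨⟩-congʳ : ∀ {n} {u u′} (v : Vector Carrier n) → (∀ i → u i ≈ u′ i) → ⟨ u , v ⟩ ≈ ⟨ u′ , v ⟩
  ⟨⟩-congʳ v u≈u′ = ⟨⟩-cong {v = v} u≈u′ (λ i → refl)

  ⟨⟩-comm : ∀ {n} (u v : Vector Carrier n) → ⟨ u , v ⟩ ≈ ⟨ v , u ⟩
  ⟨⟩-comm u v = sum-cong-≋ λ i → *-comm (u i) (v i)

  ⟨0,⟩ : ∀ {n} {u} (v : Vector Carrier n) → (∀ i → u i ≈ 0#) → ⟨ u , v ⟩ ≈ 0#
  ⟨0,⟩ v u≈0 = sum-0 λ i → trans (*-congʳ (u≈0 i)) (zeroˡ _)

  ⟨,0⟩ : ∀ {n} (u : Vector Carrier n) {v} → (∀ i → v i ≈ 0#) → ⟨ u , v ⟩ ≈ 0#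
  ⟨,0⟩ u v≈0 = sum-0 λ i → trans (*-congˡ (v≈0 i)) (zeroʳ _)

  ⟨⟩-*ˡ : ∀ {n} a (u v : Vector Carrier n) → ⟨ (λ i → a * u i) , v ⟩ ≈ a * ⟨ u , v ⟩
  ⟨⟩-*ˡ {n} a u v = begin
    sum (λ i → a * u i * v i)    ≈⟨ sum-cong-≋ (λ i → *-assoc a (u i) (v i)) ⟩
    sum (λ i → a * (u i * v i))  ≈⟨ *-distribˡ-sum {n} a (λ i → u i * v i) ⟨
    a * ⟨ u , v ⟩                ∎

  ⟨⟩-*ʳ : ∀ {n} a (u v : Vector Carrier n) → ⟨ u , (λ i → a * v i) ⟩ ≈ a * ⟨ u , v ⟩
  ⟨⟩-*ʳ a u v = trans (⟨⟩-comm u _) (trans (⟨⟩-*ˡ a v u) (*-congˡ (⟨⟩-comm v u)))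

  ⟨⟩-+ʳ : ∀ {n} (u v v′ : Vector Carrier n) → ⟨ u , (λ i → v i + v′ i) ⟩ ≈ ⟨ u , v ⟩ + ⟨ u , v′ ⟩
  ⟨⟩-+ʳ u v v′ = trans (sum-cong-≋ λ i → distribˡ (u i) (v i) (v′ i))
    (∑-distrib-+ (λ i → u i * v i) (λ i → u i * v′ i))

  ⟨⟩-+ˡ : ∀ {n} (u u′ v : Vector Carrier n) → ⟨ (λ i → u i + u′ i) , v ⟩ ≈ ⟨ u , v ⟩ + ⟨ u′ , v ⟩
  ⟨⟩-+ˡ u u′ v = trans (sum-cong-≋ λ i → distribʳ (v i) (u i) (u′ i))
    (∑-distrib-+ (λ i → u i * v i) (λ i → u′ i * v i))

  ⟨⟩-split : ∀ m {n} (u v : Vector Carrier (m ℕ.+ n)) →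
    ⟨ u , v ⟩ ≈ ⟨ u ∘ (_↑ˡ n) , v ∘ (_↑ˡ n) ⟩ + ⟨ u ∘ (m ↑ʳ_) , v ∘ (m ↑ʳ_) ⟩
  ⟨⟩-split m u v = sum-split m (λ i → u i * v i)

  ᵥ*-⟨⟩ : ∀ {m n} (L : Vector Carrier m) (A : Matrix m n) (v : Vector Carrier n) →
    ⟨ L ᵥ* A , v ⟩ ≈ ⟨ L , (λ i → ⟨ A i , v ⟩) ⟩
  ᵥ*-⟨⟩ {m} {n} L A v = begin
    sum (λ j → sum (λ i → L i * A i j) * v j)
      ≈⟨ sum-cong-≋ (λ j → *-distribʳ-sum {m} (v j) (λ i → L i * A i j)) ⟩
    sum (λ j → sum (λ i → L i * A i j * v j))
      ≈⟨ ∑-comm (λ j i → L i * A i j * v j) ⟩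
    sum (λ i → sum (λ j → L i * A i j * v j))
      ≈⟨ sum-cong-≋ (λ i → ⟨⟩-*ˡ (L i) (A i) v) ⟩
    ⟨ L , (λ i → ⟨ A i , v ⟩) ⟩ ∎

  unit-diagonal : ∀ {n} (i : Fin n) → unit (toℕ i) i ≈ 1#
  unit-diagonal i = reflexive (≡.cong (if_then 1# else 0#) (dec-true (toℕ i ℕ.≟ toℕ i) ≡.refl))

  unit-off-diagonal : ∀ {n j} (i : Fin n) → toℕ i ≢ j → unit j i ≈ 0#
  unit-off-diagonal {j = j} i i≢j = reflexive (≡.cong (if_then 1# else 0#) (dec-false (toℕ i ℕ.≟ j) i≢j))

  ⟨,unit⟩ : ∀ {n} (v : Vector Carrier n) j → ⟨ v , unit (toℕ j) ⟩ ≈ v j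
  ⟨,unit⟩ v j = begin
    ⟨ v , unit (toℕ j) ⟩     ≈⟨ sum-only j _ (λ i i≢j →
                                  trans (*-congˡ (unit-off-diagonal i (i≢j ∘ Fin.toℕ-injective))) (zeroʳ _)) ⟩
    v j * unit (toℕ j) j     ≈⟨ *-congˡ (unit-diagonal j) ⟩
    v j * 1#                 ≈⟨ *-identityʳ _ ⟩
    v j                      ∎

  Nontrivial : ∀ {n} → Vector Carrier n → Set ℓ
  Nontrivial v = ¬ (∀ i → v i ≈ 0#)

  nonzero-entry : ∀ {n} {v : Vector Carrier n} → Nontrivial v → ∃ λ i → ¬ (v i ≈ 0#)
  nonzero-entry {v = v} = Fin.¬∀⟶∃¬ _ _ (λ i → v i ≟ 0#)

  trivial-stable : ∀ {n} {v : Vector Carrier n} → ¬ Nontrivial v → ∀ i → v i ≈ 0#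
  trivial-stable {v = v} = decidable-stable (Fin.all? λ i → v i ≟ 0#)

  -- Vectors of length n are coded by Fin (q ^ n), so one can search through them.
  vector : ∀ {n} → Fin (q ℕ.^ n) → Vector Carrier n
  vector x i = element (finToFun x i)

  code : ∀ {n} → Vector Carrier n → Fin (q ℕ.^ n)
  code v = funToFin (index ∘ v)

  vector-code : ∀ {n} (v : Vector Carrier n) i → vector (code v) i ≈ v i
  vector-code v i = trans (reflexive (≡.cong element (Fin.finToFun-funToFin (index ∘ v) i))) (element-index (v i))

  code-vector : ∀ {n} (x : Fin (q ℕ.^ n)) → code {n} (vector x) ≡ x
  code-vector {n} x = ≡.trans (funToFin-cong {n} λ i → index-element (finToFun x i)) (Fin.funToFin-finToFin {n} {q} x)

  code-cong : ∀ {n} {u v : Vector Carrier n} → (∀ i → u i ≈ v i) → code u ≡ code v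
  code-cong u≈v = funToFin-cong λ i → Inverse.from-cong enumeration (u≈v i)

  code-injective : ∀ {n} {u v : Vector Carrier n} → code u ≡ code v → ∀ i → u i ≈ v i
  code-injective {u = u} {v} eq i = begin
    u i                   ≈⟨ vector-code u i ⟨
    vector (code u) i     ≡⟨ ≡.cong (λ x → vector x i) eq ⟩
    vector (code v) i     ≈⟨ vector-code v i ⟩
    v i                   ∎

  ∃-vector? : ∀ {n p} {P : Pred (Vector Carrier n) p} →
    (∀ {u v} → (∀ i → u i ≈ v i) → P u → P v) → Decidable P → Dec (∃ P)
  ∃-vector? P-resp P? = map′ (λ { (x , Px) → vector x , Px })
    (λ { (v , Pv) → code v , P-resp (λ i → sym (vector-code v i)) Pv }) (Fin.any? (P? ∘ vector))

  abstract
    -- Two of the q ^ n vectors have the same image among q ^ m.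
    kernel : ∀ {m n} (A : Matrix m n) → m ℕ.< n → ∃ λ η → Nontrivial η × ∀ i → ⟨ A i , η ⟩ ≈ 0#
    kernel {m} {n} A m<n
      with x , y , x<y , eq ← Fin.pigeonhole (ℕ.^-monoʳ-< q 1<q m<n) (λ x → code {m} λ i → ⟨ A i , vector {n} x ⟩)
      = (λ i → vector x i - vector y i)
      , (λ η≈0 → Fin.<⇒≢ x<y (≡.trans (≡.sym (code-vector {n} x))
          (≡.trans (code-cong {n} λ i → x∙y⁻¹≈ε⇒x≈y _ _ (η≈0 i)) (code-vector {n} y))))
      , (λ i → begin
          ⟨ A i , (λ j → vector x j - vector y j) ⟩
            ≈⟨ ⟨⟩-+ʳ (A i) (vector x) (λ j → - vector y j) ⟩
          ⟨ A i , vector x ⟩ + ⟨ A i , (λ j → - vector y j) ⟩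
            ≈⟨ +-congʳ (code-injective {m} eq i) ⟩
          ⟨ A i , vector y ⟩ + ⟨ A i , (λ j → - vector y j) ⟩
            ≈⟨ ⟨⟩-+ʳ (A i) (vector y) (λ j → - vector y j) ⟨
          ⟨ A i , (λ j → vector y j - vector y j) ⟩
            ≈⟨ ⟨,0⟩ (A i) (λ j → -‿inverseʳ (vector y j)) ⟩
          0# ∎)

  Annihilates : ∀ {m n} → Vector Carrier m → Matrix m n → Set ℓ
  Annihilates L A = ∀ j → (L ᵥ* A) j ≈ 0#

  Singular : ∀ {m n} → Matrix m n → Set _
  Singular A = ∃ λ L → Nontrivial L × Annihilates L A

  -- Independence of the rows. The record keeps `A` in the type, from where it can be inferred;
  -- unfolded, the condition shows `A` only inside sums.
  record Independent {m n} (A : Matrix m n) : Set (c ⊔ ℓ) where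
    constructor is-independent
    field
      trivial : ∀ L → Annihilates L A → ∀ i → L i ≈ 0#

  open Independent

  independent : ∀ {m n} {A : Matrix m n} → ¬ Singular A → Independent A
  independent ¬singular .trivial L LA≈0 = trivial-stable λ L≉0 → ¬singular (L , L≉0 , LA≈0)

  abstract
    -- Let Aη = 0 with η nonzero at `p`. Some `L` ≠ 0 kills the columns other than `p`, as there are
    -- fewer of them than rows. Then 0 = LAη reduces to the term of `p`, so `L` kills column `p`
    -- too.
    transpose-singular : ∀ {n} {A : Matrix n n} → Singular (transpose A) → Singular A
    transpose-singular {zero}  (η , η≉0 , _) = contradiction (λ ()) η≉0
    transpose-singular {suc n} {A} (η , η≉0 , Aη≈0)
      = L , proj₁ (proj₂ dependency) , LA≈0
      where
      p : Fin (suc n)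
      p = proj₁ (nonzero-entry η≉0)

      dependency : ∃ λ L → Nontrivial L × ∀ l → ⟨ (λ i → A i (punchIn p l)) , L ⟩ ≈ 0#
      dependency = kernel (λ l i → A i (punchIn p l)) ℕ.≤-refl

      L : Vector Carrier (suc n)
      L = proj₁ dependency

      LA≈0-off : ∀ l → (L ᵥ* A) (punchIn p l) ≈ 0#
      LA≈0-off l = trans (⟨⟩-comm L (λ i → A i (punchIn p l))) (proj₂ (proj₂ dependency) l)

      LAη≈0 : (L ᵥ* A) p * η p ≈ 0#
      LAη≈0 = begin
        (L ᵥ* A) p * η p
          ≈⟨ +-identityʳ _ ⟨
        (L ᵥ* A) p * η p + 0#
          ≈⟨ +-congˡ (⟨0,⟩ (η ∘ punchIn p) LA≈0-off) ⟨
        (L ᵥ* A) p * η p + ⟨ (L ᵥ* A) ∘ punchIn p , η ∘ punchIn p ⟩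
          ≈⟨ sum-remove {i = p} (λ j → (L ᵥ* A) j * η j) ⟨
        ⟨ L ᵥ* A , η ⟩
          ≈⟨ ᵥ*-⟨⟩ L A η ⟩
        ⟨ L , (λ i → ⟨ A i , η ⟩) ⟩
          ≈⟨ ⟨,0⟩ L (λ i → trans (⟨⟩-comm (A i) η) (Aη≈0 i)) ⟩
        0# ∎

      LA≈0 : Annihilates L A
      LA≈0 j with p Fin.≟ j
      ... | yes ≡.refl = *-cancel-0 (proj₂ (nonzero-entry η≉0)) (trans (*-comm _ _) LAη≈0)
      ... | no p≢j     = ≡.subst (λ k → (L ᵥ* A) k ≈ 0#) (Fin.punchIn-punchOut p≢j) (LA≈0-off (Fin.punchOut p≢j))

  transpose-independent : ∀ {n} {A : Matrix n n} → Independent A → Independent (transpose A)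
  transpose-independent {A = A} A-ind = independent λ Aᵀ-sing →
    let L , L≉0 , LA≈0 = transpose-singular {A = A} Aᵀ-sing in L≉0 (trivial A-ind L LA≈0)

  abstract
    -- The target `t` and the m rows of `A` are m + 1 > n vectors of length n, hence dependent.
    -- Independence of the rows forces a nonzero coefficient at `t`, and dividing by it solves the
    -- system.
    row-solve : ∀ {m n} {A : Matrix m n} → Independent A → n ℕ.≤ m → ∀ (t : Vector Carrier n) → ∃ λ L → ∀ j → (L ᵥ* A) j ≈ t j
    row-solve {m} {n} {A} A-ind n≤m t = L , LA≈t
      where
      B : Matrix n (suc m)
      B j = t j Vector.∷ λ i → A i j

      dependency : ∃ λ η → Nontrivial η × ∀ j → ⟨ B j , η ⟩ ≈ 0#
      dependency = kernel B (s≤s n≤m)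

      η : Vector Carrier (suc m)
      η = proj₁ dependency

      ηA : Vector Carrier n
      ηA = (η ∘ suc) ᵥ* A

      relation : ∀ j → t j * η zero + ηA j ≈ 0#
      relation j = trans (+-congˡ (⟨⟩-comm (η ∘ suc) (λ i → A i j))) (proj₂ (proj₂ dependency) j)

      η₀≉0 : ¬ (η zero ≈ 0#)
      η₀≉0 η₀≈0 = proj₁ (proj₂ dependency) λ where
        zero    → η₀≈0
        (suc i) → trivial A-ind (η ∘ suc) (λ j → x+y≈0⇒y≈0 (trans (*-congˡ η₀≈0) (zeroʳ _)) (relation j)) i

      inv : Carrier
      inv = proj₁ (invertible (η zero) η₀≉0)

      L : Vector Carrier m
      L i = (- inv) * η (suc i)

      LA≈t : ∀ j → (L ᵥ* A) j ≈ t j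
      LA≈t j = begin
        (L ᵥ* A) j                  ≈⟨ ⟨⟩-*ˡ (- inv) (η ∘ suc) (λ i → A i j) ⟩
        (- inv) * ηA j              ≈⟨ -‿distribˡ-* _ _ ⟨
        - (inv * ηA j)              ≈⟨ -‿distribʳ-* _ _ ⟩
        inv * (- ηA j)              ≈⟨ *-congˡ (inverseʳ-unique (ηA j) _ (trans (+-comm _ _) (relation j))) ⟨
        inv * (t j * η zero)        ≈⟨ solve 3 (λ a b d → a :* (b :* d) := b :* (d :* a)) refl _ _ _ ⟩
        t j * (η zero * inv)        ≈⟨ *-congˡ (proj₂ (invertible (η zero) η₀≉0)) ⟩
        t j * 1#                    ≈⟨ *-identityʳ _ ⟩
        t j                         ∎
        where open SemiringSolver commutativeSemiring

  abstract
    column-solve : ∀ {m n} {A : Matrix m n} → Independent A → m ≡ n → ∀ (t : Vector Carrier m) → ∃ λ x → ∀ i → ⟨ A i , x ⟩ ≈ t i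
    column-solve {A = A} A-ind ≡.refl t =
      let x , xAᵀ≈t = row-solve (transpose-independent A-ind) ℕ.≤-refl t
      in x , λ i → trans (⟨⟩-comm (A i) x) (xAᵀ≈t i)

  abstract
    -- Fewer than n rows are all orthogonal to some η ≠ 0. A unit vector at a position where η is
    -- nonzero is not orthogonal to η, so it lies outside their span and can be added. New rows go
    -- in front, which puts row i of `A` at `d ↑ʳ i`.
    extend-independent : ∀ d {m n} {A : Matrix m n} → Independent A → d ℕ.+ m ℕ.≤ n →
      ∃ λ (X : Matrix (d ℕ.+ m) n) → Independent X × ∀ i j → X (d ↑ʳ i) j ≈ A i j
    extend-independent zero {A = A} A-ind _ = A , A-ind , λ i j → refl
    extend-independent (suc d) {m} {n} A-ind d+m<n
      with X , X-ind , X≈A ← extend-independent d A-ind (ℕ.<⇒≤ d+m<n)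
      with η , η≉0 , Xη≈0 ← kernel X d+m<n
      with p , ηₚ≉0 ← nonzero-entry η≉0
      = X′ , X′-ind , X≈A
      where
      X′ : Matrix (suc d ℕ.+ m) n
      X′ = unit (toℕ p) Vector.∷ X

      L₀≈0 : ∀ L → Annihilates L X′ → L zero ≈ 0#
      L₀≈0 L LX′≈0 = *-cancel-0 ηₚ≉0 (begin
        η p * L zero
          ≈⟨ *-comm _ _ ⟩
        L zero * η p
          ≈⟨ *-congˡ (trans (⟨⟩-comm _ η) (⟨,unit⟩ η p)) ⟨
        L zero * ⟨ X′ zero , η ⟩
          ≈⟨ +-identityʳ _ ⟨
        L zero * ⟨ X′ zero , η ⟩ + 0#
          ≈⟨ +-congˡ (⟨,0⟩ (L ∘ suc) Xη≈0) ⟨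
        ⟨ L , (λ i → ⟨ X′ i , η ⟩) ⟩
          ≈⟨ ᵥ*-⟨⟩ L X′ η ⟨
        ⟨ L ᵥ* X′ , η ⟩
          ≈⟨ ⟨0,⟩ η LX′≈0 ⟩
        0# ∎)

      X′-ind : Independent X′
      X′-ind .trivial L LX′≈0 zero    = L₀≈0 L LX′≈0
      X′-ind .trivial L LX′≈0 (suc i) = trivial X-ind (L ∘ suc)
        (λ j → x+y≈0⇒y≈0 (trans (*-congʳ (L₀≈0 L LX′≈0)) (zeroˡ _)) (LX′≈0 j)) i

  abstract
    -- Add one row in front to obtain a basis and let η be dual to the added row. Pairing a vector
    -- with η gives its coefficient at that row; if this is zero, the rows of `A` suffice.
    hyperplane : ∀ {m} {A : Matrix m (suc m)} → Independent A →
      ∃ λ η → ∀ u → ⟨ u , η ⟩ ≈ 0# → ∃ λ L → ∀ j → (L ᵥ* A) j ≈ u j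
    hyperplane {m} {A} A-ind = proj₁ η-solution , span
      where
      extension : ∃ λ (X : Matrix (suc m) (suc m)) → Independent X × ∀ i j → X (suc i) j ≈ A i j
      extension = extend-independent 1 A-ind ℕ.≤-refl

      X : Matrix (suc m) (suc m)
      X = proj₁ extension

      X-ind : Independent X
      X-ind = proj₁ (proj₂ extension)

      X≈A : ∀ i j → X (suc i) j ≈ A i j
      X≈A = proj₂ (proj₂ extension)

      η-solution : ∃ λ x → ∀ i → ⟨ X i , x ⟩ ≈ unit 0 i
      η-solution = column-solve X-ind ≡.refl (unit 0)

      span : ∀ u → ⟨ u , proj₁ η-solution ⟩ ≈ 0# → ∃ λ L → ∀ j → (L ᵥ* A) j ≈ u j
      span u uη≈0 = L ∘ suc , LA≈u
        where
        η : Vector Carrier (suc m)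
        η = proj₁ η-solution

        L-solution : ∃ λ L → ∀ j → (L ᵥ* X) j ≈ u j
        L-solution = row-solve X-ind ℕ.≤-refl u

        L : Vector Carrier (suc m)
        L = proj₁ L-solution

        L₀≈0 : L zero ≈ 0#
        L₀≈0 = begin
          L zero                              ≈⟨ ⟨,unit⟩ L zero ⟨
          ⟨ L , unit 0 ⟩                      ≈⟨ ⟨⟩-congˡ L (proj₂ η-solution) ⟨
          ⟨ L , (λ i → ⟨ X i , η ⟩) ⟩         ≈⟨ ᵥ*-⟨⟩ L X η ⟨
          ⟨ L ᵥ* X , η ⟩                      ≈⟨ ⟨⟩-congʳ η (proj₂ L-solution) ⟩
          ⟨ u , η ⟩                           ≈⟨ uη≈0 ⟩
          0#                                  ∎

        LA≈u : ∀ j → ((L ∘ suc) ᵥ* A) j ≈ u j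
        LA≈u j = begin
          ((L ∘ suc) ᵥ* A) j                             ≈⟨ ⟨⟩-congˡ (L ∘ suc) (λ i → X≈A i j) ⟨
          ((L ∘ suc) ᵥ* (X ∘ suc)) j                     ≈⟨ +-identityˡ _ ⟨
          0# + ((L ∘ suc) ᵥ* (X ∘ suc)) j                ≈⟨ +-congʳ (trans (*-congʳ L₀≈0) (zeroˡ _)) ⟨
          L zero * X zero j + ((L ∘ suc) ᵥ* (X ∘ suc)) j ≈⟨ proj₂ L-solution j ⟩
          u j                                            ∎

-- Determinants, and their vanishing for singular matrices only.

data Adjacent : ∀ {n} → Fin n → Fin n → Set where
  here  : ∀ {n} → Adjacent {suc (suc n)} zero (suc zero)
  there : ∀ {n} {u v : Fin n} → Adjacent u v → Adjacent (suc u) (suc v)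

inject₁-adjacent : ∀ {n} (i : Fin n) → Adjacent (inject₁ i) (suc i)
inject₁-adjacent zero    = here
inject₁-adjacent (suc i) = there (inject₁-adjacent i)

adjacent-toℕ : ∀ {n} {u v : Fin n} → Adjacent u v → toℕ v ≡ suc (toℕ u)
adjacent-toℕ here        = ≡.refl
adjacent-toℕ (there adj) = ≡.cong suc (adjacent-toℕ adj)

adjacent⇒≢ : ∀ {n} {u v : Fin n} → Adjacent u v → u ≢ v
adjacent⇒≢ (there adj) ≡.refl = adjacent⇒≢ adj ≡.refl

punchOut-adjacent : ∀ {n} {i u v : Fin (suc n)} → Adjacent u v → i ≢ u → i ≢ v →
  ∃₂ λ u′ v′ → Adjacent u′ v′ × punchIn i u′ ≡ u × punchIn i v′ ≡ v
punchOut-adjacent {i = zero} here i≢u _ = contradiction ≡.refl i≢u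
punchOut-adjacent {i = suc zero} here _ i≢v = contradiction ≡.refl i≢v
punchOut-adjacent {suc (suc n)} {i = suc (suc i)} here _ _ = zero , suc zero , here , ≡.refl , ≡.refl
punchOut-adjacent {i = zero} (there adj) _ _ = _ , _ , adj , ≡.refl , ≡.refl
punchOut-adjacent {suc n} {i = suc i} (there adj) i≢u i≢v =
  let u′ , v′ , adj′ , u′≡u , v′≡v = punchOut-adjacent adj (i≢u ∘ ≡.cong suc) (i≢v ∘ ≡.cong suc)
  in suc u′ , suc v′ , there adj′ , ≡.cong suc u′≡u , ≡.cong suc v′≡v

-- Needed to compare the minors that delete u and v: they coincide as soon as columns u and v of the
-- matrix agree.
punchIn-adjacent : ∀ {n} {u v : Fin (suc n)} → Adjacent u v → ∀ l →
  punchIn u l ≡ punchIn v l ⊎ (punchIn u l ≡ v × punchIn v l ≡ u)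
punchIn-adjacent here zero          = inj₂ (≡.refl , ≡.refl)
punchIn-adjacent here (suc l)       = inj₁ ≡.refl
punchIn-adjacent (there adj) zero   = inj₁ ≡.refl
punchIn-adjacent (there adj) (suc l) with punchIn-adjacent adj l
... | inj₁ eq          = inj₁ (≡.cong suc eq)
... | inj₂ (eq₁ , eq₂) = inj₂ (≡.cong suc eq₁ , ≡.cong suc eq₂)

module Determinants {c ℓ q} (F : FiniteField c ℓ q) where
  open FiniteField F hiding (zero)
  open Codes F
  open FieldProperties F
  open MatrixProperties F
  open Exponentiation semiring using (_^_)
  open SemiringSum semiring using (sum; sum-cong-≋; ∑-distrib-+; *-distribˡ-sum)
  open RingProperties ring using (-‿distribˡ-*; -1*x≈-x)
  open SetoidReasoning setoid

  adjacent-sum : ∀ {n} {u v : Fin n} (f : Vector Carrier n) → Adjacent u v →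
    (∀ i → i ≢ u → i ≢ v → f i ≈ 0#) → f u + f v ≈ 0# → sum f ≈ 0#
  adjacent-sum f here f≈0 fᵤ+fᵥ≈0 = begin
    f zero + (f (suc zero) + sum (λ i → f (suc (suc i))))
      ≈⟨ +-assoc _ _ _ ⟨
    (f zero + f (suc zero)) + sum (λ i → f (suc (suc i)))
      ≈⟨ +-cong fᵤ+fᵥ≈0 (sum-0 λ i → f≈0 (suc (suc i)) (λ ()) (λ ())) ⟩
    0# + 0#
      ≈⟨ +-identityˡ 0# ⟩
    0# ∎
  adjacent-sum f (there adj) f≈0 fᵤ+fᵥ≈0 = begin
    f zero + sum (f ∘ suc)  ≈⟨ +-cong (f≈0 zero (λ ()) (λ ())) (adjacent-sum (f ∘ suc) adj
                                 (λ i i≢u i≢v → f≈0 (suc i) (i≢u ∘ Fin.suc-injective) (i≢v ∘ Fin.suc-injective)) fᵤ+fᵥ≈0) ⟩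
    0# + 0#                 ≈⟨ +-identityˡ 0# ⟩
    0#                      ∎

  minor : ∀ {n} → Matrix (suc n) (suc n) → Fin (suc n) → Matrix n n
  minor M j i = removeAt (M (suc i)) j

  det-cong : ∀ {n} {M N : Matrix n n} → (∀ i j → M i j ≈ N i j) → det M ≈ det N
  det-cong {zero}  M≈N = refl
  det-cong {suc n} M≈N = sum-cong-≋ λ j →
    *-cong (*-congˡ {x = (- 1#) ^ toℕ j} (M≈N zero j)) (det-cong λ i l → M≈N (suc i) (punchIn j l))

  -- Expand along the first row. In the term of `p` the entry is linear and the minor does not see
  -- column `p`; in any other term the entry is fixed and the minor is linear by induction.
  det-linear : ∀ {n} (p : Fin n) a {M A B : Matrix n n} →
    (∀ i → M i p ≈ A i p + a * B i p) →
    (∀ i j → j ≢ p → M i j ≈ A i j) → (∀ i j → j ≢ p → M i j ≈ B i j) →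
    det M ≈ det A + a * det B
  det-linear {suc n} p a {M} {A} {B} Mₚ M≈A M≈B = begin
    sum (term M)                            ≈⟨ sum-cong-≋ linear ⟩
    sum (λ j → term A j + a * term B j)     ≈⟨ ∑-distrib-+ (term A) (λ j → a * term B j) ⟩
    det A + sum (λ j → a * term B j)        ≈⟨ +-congˡ (*-distribˡ-sum a (term B)) ⟨
    det A + a * det B                       ∎
    where
    open SemiringSolver commutativeSemiring

    term : Matrix (suc n) (suc n) → Vector Carrier (suc n)
    term M j = (- 1#) ^ toℕ j * M zero j * det (minor M j)

    linear : ∀ j → term M j ≈ term A j + a * term B j
    linear j with j Fin.≟ p
    ... | yes ≡.refl = begin
      term M p
        ≈⟨ *-congʳ (*-congˡ (Mₚ zero)) ⟩
      (- 1#) ^ toℕ p * (A zero p + a * B zero p) * det (minor M p)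
        ≈⟨ solve 5 (λ s x y z d → s :* (x :+ y :* z) :* d := s :* x :* d :+ y :* (s :* z :* d)) refl _ _ _ _ _ ⟩
      (- 1#) ^ toℕ p * A zero p * det (minor M p) + a * ((- 1#) ^ toℕ p * B zero p * det (minor M p))
        ≈⟨ +-cong (*-congˡ (det-cong λ i l → M≈A (suc i) (punchIn p l) (Fin.punchInᵢ≢i p l)))
                  (*-congˡ (*-congˡ (det-cong λ i l → M≈B (suc i) (punchIn p l) (Fin.punchInᵢ≢i p l)))) ⟩
      term A p + a * term B p ∎
    ... | no j≢p = begin
      term M j
        ≈⟨ *-congˡ (det-linear p′ a minorₚ (off A M≈A) (off B M≈B)) ⟩
      (- 1#) ^ toℕ j * M zero j * (det (minor A j) + a * det (minor B j))
        ≈⟨ solve 5 (λ s m x y z → s :* m :* (x :+ y :* z) := s :* m :* x :+ y :* (s :* m :* z)) refl _ _ _ _ _ ⟩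
      (- 1#) ^ toℕ j * M zero j * det (minor A j) + a * ((- 1#) ^ toℕ j * M zero j * det (minor B j))
        ≈⟨ +-cong (*-congʳ (*-congˡ (M≈A zero j j≢p))) (*-congˡ (*-congʳ (*-congˡ (M≈B zero j j≢p)))) ⟩
      term A j + a * term B j ∎
      where
      p′ : Fin n
      p′ = punchOut j≢p

      minorₚ : ∀ i → minor M j i p′ ≈ minor A j i p′ + a * minor B j i p′
      minorₚ i = ≡.subst (λ k → M (suc i) k ≈ A (suc i) k + a * B (suc i) k)
        (≡.sym (Fin.punchIn-punchOut j≢p)) (Mₚ (suc i))

      off : ∀ N → (∀ i l → l ≢ p → M i l ≈ N i l) → ∀ i l → l ≢ p′ → minor M j i l ≈ minor N j i l
      off N M≈N i l l≢p′ = M≈N (suc i) (punchIn j l) λ eq → l≢p′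
        (Fin.punchIn-injective j l p′ (≡.trans eq (≡.sym (Fin.punchIn-punchOut j≢p))))

  -- Every term other than those of u and v contains a minor that still has the two equal adjacent
  -- columns. The terms of u and v have equal entries and equal minors, and opposite signs because
  -- the positions differ by one.
  det-alternating : ∀ {n} {u v : Fin n} (M : Matrix n n) → Adjacent u v →
    (∀ i → M i u ≈ M i v) → det M ≈ 0#
  det-alternating {suc n} {u} {v} M adj Mᵤ≈Mᵥ = adjacent-sum _ adj off cancel
    where
    off : ∀ j → j ≢ u → j ≢ v → (- 1#) ^ toℕ j * M zero j * det (minor M j) ≈ 0#
    off j j≢u j≢v with u′ , v′ , adj′ , ≡.refl , ≡.refl ← punchOut-adjacent adj j≢u j≢v =
      trans (*-congˡ (det-alternating (minor M j) adj′ (Mᵤ≈Mᵥ ∘ suc))) (zeroʳ _)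

    minors : ∀ i l → minor M v i l ≈ minor M u i l
    minors i l with punchIn-adjacent adj l
    ... | inj₁ eq = reflexive (≡.cong (M (suc i)) (≡.sym eq))
    ... | inj₂ (eq₁ , eq₂) = begin
      M (suc i) (punchIn v l)  ≡⟨ ≡.cong (M (suc i)) eq₂ ⟩
      M (suc i) u              ≈⟨ Mᵤ≈Mᵥ (suc i) ⟩
      M (suc i) v              ≡⟨ ≡.cong (M (suc i)) eq₁ ⟨
      M (suc i) (punchIn u l)  ∎

    cancel : (- 1#) ^ toℕ u * M zero u * det (minor M u) + (- 1#) ^ toℕ v * M zero v * det (minor M v) ≈ 0#
    cancel = begin
      x + (- 1#) ^ toℕ v * M zero v * det (minor M v)
        ≈⟨ +-congˡ (*-cong (*-cong (reflexive (≡.cong ((- 1#) ^_) (adjacent-toℕ adj))) (sym (Mᵤ≈Mᵥ zero))) (det-cong minors)) ⟩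
      x + (- 1# * (- 1#) ^ toℕ u) * M zero u * det (minor M u)
        ≈⟨ +-congˡ (trans (*-congʳ (*-assoc _ _ _)) (*-assoc _ _ _)) ⟩
      x + - 1# * x
        ≈⟨ +-congˡ (-1*x≈-x x) ⟩
      x - x
        ≈⟨ -‿inverseʳ x ⟩
      0# ∎
      where x = (- 1#) ^ toℕ u * M zero u * det (minor M u)

  -- What column operations preserve: the determinant and the left kernel, the two things that are
  -- to be compared.
  record _∼_ {n} (M N : Matrix n n) : Set (c ⊔ ℓ) where
    field
      same-det : det M ≈ det N
      to       : ∀ L → Annihilates L M → Annihilates L N
      from     : ∀ L → Annihilates L N → Annihilates L M

  ∼-refl : ∀ {n} {M : Matrix n n} → M ∼ M
  ∼-refl = record { same-det = refl ; to = λ _ z → z ; from = λ _ z → z }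

  ∼-trans : ∀ {n} {M N O : Matrix n n} → M ∼ N → N ∼ O → M ∼ O
  ∼-trans p q = record
    { same-det = trans (_∼_.same-det p) (_∼_.same-det q)
    ; to       = λ L z → _∼_.to q L (_∼_.to p L z)
    ; from     = λ L z → _∼_.from p L (_∼_.from q L z)
    }

  replaceColumn : ∀ {m n} → Matrix m n → Fin n → Vector Carrier m → Matrix m n
  replaceColumn M u w i j = if does (j Fin.≟ u) then w i else M i j

  replaceColumn-at : ∀ {m n} (M : Matrix m n) u w i → replaceColumn M u w i u ≈ w i
  replaceColumn-at M u w i = reflexive (≡.cong (if_then w i else M i u) (dec-true (u Fin.≟ u) ≡.refl))

  replaceColumn-off : ∀ {m n} (M : Matrix m n) u w i j → j ≢ u → replaceColumn M u w i j ≈ M i j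
  replaceColumn-off M u w i j j≢u = reflexive (≡.cong (if_then w i else M i j) (dec-false (j Fin.≟ u) j≢u))

  addColumn : ∀ {m n} → Matrix m n → Fin n → Carrier → Fin n → Matrix m n
  addColumn M u a v = replaceColumn M u (λ i → M i u + a * M i v)

  addColumn-at : ∀ {m n} (M : Matrix m n) u a v i → addColumn M u a v i u ≈ M i u + a * M i v
  addColumn-at M u a v = replaceColumn-at M u (λ i → M i u + a * M i v)

  addColumn-off : ∀ {m n} (M : Matrix m n) u a v i j → j ≢ u → addColumn M u a v i j ≈ M i j
  addColumn-off M u a v = replaceColumn-off M u (λ i → M i u + a * M i v)

  -- By linearity in column u, the determinant changes by `a` times that of `B`, in which column v
  -- occurs twice in adjacent places. The left kernel is preserved because column v stays and allows
  -- the operation to be undone.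
  addColumn-∼ : ∀ {n} (M : Matrix n n) {u v} a → Adjacent u v ⊎ Adjacent v u → M ∼ addColumn M u a v
  addColumn-∼ {n} M {u} {v} a adj = record
    { same-det = sym (begin
        det M′           ≈⟨ det-linear u a M′ᵤ M′≈M M′≈B ⟩
        det M + a * det B ≈⟨ +-congˡ (trans (*-congˡ (B-det adj)) (zeroʳ a)) ⟩
        det M + 0#       ≈⟨ +-identityʳ _ ⟩
        det M            ∎)
    ; to = λ L LM≈0 j → to L LM≈0 j (j Fin.≟ u)
    ; from = λ L LM′≈0 j → from L LM′≈0 j (j Fin.≟ u)
    }
    where
    M′ B : Matrix n n
    M′ = addColumn M u a v
    B = replaceColumn M u (λ i → M i v)

    v≢u : v ≢ u
    v≢u = [ (λ uv → ≡.≢-sym (adjacent⇒≢ uv)) , adjacent⇒≢ ]′ adj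

    M′ᵤ : ∀ i → M′ i u ≈ M i u + a * B i u
    M′ᵤ i = trans (addColumn-at M u a v i)
      (+-congˡ (*-congˡ (sym (replaceColumn-at M u (λ i → M i v) i))))

    M′≈M : ∀ i j → j ≢ u → M′ i j ≈ M i j
    M′≈M = addColumn-off M u a v

    M′≈B : ∀ i j → j ≢ u → M′ i j ≈ B i j
    M′≈B i j j≢u = trans (M′≈M i j j≢u) (sym (replaceColumn-off M u (λ i → M i v) i j j≢u))

    Bᵤ≈Bᵥ : ∀ i → B i u ≈ B i v
    Bᵤ≈Bᵥ i = trans (replaceColumn-at M u (λ i → M i v) i) (sym (replaceColumn-off M u (λ i → M i v) i v v≢u))

    B-det : Adjacent u v ⊎ Adjacent v u → det B ≈ 0#
    B-det (inj₁ uv) = det-alternating B uv Bᵤ≈Bᵥ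
    B-det (inj₂ vu) = det-alternating B vu (λ i → sym (Bᵤ≈Bᵥ i))

    LM′ᵤ : ∀ L → (L ᵥ* M′) u ≈ (L ᵥ* M) u + a * (L ᵥ* M) v
    LM′ᵤ L = begin
      (L ᵥ* M′) u
        ≈⟨ ⟨⟩-congˡ L (addColumn-at M u a v) ⟩
      ⟨ L , (λ i → M i u + a * M i v) ⟩
        ≈⟨ ⟨⟩-+ʳ L (λ i → M i u) (λ i → a * M i v) ⟩
      (L ᵥ* M) u + ⟨ L , (λ i → a * M i v) ⟩
        ≈⟨ +-congˡ (⟨⟩-*ʳ a L (λ i → M i v)) ⟩
      (L ᵥ* M) u + a * (L ᵥ* M) v ∎

    LM′ : ∀ L j → j ≢ u → (L ᵥ* M′) j ≈ (L ᵥ* M) j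
    LM′ L j j≢u = ⟨⟩-congˡ L (λ i → M′≈M i j j≢u)

    to : ∀ L → Annihilates L M → ∀ j → Dec (j ≡ u) → (L ᵥ* M′) j ≈ 0#
    to L LM≈0 j (yes ≡.refl) = begin
      (L ᵥ* M′) j                  ≈⟨ LM′ᵤ L ⟩
      (L ᵥ* M) j + a * (L ᵥ* M) v  ≈⟨ +-cong (LM≈0 j) (*-congˡ (LM≈0 v)) ⟩
      0# + a * 0#                  ≈⟨ trans (+-identityˡ _) (zeroʳ a) ⟩
      0#                           ∎
    to L LM≈0 j (no j≢u) = trans (LM′ L j j≢u) (LM≈0 j)

    from : ∀ L → Annihilates L M′ → ∀ j → Dec (j ≡ u) → (L ᵥ* M) j ≈ 0#
    from L LM′≈0 j (yes ≡.refl) = x+y≈0⇒x≈0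
      (trans (*-congˡ (trans (sym (LM′ L v v≢u)) (LM′≈0 v))) (zeroʳ a))
      (trans (sym (LM′ᵤ L)) (LM′≈0 j))
    from L LM′≈0 j (no j≢u) = trans (sym (LM′ L j j≢u)) (LM′≈0 j)

  Reduction : ∀ {n} → Matrix (suc n) (suc n) → Fin (suc n) → Set (c ⊔ ℓ)
  Reduction {n} M m = ∃ λ (N : Matrix (suc n) (suc n)) → M ∼ N × (∀ j → m Fin.< j → N zero j ≈ 0#)

  nonzero-shift : ∀ x {y} → ¬ (y ≈ 0#) → ∃ λ t → ¬ (x + t * y ≈ 0#)
  nonzero-shift x {y} y≉0 with x ≟ 0#
  ... | yes x≈0 = 1# , λ eq → y≉0 (trans (sym (*-identityˡ y)) (x+y≈0⇒y≈0 x≈0 eq))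
  ... | no x≉0  = 0# , λ eq → x≉0 (x+y≈0⇒x≈0 (zeroˡ y) eq)

  eliminate : ∀ {x} y → ¬ (x ≈ 0#) → ∃ λ t → y + t * x ≈ 0#
  eliminate {x} y x≉0 = let x⁻¹ , xx⁻¹≈1 = invertible x x≉0 in - (y * x⁻¹) , (begin
    y + - (y * x⁻¹) * x    ≈⟨ +-congˡ (-‿distribˡ-* _ x) ⟨
    y - y * x⁻¹ * x        ≈⟨ +-congˡ (-‿cong (trans (*-assoc y x⁻¹ x) (*-congˡ (trans (*-comm x⁻¹ x) xx⁻¹≈1)))) ⟩
    y - y * 1#             ≈⟨ +-congˡ (-‿cong (*-identityʳ y)) ⟩
    y - y                  ≈⟨ -‿inverseʳ y ⟩
    0#                     ∎)

  -- Only adjacent columns are combined, as those are the ones for which det is known to alternate.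
  abstract
    reduce : ∀ {n} (M : Matrix (suc n) (suc n)) m → Reduction M m
    reduce {n} M = >-weakInduction (Reduction M)
      (M , ∼-refl , λ j n<j → contradiction (Fin.≤fromℕ j) (ℕ.<⇒≱ n<j)) step
      where
      step : ∀ i → Reduction M (suc i) → Reduction M (inject₁ i)
      step i (N , M∼N , N≈0) with N zero (suc i) ≟ 0#
      ... | yes Nᵥ≈0 = N , M∼N , λ j i<j → beyond j i<j (suc i Fin.≟ j)
        where
        beyond : ∀ j → inject₁ i Fin.< j → Dec (suc i ≡ j) → N zero j ≈ 0#
        beyond j i<j (yes ≡.refl) = Nᵥ≈0
        beyond j i<j (no i+1≢j)   = N≈0 j (Fin.≤∧≢⇒< (≡.subst (ℕ._< toℕ j) (Fin.toℕ-inject₁ i) i<j) i+1≢j)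
      -- A multiple of column v first makes the entry at u nonzero; this entry then serves as the
      -- pivot that clears the one at v. No exchange of columns, hence no change of sign, occurs.
      ... | no Nᵥ≉0 = N₂ , ∼-trans M∼N (∼-trans N∼N₁ N₁∼N₂) , λ j i<j → beyond j i<j (j Fin.≟ v)
        where
        u v : Fin (suc n)
        u = inject₁ i
        v = suc i

        shift : ∃ λ t → ¬ (N zero u + t * N zero v ≈ 0#)
        shift = nonzero-shift (N zero u) Nᵥ≉0

        N₁ : Matrix (suc n) (suc n)
        N₁ = addColumn N u (proj₁ shift) v

        N∼N₁ : N ∼ N₁
        N∼N₁ = addColumn-∼ N (proj₁ shift) (inj₁ (inject₁-adjacent i))

        N₁ᵤ≉0 : ¬ (N₁ zero u ≈ 0#)
        N₁ᵤ≉0 N₁ᵤ≈0 = proj₂ shift (trans (sym (addColumn-at N u (proj₁ shift) v zero)) N₁ᵤ≈0)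

        elimination : ∃ λ t → N₁ zero v + t * N₁ zero u ≈ 0#
        elimination = eliminate (N₁ zero v) N₁ᵤ≉0

        N₂ : Matrix (suc n) (suc n)
        N₂ = addColumn N₁ v (proj₁ elimination) u

        N₁∼N₂ : N₁ ∼ N₂
        N₁∼N₂ = addColumn-∼ N₁ (proj₁ elimination) (inj₂ (inject₁-adjacent i))

        beyond : ∀ j → inject₁ i Fin.< j → Dec (j ≡ suc i) → N₂ zero j ≈ 0#
        beyond j i<j (yes ≡.refl) = trans (addColumn-at N₁ v (proj₁ elimination) u zero) (proj₂ elimination)
        beyond j i<j (no j≢v) = begin
          N₂ zero j  ≈⟨ addColumn-off N₁ v (proj₁ elimination) u zero j j≢v ⟩
          N₁ zero j  ≈⟨ addColumn-off N u (proj₁ shift) v zero j (Fin.<⇒≢ i<j ∘ ≡.sym) ⟩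
          N zero j   ≈⟨ N≈0 j (Fin.≤∧≢⇒< (≡.subst (ℕ._< toℕ j) (Fin.toℕ-inject₁ i) i<j) (j≢v ∘ ≡.sym)) ⟩
          0#         ∎

  -- Both directions are by induction, after column operations have cleared the first row behind its
  -- first entry. If that entry is zero too, the first unit vector is a left-kernel vector.
  -- Otherwise the determinant vanishes with that of the minor, and a left-kernel vector of the
  -- minor extends by a first coordinate that cancels column `zero`.
  det≈0⇒singular : ∀ {n} (M : Matrix n n) → det M ≈ 0# → Singular M
  singular⇒det≈0 : ∀ {n} (M : Matrix n n) → Singular M → det M ≈ 0#

  private
    module Reduced {n} (M : Matrix (suc n) (suc n)) where
      N : Matrix (suc n) (suc n)
      N = proj₁ (reduce M zero)

      M∼N : M ∼ N
      M∼N = proj₁ (proj₂ (reduce M zero))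

      N≈0 : ∀ j → N zero (suc j) ≈ 0#
      N≈0 j = proj₂ (proj₂ (reduce M zero)) (suc j) (s≤s z≤n)

      det-N : det M ≈ N zero zero * det (minor N zero)
      det-N = begin
        det M
          ≈⟨ _∼_.same-det M∼N ⟩
        1# * N zero zero * det (minor N zero) + _
          ≈⟨ +-congˡ (sum-0 λ j → trans (*-congʳ (trans (*-congˡ (N≈0 j)) (zeroʳ _))) (zeroˡ _)) ⟩
        1# * N zero zero * det (minor N zero) + 0#
          ≈⟨ +-identityʳ _ ⟩
        1# * N zero zero * det (minor N zero)
          ≈⟨ *-congʳ (*-identityˡ _) ⟩
        N zero zero * det (minor N zero) ∎

      LN : ∀ (L : Vector Carrier (suc n)) j → (L ᵥ* N) (suc j) ≈ ((L ∘ suc) ᵥ* minor N zero) j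
      LN L j = trans (+-congʳ (trans (*-congˡ (N≈0 j)) (zeroʳ _))) (+-identityˡ _)

  det≈0⇒singular {zero}  M 1≈0 = contradiction (sym 1≈0) 0≉1
  det≈0⇒singular {suc n} M det≈0 with Reduced.N M zero zero ≟ 0#
  ... | yes N₀₀≈0 = unit 0 , (λ e≈0 → 0≉1 (sym (e≈0 zero))) , _∼_.from M∼N (unit 0) λ j → begin
    (unit 0 ᵥ* N) j           ≈⟨ ⟨⟩-comm (unit 0) (λ i → N i j) ⟩
    ⟨ (λ i → N i j) , unit 0 ⟩ ≈⟨ ⟨,unit⟩ (λ i → N i j) zero ⟩
    N zero j                  ≈⟨ row j ⟩
    0#                        ∎
    where
    open Reduced M
    row : ∀ j → N zero j ≈ 0#
    row zero    = N₀₀≈0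
    row (suc j) = N≈0 j
  ... | no N₀₀≉0 = L , (λ L≈0 → proj₁ (proj₂ ih) (L≈0 ∘ suc)) , _∼_.from M∼N L LN≈0
    where
    open Reduced M

    ih : Singular (minor N zero)
    ih = det≈0⇒singular (minor N zero) (*-cancel-0 N₀₀≉0 (trans (sym det-N) det≈0))

    column : Carrier
    column = ⟨ proj₁ ih , (λ i → N (suc i) zero) ⟩

    L : Vector Carrier (suc n)
    L = proj₁ (eliminate column N₀₀≉0) Vector.∷ proj₁ ih

    LN≈0 : Annihilates L N
    LN≈0 zero    = trans (+-comm _ _) (proj₂ (eliminate column N₀₀≉0))
    LN≈0 (suc j) = trans (LN L j) (proj₂ (proj₂ ih) j)

  singular⇒det≈0 {zero}  M (L , L≉0 , _) = contradiction (λ ()) L≉0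
  singular⇒det≈0 {suc n} M (L , L≉0 , LM≈0) with Reduced.N M zero zero ≟ 0#
  ... | yes N₀₀≈0 = trans (Reduced.det-N M) (trans (*-congʳ N₀₀≈0) (zeroˡ _))
  ... | no N₀₀≉0  = trans det-N (trans (*-congˡ (singular⇒det≈0 (minor N zero) (L ∘ suc , tail≉0 , tail-N≈0))) (zeroʳ _))
    where
    open Reduced M

    LN≈0 : Annihilates L N
    LN≈0 = _∼_.to M∼N L LM≈0

    tail-N≈0 : Annihilates (L ∘ suc) (minor N zero)
    tail-N≈0 j = trans (sym (LN L j)) (LN≈0 (suc j))

    tail≉0 : Nontrivial (L ∘ suc)
    tail≉0 L≈0 = L≉0 λ where
      zero    → *-cancel-0 N₀₀≉0 (trans (*-comm _ _)
                  (x+y≈0⇒x≈0 (⟨0,⟩ (λ i → N (suc i) zero) L≈0) (LN≈0 zero)))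
      (suc i) → L≈0 i

inject≤-increasing : ∀ {m n} (m≤n : m ℕ.≤ n) → (λ (i : Fin m) → inject≤ i m≤n) Preserves Fin._<_ ⟶ Fin._<_
inject≤-increasing m≤n {i} {j} i<j =
  ≡.subst₂ ℕ._<_ (≡.sym (Fin.toℕ-inject≤ i m≤n)) (≡.sym (Fin.toℕ-inject≤ j m≤n)) i<j

-- Polynomials with bounded degree and their roots.

module PolynomialRoots {c ℓ q} (F : FiniteField c ℓ q) where
  open FiniteField F hiding (zero)
  open Codes F
  open FieldProperties F
  open MatrixProperties F
  open Exponentiation semiring using (_^_)
  open GroupProperties +-group using (∙-cancelˡ; x∙y⁻¹≈ε⇒x≈y; x≈y⇒x∙y⁻¹≈ε)
  open RingProperties ring using ([y-z]x≈yx-zx)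
  open SetoidReasoning setoid

  horner : ∀ {n} → Vector Carrier n → Carrier → Carrier
  horner {zero}  p x = 0#
  horner {suc n} p x = p zero + x * horner (p ∘ suc) x

  powers : ∀ {n} → Carrier → Vector Carrier n
  powers x i = x ^ toℕ i

  ⟨,powers⟩ : ∀ {n} (p : Vector Carrier n) x → ⟨ p , powers x ⟩ ≈ horner p x
  ⟨,powers⟩ {zero}  p x = refl
  ⟨,powers⟩ {suc n} p x = +-cong (*-identityʳ _)
    (trans (⟨⟩-*ʳ x (p ∘ suc) (powers x)) (*-congˡ (⟨,powers⟩ (p ∘ suc) x)))

  horner-0 : ∀ {n} {p : Vector Carrier n} x → (∀ i → p i ≈ 0#) → horner p x ≈ 0#
  horner-0 {zero}  x p≈0 = refl
  horner-0 {suc n} x p≈0 = trans (+-cong (p≈0 zero) (trans (*-congˡ (horner-0 x (p≈0 ∘ suc))) (zeroʳ x))) (+-identityˡ 0#)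

  -- The quotient of x p(x) − a p(a) by x − a.
  quotient : ∀ {n} → Carrier → Vector Carrier n → Vector Carrier n
  quotient {suc n} a p = horner p a Vector.∷ quotient a (p ∘ suc)

  -- With s the quotient, this is x p(x) - a p(a) = (x - a) s(x), with the negative terms moved
  -- across so that a semiring solver applies.
  quotient-horner : ∀ {n} a (p : Vector Carrier n) x →
    x * horner p x + a * horner (quotient a p) x ≈ a * horner p a + x * horner (quotient a p) x
  quotient-horner {zero}  a p x = trans (+-cong (zeroʳ x) (zeroʳ a)) (sym (+-cong (zeroʳ a) (zeroʳ x)))
  quotient-horner {suc n} a p x = begin
    x * (p zero + x * h) + a * (p[a] + x * s)
      ≈⟨ solve 6 (λ X A P Q H S → X :* (P :+ X :* H) :+ A :* (Q :+ X :* S)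
                               := X :* P :+ A :* Q :+ X :* (X :* H :+ A :* S)) refl x a (p zero) p[a] h s ⟩
    x * p zero + a * p[a] + x * (x * h + a * s)
      ≈⟨ +-congˡ (*-congˡ (quotient-horner a (p ∘ suc) x)) ⟩
    x * p zero + a * p[a] + x * (a * h[a] + x * s)
      ≈⟨ solve 6 (λ X A P Q K S → X :* P :+ A :* Q :+ X :* (A :* K :+ X :* S)
                               := A :* Q :+ X :* (P :+ A :* K :+ X :* S)) refl x a (p zero) p[a] h[a] s ⟩
    a * p[a] + x * (p[a] + x * s) ∎
    where
    open SemiringSolver commutativeSemiring
    h = horner (p ∘ suc) x
    h[a] = horner (p ∘ suc) a
    p[a] = horner p a
    s = horner (quotient a (p ∘ suc)) x

  quotient-trivial : ∀ {n} a (p : Vector Carrier n) → (∀ i → quotient a p i ≈ 0#) → ∀ i → p i ≈ 0#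
  quotient-trivial {suc n} a p s≈0 = Fin.∀-cons
    (x+y≈0⇒x≈0 (trans (*-congˡ (horner-0 a tail≈0)) (zeroʳ a)) (s≈0 zero)) tail≈0
    where
    tail≈0 : ∀ i → p (suc i) ≈ 0#
    tail≈0 = quotient-trivial a (p ∘ suc) (s≈0 ∘ suc)

  *-cancelʳ-≉ : ∀ {x y} s → ¬ (x ≈ y) → x * s ≈ y * s → s ≈ 0#
  *-cancelʳ-≉ {x} {y} s x≉y xs≈ys = *-cancel-0 (x≉y ∘ x∙y⁻¹≈ε⇒x≈y x y)
    (trans ([y-z]x≈yx-zx s x y) (x≈y⇒x∙y⁻¹≈ε xs≈ys))

  -- Write p(x) = p₀ + x h(x), with `a` the first root. Then p(x) - p(a) = x h(x) - a h(a) = (x - a)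
  -- s(x), so s vanishes at all the other roots and has one coefficient less than p. By induction s
  -- = 0, which gives h = 0 and then p₀ = 0.
  roots⇒trivial : ∀ {n} (p : Vector Carrier n) (r : Fin n → Carrier) →
    Injective _≡_ _≈_ r → (∀ i → horner p (r i) ≈ 0#) → ∀ i → p i ≈ 0#
  roots⇒trivial {suc n} p r r-inj p[r]≈0 = Fin.∀-cons
    (x+y≈0⇒x≈0 (trans (*-congˡ (horner-0 a tail≈0)) (zeroʳ a)) (p[r]≈0 zero)) tail≈0
    where
    a = r zero

    s[r]≈0 : ∀ i → horner (quotient a (p ∘ suc)) (r (suc i)) ≈ 0#
    s[r]≈0 i = *-cancelʳ-≉ _ (λ a≈x → Fin.0≢1+n (r-inj a≈x)) (∙-cancelˡ _ _ _ (begin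
      x * horner (p ∘ suc) x + a * s  ≈⟨ quotient-horner a (p ∘ suc) x ⟩
      a * horner (p ∘ suc) a + x * s  ≈⟨ +-congʳ (∙-cancelˡ _ _ _ (trans (p[r]≈0 zero) (sym (p[r]≈0 (suc i))))) ⟩
      x * horner (p ∘ suc) x + x * s  ∎))
      where
      x = r (suc i)
      s = horner (quotient a (p ∘ suc)) x

    tail≈0 : ∀ i → p (suc i) ≈ 0#
    tail≈0 = quotient-trivial a (p ∘ suc)
      (roots⇒trivial (quotient a (p ∘ suc)) (r ∘ suc) (Fin.suc-injective ∘ r-inj) s[r]≈0)

  horner-init : ∀ {n} (p : Vector Carrier (suc n)) x → p (fromℕ n) ≈ 0# → horner p x ≈ horner (p ∘ inject₁) x
  horner-init {zero}  p x pₙ≈0 = trans (+-cong pₙ≈0 (zeroʳ x)) (+-identityˡ 0#)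
  horner-init {suc n} p x pₙ≈0 = +-congˡ (*-congˡ (horner-init (p ∘ suc) x pₙ≈0))

  init-last-trivial : ∀ {n} (p : Vector Carrier (suc n)) → (∀ i → p (inject₁ i) ≈ 0#) → p (fromℕ n) ≈ 0# → ∀ i → p i ≈ 0#
  init-last-trivial {zero}  p init≈0 last≈0 zero    = last≈0
  init-last-trivial {suc n} p init≈0 last≈0 zero    = init≈0 zero
  init-last-trivial {suc n} p init≈0 last≈0 (suc i) = init-last-trivial (p ∘ suc) (init≈0 ∘ suc) last≈0 i

  reedSolomon-independent : Independent (reedSolomon q)
  reedSolomon-independent = is-independent λ L LR≈0 →
    roots⇒trivial L element element-injective λ j → trans (sym (⟨,powers⟩ L (element j))) (LR≈0 j)

-- MDS matrices as zero counts, and the equivalence of (1), (2) and (3).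

module Equivalences {c ℓ q} (F : FiniteField c ℓ q) where
  open FiniteField F hiding (zero)
  open Codes F
  open FieldProperties F
  open MatrixProperties F
  open PolynomialRoots F
  open SetoidReasoning setoid
  open Independent

  module _ {m : ℕ} where
    open LinearAlgebra (columnSpace m) public using (LinearlyIndependent) renaming (combination to columnCombination)

  columnCombination-ᵥ* : ∀ {m n} (a : Vector Carrier n) (v : Matrix n m) i → columnCombination a v i ≡ (a ᵥ* v) i
  columnCombination-ᵥ* {n = zero}  a v i = ≡.refl
  columnCombination-ᵥ* {n = suc n} a v i = ≡.cong₂ _+_ ≡.refl (columnCombination-ᵥ* (a ∘ suc) (v ∘ suc) i)

  linearlyIndependent⇒independent : ∀ {m n} {v : Matrix n m} → LinearlyIndependent v → Independent v
  linearlyIndependent⇒independent {v = v} v-ind = is-independent λ L Lv≈0 →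
    v-ind L λ i → trans (reflexive (columnCombination-ᵥ* L v i)) (Lv≈0 i)

  independent⇒linearlyIndependent : ∀ {m n} {v : Matrix n m} → Independent v → LinearlyIndependent v
  independent⇒linearlyIndependent {v = v} v-ind L Lv≈0 =
    trivial v-ind L λ i → trans (reflexive (≡.sym (columnCombination-ᵥ* L v i))) (Lv≈0 i)

  zero-positions : ∀ {n} (v : Vector Carrier n) → Enumeration (λ j → v j ≈ 0#) (zeros v)
  zero-positions = count-enumeration (_≟ 0#)

  zeros-mono : ∀ {n} {u v : Vector Carrier n} → (∀ i → u i ≈ 0# → v i ≈ 0#) → zeros u ℕ.≤ zeros v
  zeros-mono {u = u} {v} u⇒v = ≥-injective (zero-positions v) (injective (zero-positions u))
    (λ i → u⇒v _ (sound (zero-positions u) i))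
    where open Enumeration

  zeros-cong : ∀ {n} {u v : Vector Carrier n} → (∀ i → u i ≈ v i) → zeros u ≡ zeros v
  zeros-cong u≈v = ℕ.≤-antisym
    (zeros-mono λ i uᵢ≈0 → trans (sym (u≈v i)) uᵢ≈0) (zeros-mono λ i vᵢ≈0 → trans (u≈v i) vᵢ≈0)

  zeros-choice : ∀ {k n} (v : Vector Carrier n) → k ℕ.≤ zeros v →
    ∃ λ (f : Fin k → Fin n) → StrictlyIncreasing f × ∀ i → v (f i) ≈ 0#
  zeros-choice v k≤zeros = (λ i → position (inject≤ i k≤zeros))
    , (λ i<j → increasing (inject≤-increasing k≤zeros i<j)) , (λ i → sound (inject≤ i k≤zeros))
    where open Enumeration (zero-positions v)

  columns : ∀ {k m n} → Matrix k n → (Fin m → Fin n) → Matrix k m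
  columns M f i j = M i (f j)

  combinationWithZeros : ∀ {k m n} {M : Matrix k n} L → Nontrivial L → {g : Fin m → Fin n} →
    Injective _≡_ _≡_ g → (∀ i → (L ᵥ* M) (g i) ≈ 0#) → HasCombinationWithZeros M m
  combinationWithZeros {M = M} L L≉0 g-inj LM≈0 =
    L , L≉0 , Enumeration.≥-injective (zero-positions (L ᵥ* M)) g-inj LM≈0

  -- There are finitely many coefficient vectors up to equality. Decidability licenses the proofs of
  -- (2) by contradiction.
  hasCombinationWithZeros? : ∀ {k n} (M : Matrix k n) z → Dec (HasCombinationWithZeros M z)
  hasCombinationWithZeros? M z = ∃-vector?
    (λ {u} {v} u≈v (u≉0 , z≤zeros) → (λ v≈0 → u≉0 λ i → trans (u≈v i) (v≈0 i))
      , ≡.subst (z ℕ.≤_) (zeros-cong {u = u ᵥ* M} (λ j → ⟨⟩-congʳ (λ i → M i j) u≈v)) z≤zeros)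
    (λ L → ¬? (Fin.all? λ i → L i ≟ 0#) ×-dec (z ℕ.≤? zeros (L ᵥ* M)))

  hasCombinationWithZeros-stable : ∀ {k n z} (M : Matrix k n) →
    ¬ ¬ HasCombinationWithZeros M z → HasCombinationWithZeros M z
  hasCombinationWithZeros-stable {z = z} M = decidable-stable (hasCombinationWithZeros? M z)

  module _ {k n : ℕ} (M : Matrix k n) where

    columns-independent : ¬ HasCombinationWithZeros M k → {g : Fin k → Fin n} → Injective _≡_ _≡_ g → Independent (columns M g)
    columns-independent ¬comb g-inj = independent λ (L , L≉0 , LM≈0) → ¬comb (combinationWithZeros {M = M} L L≉0 g-inj LM≈0)

    -- The zeros of a combination select a square submatrix with dependent rows, whereas `IsMDS`
    -- speaks of its columns; `transpose-independent` mediates, here and in the converse.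
    MDS⇒¬combination : IsMDS M → ¬ HasCombinationWithZeros M k
    MDS⇒¬combination mds (L , L≉0 , k≤zeros) =
      let f , f-inc , LM≈0 = zeros-choice (L ᵥ* M) k≤zeros
      in L≉0 (trivial (transpose-independent (linearlyIndependent⇒independent (mds f f-inc))) L LM≈0)

    ¬combination⇒MDS : ¬ HasCombinationWithZeros M k → IsMDS M
    ¬combination⇒MDS ¬comb f f-inc = independent⇒linearlyIndependent
      (transpose-independent (columns-independent ¬comb (increasing⇒injective f-inc)))

  -- The column in front is the point at infinity: it reads off the coefficient of x^(k-1).
  extendedReedSolomon : ∀ k → Matrix k (suc q)
  extendedReedSolomon k i = unit (k ℕ.∸ 1) i Vector.∷ reedSolomon k i

  -- Of the increasing zero positions only the first can be the point at infinity. If it is not, a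
  -- nonzero polynomial has as many roots as coefficients. If it is, the leading coefficient
  -- vanishes, and one coefficient less faces one root less.
  extendedReedSolomon-¬combination : ∀ k → ¬ HasCombinationWithZeros (extendedReedSolomon k) k
  extendedReedSolomon-¬combination zero    (L , L≉0 , _) = L≉0 λ ()
  extendedReedSolomon-¬combination (suc k) (L , L≉0 , k≤zeros) = by-cases (f zero Fin.≟ zero)
    where
    choice = zeros-choice (L ᵥ* extendedReedSolomon (suc k)) k≤zeros

    f : Fin (suc k) → Fin (suc q)
    f = proj₁ choice

    f-inc : StrictlyIncreasing f
    f-inc = proj₁ (proj₂ choice)

    zero-at : ∀ i → (L ᵥ* extendedReedSolomon (suc k)) (f i) ≈ 0#
    zero-at = proj₂ (proj₂ choice)

    root : ∀ i → f i ≢ zero → Carrier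
    root i fᵢ≢0 = element (punchOut (≡.≢-sym fᵢ≢0))

    root-horner : ∀ i (fᵢ≢0 : f i ≢ zero) → horner L (root i fᵢ≢0) ≈ 0#
    root-horner i fᵢ≢0 = trans (sym (⟨,powers⟩ L (root i fᵢ≢0)))
      (≡.subst (λ j → (L ᵥ* extendedReedSolomon (suc k)) j ≈ 0#)
        (≡.sym (Fin.punchIn-punchOut (≡.≢-sym fᵢ≢0))) (zero-at i))

    root-injective : ∀ {i j} (fᵢ≢0 : f i ≢ zero) (fⱼ≢0 : f j ≢ zero) → root i fᵢ≢0 ≈ root j fⱼ≢0 → i ≡ j
    root-injective fᵢ≢0 fⱼ≢0 eq = increasing⇒injective f-inc
      (Fin.punchOut-injective (≡.≢-sym fᵢ≢0) (≡.≢-sym fⱼ≢0) (element-injective eq))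

    by-cases : ¬ Dec (f zero ≡ zero)
    by-cases (no f₀≢0) = L≉0 (roots⇒trivial L (λ i → root i (fᵢ≢0 i)) (root-injective (fᵢ≢0 _) (fᵢ≢0 _))
      (λ i → root-horner i (fᵢ≢0 i)))
      where
      fᵢ≢0 : ∀ i → f i ≢ zero
      fᵢ≢0 zero    = f₀≢0
      fᵢ≢0 (suc i) eq with () ← ≡.subst (f zero Fin.<_) eq (f-inc {zero} {suc i} (s≤s z≤n))
    by-cases (yes f₀≡0) = L≉0 (init-last-trivial L
      (roots⇒trivial (L ∘ inject₁) (λ i → root (suc i) (fᵢ≢0 i)) (λ eq → Fin.suc-injective (root-injective (fᵢ≢0 _) (fᵢ≢0 _) eq))
        (λ i → trans (sym (horner-init L (root (suc i) (fᵢ≢0 i)) last≈0)) (root-horner (suc i) (fᵢ≢0 i)))) last≈0)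
      where
      fᵢ≢0 : ∀ i → f (suc i) ≢ zero
      fᵢ≢0 i eq = Fin.0≢1+n (increasing⇒injective f-inc (≡.trans f₀≡0 (≡.sym eq)))

      last≈0 : L (fromℕ k) ≈ 0#
      last≈0 = begin
        L (fromℕ k)                       ≈⟨ ⟨,unit⟩ L (fromℕ k) ⟨
        ⟨ L , unit (toℕ (fromℕ k)) ⟩      ≡⟨ ≡.cong (λ l → ⟨ L , unit l ⟩) (Fin.toℕ-fromℕ k) ⟩
        ⟨ L , unit k ⟩                    ≈⟨ ≡.subst (λ j → (L ᵥ* extendedReedSolomon (suc k)) j ≈ 0#) f₀≡0 (zero-at zero) ⟩
        0#                                ∎

  module _ {k : ℕ} (¬exceptional : ¬ Exceptional k) where

    statement₁⇒statement₂ : Statement₁ k → Statement₂ k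
    statement₁⇒statement₂ (max , _) M = hasCombinationWithZeros-stable M λ ¬comb →
      ℕ.<⇒≱ ℕ.≤-refl (proj₂ (max ¬exceptional) (2 ℕ.+ q) M (¬combination⇒MDS M ¬comb))

    statement₂⇒statement₁ : Statement₂ k → Statement₁ k
    statement₂⇒statement₁ stmt₂ =
        (λ _ → (extendedReedSolomon k , ¬combination⇒MDS (extendedReedSolomon k) (extendedReedSolomon-¬combination k)) , bound)
      , λ exceptional → contradiction exceptional ¬exceptional
      where
      bound : ∀ n (M : Matrix k n) → IsMDS M → n ℕ.≤ suc q
      -- The first q + 2 columns of a wider MDS matrix are again MDS, against (2).
      bound n M mds = ℕ.≮⇒≥ λ 2+q≤n → MDS⇒¬combination (columns M λ j → inject≤ j 2+q≤n)
        (λ f f-inc → mds (λ i → inject≤ (f i) 2+q≤n) (λ i<j → inject≤-increasing 2+q≤n (f-inc i<j)))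
        (stmt₂ (columns M λ j → inject≤ j 2+q≤n))

  statement₂⇒statement₃ : ∀ {k} → Statement₂ k → Statement₃ k
  statement₂⇒statement₃ stmt₂ M _ _ = stmt₂ M

  -- If no combination has k zeros, the square block `C` of the first k columns is invertible.
  -- Multiplying by its inverse `E` turns the first two columns into the unit vectors of (3), and a
  -- combination L′ of the rows of EM is the combination L′E of the rows of M.
  statement₃⇒statement₂ : ∀ {k} → 2 ℕ.≤ k → k ℕ.≤ q → Statement₃ k → Statement₂ k
  statement₃⇒statement₂ {k} (s≤s (s≤s _)) k≤q stmt₃ M = hasCombinationWithZeros-stable M λ ¬comb → ¬comb (invert ¬comb)
    where
    k≤2+q : k ℕ.≤ 2 ℕ.+ q
    k≤2+q = ℕ.m≤n⇒m≤1+n (ℕ.m≤n⇒m≤1+n k≤q)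

    C : Matrix k k
    C = columns M (λ j → inject≤ j k≤2+q)

    invert : ¬ HasCombinationWithZeros M k → HasCombinationWithZeros M k
    invert ¬comb = L , L≉0 , ≡.subst (k ℕ.≤_)
      (zeros-cong {u = L′ ᵥ* λ i → E i ᵥ* M} λ j → sym (ᵥ*-⟨⟩ L′ E (λ i → M i j))) (proj₂ (proj₂ comb′))
      where
      inverse : ∀ i → ∃ λ L → ∀ j → (L ᵥ* C) j ≈ unit (toℕ j) i
      inverse i = row-solve (columns-independent M ¬comb (Fin.inject≤-injective k≤2+q k≤2+q _ _)) ℕ.≤-refl (λ j → unit (toℕ j) i)

      E : Matrix k k
      E i = proj₁ (inverse i)

      comb′ : HasCombinationWithZeros (λ i → E i ᵥ* M) k
      comb′ = stmt₃ (λ i → E i ᵥ* M) (λ i → proj₂ (inverse i) zero) (λ i → proj₂ (inverse i) (suc zero))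

      L′ L : Vector Carrier k
      L′ = proj₁ comb′
      L = L′ ᵥ* E

      L≉0 : Nontrivial L
      L≉0 L≈0 = proj₁ (proj₂ comb′) λ j → begin
        L′ j                                     ≈⟨ ⟨,unit⟩ L′ j ⟨
        ⟨ L′ , unit (toℕ j) ⟩                    ≈⟨ ⟨⟩-congˡ L′ (λ i → proj₂ (inverse i) j) ⟨
        ⟨ L′ , (λ i → ⟨ E i , (λ l → C l j) ⟩) ⟩ ≈⟨ ᵥ*-⟨⟩ L′ E (λ l → C l j) ⟨
        ⟨ L , (λ l → C l j) ⟩                    ≈⟨ ⟨0,⟩ (λ l → C l j) L≈0 ⟩
        0#                                       ∎

-- Positions in R ∪ B: the first d columns of B, and the remaining ones with
-- the last two columns of B moved to the front.
module Positions (q d : ℕ) where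

  encode : Fin d ⊎ Fin (2 ℕ.+ q) → Fin (q ℕ.+ (d ℕ.+ 2))
  encode (inj₁ i)             = q ↑ʳ (i ↑ˡ 2)
  encode (inj₂ zero)          = q ↑ʳ (d ↑ʳ zero)
  encode (inj₂ (suc zero))    = q ↑ʳ (d ↑ʳ suc zero)
  encode (inj₂ (suc (suc j))) = j ↑ˡ (d ℕ.+ 2)

  decode : Fin (q ℕ.+ (d ℕ.+ 2)) → Fin d ⊎ Fin (2 ℕ.+ q)
  decode = [ inj₂ ∘ (2 ↑ʳ_) , [ inj₁ , inj₂ ∘ (_↑ˡ q) ]′ ∘ splitAt d ]′ ∘ splitAt q

  decode-encode : ∀ x → decode (encode x) ≡ x
  decode-encode (inj₁ i)
    rewrite Fin.splitAt-↑ʳ q (d ℕ.+ 2) (i ↑ˡ 2) | Fin.splitAt-↑ˡ d i 2 = ≡.refl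
  decode-encode (inj₂ zero)
    rewrite Fin.splitAt-↑ʳ q (d ℕ.+ 2) (d ↑ʳ zero) | Fin.splitAt-↑ʳ d 2 zero = ≡.refl
  decode-encode (inj₂ (suc zero))
    rewrite Fin.splitAt-↑ʳ q (d ℕ.+ 2) (d ↑ʳ suc zero) | Fin.splitAt-↑ʳ d 2 (suc zero) = ≡.refl
  decode-encode (inj₂ (suc (suc j)))
    rewrite Fin.splitAt-↑ˡ q j (d ℕ.+ 2) = ≡.refl

  encode-decode : ∀ x → encode (decode x) ≡ x
  encode-decode x with splitAt q x in eq
  ... | inj₁ j = Fin.splitAt⁻¹-↑ˡ eq
  ... | inj₂ y with splitAt d y in eq′
  ...   | inj₁ i          = ≡.trans (≡.cong (q ↑ʳ_) (Fin.splitAt⁻¹-↑ˡ eq′)) (Fin.splitAt⁻¹-↑ʳ eq)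
  ...   | inj₂ zero       = ≡.trans (≡.cong (q ↑ʳ_) (Fin.splitAt⁻¹-↑ʳ eq′)) (Fin.splitAt⁻¹-↑ʳ eq)
  ...   | inj₂ (suc zero) = ≡.trans (≡.cong (q ↑ʳ_) (Fin.splitAt⁻¹-↑ʳ eq′)) (Fin.splitAt⁻¹-↑ʳ eq)

  encode-injective : ∀ {x y} → encode x ≡ encode y → x ≡ y
  encode-injective {x} {y} eq =
    ≡.trans (≡.sym (decode-encode x)) (≡.trans (≡.cong decode eq) (decode-encode y))

∀-split : ∀ m {n p} {P : Fin (m ℕ.+ n) → Set p} →
  (∀ i → P (i ↑ˡ n)) → (∀ i → P (m ↑ʳ i)) → ∀ i → P i
∀-split m {n} {P = P} Pˡ Pʳ i with splitAt m i in eq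
... | inj₁ j = ≡.subst P (Fin.splitAt⁻¹-↑ˡ eq) (Pˡ j)
... | inj₂ j = ≡.subst P (Fin.splitAt⁻¹-↑ʳ eq) (Pʳ j)

-- From (2) to (5).

module SecondToFifth {c ℓ q} (F : FiniteField c ℓ q) where
  open FiniteField F hiding (zero)
  open Codes F
  open MatrixProperties F
  open Determinants F
  open Equivalences F
  open SetoidReasoning setoid
  open Independent

  independent-take : ∀ {m n p} (A : Matrix (m ℕ.+ n) p) → Independent A → Independent (A ∘ (_↑ˡ n))
  independent-take {m} {n} A A-ind = is-independent λ L LA≈0 i →
    trans (reflexive (≡.sym (lookup-++ˡ L (λ _ → 0#) i))) (trivial A-ind (L ++ λ _ → 0#) (λ j → begin
      ((L ++ λ _ → 0#) ᵥ* A) j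
        ≈⟨ ⟨⟩-split m (L ++ λ _ → 0#) (λ i → A i j) ⟩
      ⟨ (L ++ λ _ → 0#) ∘ (_↑ˡ n) , (λ i → A (i ↑ˡ n) j) ⟩ + ⟨ (L ++ λ _ → 0#) ∘ (m ↑ʳ_) , (λ i → A (m ↑ʳ i) j) ⟩
        ≈⟨ +-cong (⟨⟩-congʳ (λ i → A (i ↑ˡ n) j) (λ i → reflexive (lookup-++ˡ L (λ _ → 0#) i)))
                  (⟨0,⟩ (λ i → A (m ↑ʳ i) j) (λ i → reflexive (lookup-++ʳ L (λ _ → 0#) i))) ⟩
      (L ᵥ* (A ∘ (_↑ˡ n))) j + 0#
        ≈⟨ +-identityʳ _ ⟩
      (L ᵥ* (A ∘ (_↑ˡ n))) j
        ≈⟨ LA≈0 j ⟩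
      0# ∎) (i ↑ˡ n))

  independent-cong : ∀ {m n} {A B : Matrix m n} → (∀ i j → A i j ≈ B i j) → Independent A → Independent B
  independent-cong A≈B A-ind = is-independent λ L LB≈0 →
    trivial A-ind L λ j → trans (⟨⟩-congˡ L (λ i → A≈B i j)) (LB≈0 j)

  module _ {k s : ℕ} (k<s : k ℕ.< s) (b : Vector (Vector Carrier s) (s ℕ.∸ k ℕ.+ 2)) where
    private
      d : ℕ
      d = s ℕ.∸ k

      k+d≡s : k ℕ.+ d ≡ s
      k+d≡s = ℕ.m+[n∸m]≡n (ℕ.<⇒≤ k<s)

      R∪B : Matrix s (q ℕ.+ (d ℕ.+ 2))
      R∪B = transpose (transpose (reedSolomon s) ++ b)

    open Positions q d

    module _ (b-ind : Independent (λ i → b (i ↑ˡ 2))) where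
      private
        extension : ∃ λ (X : Matrix (k ℕ.+ d) s) → Independent X × ∀ i j → X (k ↑ʳ i) j ≈ b (i ↑ˡ 2) j
        extension = extend-independent k b-ind (ℕ.≤-reflexive k+d≡s)

        X : Matrix (k ℕ.+ d) s
        X = proj₁ extension

        δ : Fin k → Vector Carrier k
        δ i j = unit (toℕ j) i

        none : Vector Carrier d
        none _ = 0#

        dual : ∀ (i : Fin k) → ∃ λ x → ∀ r → ⟨ X r , x ⟩ ≈ (δ i ++ none) r
        dual i = column-solve (proj₁ (proj₂ extension)) k+d≡s (δ i ++ none)

      -- The vectors dual to the first k rows of `X`, that is, to those that complete b₁, ...,
      -- b_{s-k} to a basis. Pairing with the first k rows shows independence, pairing with the
      -- others shows orthogonality to the b's.
      projection : Matrix k s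
      projection i = proj₁ (dual i)

      projection-independent : Independent projection
      projection-independent = is-independent λ L LP≈0 j → begin
        L j
          ≈⟨ ⟨,unit⟩ L j ⟨
        ⟨ L , unit (toℕ j) ⟩
          ≈⟨ ⟨⟩-congˡ L (λ i → trans (⟨⟩-comm (projection i) (X (j ↑ˡ d))) (trans (proj₂ (dual i) (j ↑ˡ d))
               (reflexive (lookup-++ˡ (δ i) none j)))) ⟨
        ⟨ L , (λ i → ⟨ projection i , X (j ↑ˡ d) ⟩) ⟩
          ≈⟨ ᵥ*-⟨⟩ L projection (X (j ↑ˡ d)) ⟨
        ⟨ L ᵥ* projection , X (j ↑ˡ d) ⟩
          ≈⟨ ⟨0,⟩ (X (j ↑ˡ d)) LP≈0 ⟩
        0# ∎

      projection-b : ∀ i j → ⟨ projection i , b (j ↑ˡ 2) ⟩ ≈ 0#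
      projection-b i j = begin
        ⟨ projection i , b (j ↑ˡ 2) ⟩                          ≈⟨ ⟨⟩-congˡ (projection i) (proj₂ (proj₂ extension) j) ⟨
        ⟨ projection i , X (k ↑ʳ j) ⟩                          ≈⟨ ⟨⟩-comm (projection i) (X (k ↑ʳ j)) ⟩
        ⟨ X (k ↑ʳ j) , projection i ⟩                          ≈⟨ proj₂ (dual i) (k ↑ʳ j) ⟩
        (δ i ++ none) (k ↑ʳ j)                                 ≡⟨ lookup-++ʳ (δ i) none j ⟩
        0#                                                     ∎

      projected : Matrix k (2 ℕ.+ q)
      projected i j = ⟨ projection i , (λ l → R∪B l (encode (inj₂ j))) ⟩

      -- The row `LP` vanishes on k columns chosen among the zeros and on b₁, ..., b_{s-k}, which
      -- makes s columns. They are sorted because (5) admits only increasing selections.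
      singular-columns : HasCombinationWithZeros projected k →
        ∃ λ (f : Fin s → Fin (q ℕ.+ (d ℕ.+ 2))) → StrictlyIncreasing f ×
          (∀ i → ∃ λ j → f j ≡ q ↑ʳ (i ↑ˡ 2)) × det (columns R∪B f) ≈ 0#
      singular-columns (L , L≉0 , k≤zeros) = f , f-inc , f-b , singular⇒det≈0 (columns R∪B f) (LP , LP≉0 , λ j →
        let i , hᵢ≡fⱼ = f⊆h j in ≡.subst (λ x → (LP ᵥ* R∪B) x ≈ 0#) hᵢ≡fⱼ (h≈0 (splitAt k (cast (≡.sym k+d≡s) i))))
        where
        LP : Vector Carrier s
        LP = L ᵥ* projection

        LP≉0 : Nontrivial LP
        LP≉0 LP≈0 = L≉0 (trivial projection-independent L LP≈0)

        choice : ∃ λ (g : Fin k → Fin (2 ℕ.+ q)) → StrictlyIncreasing g × ∀ i → (L ᵥ* projected) (g i) ≈ 0#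
        choice = zeros-choice (L ᵥ* projected) k≤zeros

        g : Fin k → Fin (2 ℕ.+ q)
        g = proj₁ choice

        place : Fin k ⊎ Fin d → Fin d ⊎ Fin (2 ℕ.+ q)
        place = [ inj₂ ∘ g , inj₁ ]′

        place-injective : ∀ {x y} → place x ≡ place y → x ≡ y
        place-injective {inj₁ x} {inj₁ y} eq = ≡.cong inj₁ (increasing⇒injective (proj₁ (proj₂ choice)) (inj₂-injective eq))
        place-injective {inj₂ x} {inj₂ y} eq = ≡.cong inj₂ (inj₁-injective eq)

        h : Fin s → Fin (q ℕ.+ (d ℕ.+ 2))
        h i = encode (place (splitAt k (cast (≡.sym k+d≡s) i)))

        splitAt-injective : ∀ {x y : Fin (k ℕ.+ d)} → splitAt k x ≡ splitAt k y → x ≡ y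
        splitAt-injective {x} {y} eq = ≡.trans (≡.sym (Fin.join-splitAt k d x))
          (≡.trans (≡.cong (Fin.join k d) eq) (Fin.join-splitAt k d y))

        h-injective : Injective _≡_ _≡_ h
        h-injective {x} {y} eq = Fin.toℕ-injective (≡.trans (≡.sym (Fin.toℕ-cast (≡.sym k+d≡s) x))
          (≡.trans (≡.cong toℕ (splitAt-injective (place-injective (encode-injective eq)))) (Fin.toℕ-cast (≡.sym k+d≡s) y)))

        sorted : Sorting h
        sorted = sort h h-injective

        f : Fin s → Fin (q ℕ.+ (d ℕ.+ 2))
        f = proj₁ sorted

        f-inc : StrictlyIncreasing f
        f-inc = proj₁ (proj₂ sorted)

        f⊆h : ∀ j → ∃ λ i → h i ≡ f j
        f⊆h = proj₁ (proj₂ (proj₂ sorted))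

        f-b : ∀ i → ∃ λ j → f j ≡ q ↑ʳ (i ↑ˡ 2)
        f-b i = let j , fⱼ≡h = proj₂ (proj₂ (proj₂ sorted)) (cast k+d≡s (k ↑ʳ i)) in j , ≡.trans fⱼ≡h
          (≡.cong (encode ∘ place) (≡.trans (≡.cong (splitAt k)
            (≡.trans (Fin.cast-trans k+d≡s (≡.sym k+d≡s) (k ↑ʳ i)) (Fin.cast-is-id ≡.refl (k ↑ʳ i))))
            (Fin.splitAt-↑ʳ k d i)))

        h≈0 : ∀ x → (LP ᵥ* R∪B) (encode (place x)) ≈ 0#
        h≈0 (inj₁ i) = trans (ᵥ*-⟨⟩ L projection (λ l → R∪B l (encode (inj₂ (g i))))) (proj₂ (proj₂ choice) i)
        h≈0 (inj₂ i) = begin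
          (LP ᵥ* R∪B) (q ↑ʳ (i ↑ˡ 2))
            ≈⟨ ⟨⟩-congˡ LP (λ l → reflexive (≡.cong (λ w → w l) (lookup-++ʳ (transpose (reedSolomon s)) b (i ↑ˡ 2)))) ⟩
          ⟨ LP , b (i ↑ˡ 2) ⟩
            ≈⟨ ᵥ*-⟨⟩ L projection (b (i ↑ˡ 2)) ⟩
          ⟨ L , (λ i′ → ⟨ projection i′ , b (i ↑ˡ 2) ⟩) ⟩
            ≈⟨ ⟨,0⟩ L (λ i′ → projection-b i′ i) ⟩
          0# ∎

  statement₂⇒statement₅ : ∀ {k} → Statement₂ k → Statement₅ k
  statement₂⇒statement₅ {k} stmt₂ (s , k<s , _ , b , minors≉0 , b∪e-ind) =
    let f , f-inc , f-b , det≈0 = singular-columns k<s b b-ind (stmt₂ (projected k<s b b-ind))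
    in minors≉0 f f-inc f-b det≈0
    where
    d : ℕ
    d = s ℕ.∸ k

    e : Vector (Vector Carrier s) 1
    e = unit (s ℕ.∸ 1) Vector.∷ Vector.[]

    b-ind : Independent (λ i → b (i ↑ˡ 2))
    b-ind = independent-cong (λ i j → reflexive (≡.cong (λ w → w j) (lookup-++ˡ b e (i ↑ˡ 2))))
      (independent-take {d} ((b ++ e) ∘ (_↑ˡ 1)) (independent-take {d ℕ.+ 2} (b ++ e) (linearlyIndependent⇒independent b∪e-ind)))

-- Statement (2) for k = 2 and k = q.

module _ {q : ℕ} where

  -- The positions 2, …, q + 1, except that i is moved to a.
  moveOne : Fin 2 → Fin q → Fin q → Fin (2 ℕ.+ q)
  moveOne a i t with t Fin.≟ i
  ... | yes _ = a ↑ˡ q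
  ... | no _  = suc (suc t)

  moveOne-injective : ∀ a i → Injective _≡_ _≡_ (moveOne a i)
  moveOne-injective a i {s} {t} eq with s Fin.≟ i | t Fin.≟ i
  moveOne-injective a          i eq | yes s≡i | yes t≡i = ≡.trans s≡i (≡.sym t≡i)
  moveOne-injective a          i eq | no _    | no _    = Fin.suc-injective (Fin.suc-injective eq)
  moveOne-injective zero       i () | yes _   | no _
  moveOne-injective (suc zero) i () | yes _   | no _
  moveOne-injective zero       i () | no _    | yes _
  moveOne-injective (suc zero) i () | no _    | yes _

  moveOne-elim : ∀ {p} {P : Fin (2 ℕ.+ q) → Set p} a i → P (a ↑ˡ q) →
    (∀ t → t ≢ i → P (suc (suc t))) → ∀ t → P (moveOne a i t)
  moveOne-elim a i Pₐ P₂ t with t Fin.≟ i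
  ... | yes _  = Pₐ
  ... | no t≢i = P₂ t t≢i

  -- The q zeros of a combination that vanishes in the first two columns and everywhere in the last
  -- q columns except at i and j.
  moveTwo : Fin q → Fin q → Fin q → Fin (2 ℕ.+ q)
  moveTwo i j t with t Fin.≟ i | t Fin.≟ j
  ... | yes _ | _     = zero
  ... | no _  | yes _ = suc zero
  ... | no _  | no _  = suc (suc t)

  moveTwo-injective : ∀ i j → Injective _≡_ _≡_ (moveTwo i j)
  moveTwo-injective i j {s} {t} eq with s Fin.≟ i | s Fin.≟ j | t Fin.≟ i | t Fin.≟ j
  moveTwo-injective i j eq | yes s≡i | _       | yes t≡i | _       = ≡.trans s≡i (≡.sym t≡i)
  moveTwo-injective i j eq | no _    | yes s≡j | no _    | yes t≡j = ≡.trans s≡j (≡.sym t≡j)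
  moveTwo-injective i j eq | no _    | no _    | no _    | no _    = Fin.suc-injective (Fin.suc-injective eq)
  moveTwo-injective i j () | yes _   | _       | no _    | yes _
  moveTwo-injective i j () | yes _   | _       | no _    | no _
  moveTwo-injective i j () | no _    | yes _   | yes _   | _
  moveTwo-injective i j () | no _    | no _    | yes _   | _
  moveTwo-injective i j () | no _    | yes _   | no _    | no _
  moveTwo-injective i j () | no _    | no _    | no _    | yes _

  moveTwo-elim : ∀ {p} {P : Fin (2 ℕ.+ q) → Set p} i j → P zero → P (suc zero) →
    (∀ t → t ≢ i → t ≢ j → P (suc (suc t))) → ∀ t → P (moveTwo i j t)
  moveTwo-elim i j P₀ P₁ P₂ t with t Fin.≟ i | t Fin.≟ j
  ... | yes _  | _      = P₀
  ... | no _   | yes _  = P₁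
  ... | no t≢i | no t≢j = P₂ t t≢i t≢j

module ExtremeDimensions {c ℓ q} (F : FiniteField c ℓ q) where
  open FiniteField F hiding (zero)
  open Codes F
  open FieldProperties F
  open MatrixProperties F
  open Equivalences F
  open RingProperties ring using (-‿distribˡ-*)
  open SetoidReasoning setoid

  x*y-y*x≈0 : ∀ x y {a b} → x * a ≈ y * b → x * a + - y * b ≈ 0#
  x*y-y*x≈0 x y {a} {b} xa≈yb = begin
    x * a + - y * b   ≈⟨ +-cong xa≈yb (sym (-‿distribˡ-* y b)) ⟩
    y * b - y * b     ≈⟨ -‿inverseʳ _ ⟩
    0#                ∎

  -- By (3) the first two columns may be taken to be unit vectors. The other q columns then have no
  -- zero entry, two of them have the same ratio of entries, and a vector orthogonal to one of these
  -- is orthogonal to both.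
  dimension-2 : Statement₂ 2
  dimension-2 = statement₃⇒statement₂ ℕ.≤-refl 1<q λ M M₀ M₁ → hasCombinationWithZeros-stable M (no-MDS M M₀ M₁)
    where
    module _ (M : Matrix 2 (2 ℕ.+ q)) (M₀ : ∀ i → M i zero ≈ unit 0 i) (M₁ : ∀ i → M i (suc zero) ≈ unit 1 i)
             (¬comb : ¬ HasCombinationWithZeros M 2) where
      x y : Vector Carrier q
      x j = M zero (suc (suc j))
      y j = M (suc zero) (suc (suc j))

      pair : ∀ {n} → Fin n → Fin n → Fin 2 → Fin n
      pair i j zero       = i
      pair i j (suc zero) = j

      pair-injective : ∀ {n} {i j : Fin n} → i ≢ j → Injective _≡_ _≡_ (pair i j)
      pair-injective i≢j {zero}     {zero}     _  = ≡.refl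
      pair-injective i≢j {zero}     {suc zero} eq = contradiction eq i≢j
      pair-injective i≢j {suc zero} {zero}     eq = contradiction (≡.sym eq) i≢j
      pair-injective i≢j {suc zero} {suc zero} _  = ≡.refl

      two-zeros : ∀ L → Nontrivial L → ∀ {i j} → i ≢ j → (L ᵥ* M) i ≈ 0# → ¬ ((L ᵥ* M) j ≈ 0#)
      two-zeros L L≉0 i≢j LMᵢ≈0 LMⱼ≈0 = ¬comb (combinationWithZeros {M = M} L L≉0 (pair-injective i≢j)
        λ { zero → LMᵢ≈0 ; (suc zero) → LMⱼ≈0 })

      unit-row : ∀ i j → (unit (toℕ i) ᵥ* M) j ≈ M i j
      unit-row i j = trans (⟨⟩-comm (unit (toℕ i)) (λ l → M l j)) (⟨,unit⟩ (λ l → M l j) i)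

      unit≉0 : ∀ (i : Fin 2) → Nontrivial (unit {2} (toℕ i))
      unit≉0 i e≈0 = 0≉1 (trans (sym (e≈0 i)) (unit-diagonal i))

      x≉0 : ∀ j → ¬ (x j ≈ 0#)
      x≉0 j xⱼ≈0 = two-zeros (unit 0) (unit≉0 zero) {suc zero} {suc (suc j)} (λ ())
        (trans (unit-row zero (suc zero)) (M₁ zero)) (trans (unit-row zero (suc (suc j))) xⱼ≈0)

      y≉0 : ∀ j → ¬ (y j ≈ 0#)
      y≉0 j yⱼ≈0 = two-zeros (unit 1) (unit≉0 (suc zero)) {zero} {suc (suc j)} (λ ())
        (trans (unit-row (suc zero) zero) (M₀ (suc zero))) (trans (unit-row (suc zero) (suc (suc j))) yⱼ≈0)

      no-MDS : ⊥
      no-MDS = let i , j , i≢j , xᵢyⱼ≈xⱼyᵢ = equal-ratios x y x≉0 y≉0 in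
        two-zeros (y i Vector.∷ - x i Vector.∷ Vector.[]) (λ L≈0 → y≉0 i (L≈0 zero))
          {suc (suc i)} {suc (suc j)} (i≢j ∘ Fin.suc-injective ∘ Fin.suc-injective)
          (trans (+-congˡ (+-identityʳ _)) (x*y-y*x≈0 (y i) (x i) (*-comm _ _)))
          (trans (+-congˡ (+-identityʳ _)) (x*y-y*x≈0 (y i) (x i) (trans (*-comm _ _) (sym xᵢyⱼ≈xⱼyᵢ))))

  -- Otherwise the last q columns are invertible, and `E i` is the combination that equals the i-th
  -- unit vector there. It has q - 1 zeros already, so its entries `u i` and `v i` in the first two
  -- columns are nonzero. If the ratios at i and j agree, v_j E_i - v_i E_j has 2 + (q - 2) zeros.
  dimension-q : Statement₂ q
  dimension-q M = hasCombinationWithZeros-stable M no-MDS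
    where
    module _ (¬comb : ¬ HasCombinationWithZeros M q) where
      dual : ∀ i → ∃ λ E → ∀ j → (E ᵥ* columns M (2 ↑ʳ_)) j ≈ unit (toℕ i) j
      dual i = row-solve (columns-independent M ¬comb (Fin.suc-injective ∘ Fin.suc-injective)) ℕ.≤-refl (unit (toℕ i))

      E : Matrix q q
      E i = proj₁ (dual i)

      u v : Vector Carrier q
      u i = (E i ᵥ* M) zero
      v i = (E i ᵥ* M) (suc zero)

      E-diagonal : ∀ i → (E i ᵥ* M) (suc (suc i)) ≈ 1#
      E-diagonal i = trans (proj₂ (dual i) i) (unit-diagonal i)

      E-off-diagonal : ∀ i j → j ≢ i → (E i ᵥ* M) (suc (suc j)) ≈ 0#
      E-off-diagonal i j j≢i = trans (proj₂ (dual i) j) (unit-off-diagonal j (j≢i ∘ Fin.toℕ-injective))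

      E≉0 : ∀ i → Nontrivial (E i)
      E≉0 i Eᵢ≈0 = 0≉1 (trans (sym (⟨0,⟩ (λ l → M l (suc (suc i))) Eᵢ≈0)) (E-diagonal i))

      first≉0 : ∀ (a : Fin 2) i → ¬ ((E i ᵥ* M) (a ↑ˡ q) ≈ 0#)
      first≉0 a i EᵢM≈0 = ¬comb (combinationWithZeros {M = M} (E i) (E≉0 i) (moveOne-injective a i) 
        (moveOne-elim {P = λ c → (E i ᵥ* M) c ≈ 0#} a i EᵢM≈0 (E-off-diagonal i)))

      module _ {i j : Fin q} (i≢j : i ≢ j) (uᵢvⱼ≈uⱼvᵢ : u i * v j ≈ u j * v i) where
        L : Vector Carrier q
        L t = v j * E i t + - v i * E j t

        LM : ∀ c → (L ᵥ* M) c ≈ v j * (E i ᵥ* M) c + - v i * (E j ᵥ* M) c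
        LM c = trans (⟨⟩-+ˡ (λ t → v j * E i t) (λ t → - v i * E j t) (λ l → M l c))
          (+-cong (⟨⟩-*ˡ (v j) (E i) (λ l → M l c)) (⟨⟩-*ˡ (- v i) (E j) (λ l → M l c)))

        L≉0 : Nontrivial L
        L≉0 L≈0 = first≉0 (suc zero) j (begin
          v j                             ≈⟨ *-identityʳ _ ⟨
          v j * 1#                        ≈⟨ *-congˡ (E-diagonal i) ⟨
          v j * (E i ᵥ* M) 2+i              ≈⟨ +-identityʳ _ ⟨
          v j * (E i ᵥ* M) 2+i + 0#         ≈⟨ +-congˡ (trans (*-congˡ (E-off-diagonal j i i≢j)) (zeroʳ _)) ⟨
          v j * (E i ᵥ* M) 2+i + _          ≈⟨ LM 2+i ⟨
          (L ᵥ* M) 2+i                      ≈⟨ ⟨0,⟩ (λ l → M l 2+i) L≈0 ⟩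
          0#                              ∎)
          where 2+i = suc (suc i)

        g≈0 : ∀ t → (L ᵥ* M) (moveTwo i j t) ≈ 0#
        g≈0 = moveTwo-elim {P = λ c → (L ᵥ* M) c ≈ 0#} i j
          (trans (LM zero) (x*y-y*x≈0 (v j) (v i) (trans (*-comm _ _) (trans uᵢvⱼ≈uⱼvᵢ (*-comm _ _)))))
          (trans (LM (suc zero)) (x*y-y*x≈0 (v j) (v i) (*-comm _ _)))
          (λ t t≢i t≢j → trans (LM (suc (suc t))) (trans
            (+-cong (trans (*-congˡ (E-off-diagonal i t t≢i)) (zeroʳ _)) (trans (*-congˡ (E-off-diagonal j t t≢j)) (zeroʳ _)))
            (+-identityʳ 0#)))

        combination : HasCombinationWithZeros M q
        combination = combinationWithZeros {M = M} L L≉0 (moveTwo-injective i j) g≈0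

      no-MDS : ⊥
      no-MDS = let i , j , i≢j , eq = equal-ratios u v (first≉0 zero) (first≉0 (suc zero)) in ¬comb (combination i≢j eq)

-- Lifting an MDS matrix in general position to a counterexample to (5).

module FifthToSecond {c ℓ q} (F : FiniteField c ℓ q) where
  open FiniteField F hiding (zero)
  open Codes F
  open FieldProperties F
  open MatrixProperties F
  open Determinants F
  open PolynomialRoots F
  open Equivalences F
  open GroupProperties +-group using (x∙y⁻¹≈ε⇒x≈y)
  open SetoidReasoning setoid

  unit-sym : ∀ {m n} (i : Fin m) (j : Fin n) → unit (toℕ i) j ≈ unit (toℕ j) i
  unit-sym i j with toℕ j ℕ.≟ toℕ i
  ... | yes j≡i = trans (diagonal j i j≡i) (sym (diagonal i j (≡.sym j≡i)))
    where
    diagonal : ∀ {m n} (i : Fin m) (j : Fin n) → toℕ i ≡ toℕ j → unit (toℕ j) i ≈ 1#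
    diagonal i j i≡j = ≡.subst (λ l → unit l i ≈ 1#) i≡j (unit-diagonal i)
  ... | no j≢i  = trans (unit-off-diagonal j j≢i) (sym (unit-off-diagonal i (≡.≢-sym j≢i)))

  -- Without such an element, comparison with `0#` would inject the field into `Fin 2`.
  third-element : 2 ℕ.< q → ∃ λ x → ¬ (x ≈ 0#) × ¬ (x ≈ 1#)
  third-element 2<q = element (proj₁ search) , proj₂ search
    where
    binary : ∀ {x : Carrier} → Dec (x ≈ 0#) → Fin 2
    binary (yes _) = zero
    binary (no _)  = suc zero

    search : ∃ λ a → ¬ (element a ≈ 0#) × ¬ (element a ≈ 1#)
    search with Fin.any? (λ a → ¬? (element a ≟ 0#) ×-dec ¬? (element a ≟ 1#))
    ... | yes found = found
    ... | no ¬found = contradiction 2<q (ℕ.≤⇒≯ (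
      Fin.injective⇒≤ {f = λ a → binary (element a ≟ 0#)} λ {a} {b} eq → element-injective (same a b eq)))
      where
      one : ∀ {a} → ¬ (element a ≈ 0#) → element a ≈ 1#
      one {a} a≉0 with element a ≟ 1#
      ... | yes a≈1 = a≈1
      ... | no a≉1  = contradiction (a , a≉0 , a≉1) ¬found

      same : ∀ a b → binary (element a ≟ 0#) ≡ binary (element b ≟ 0#) → element a ≈ element b
      same a b eq with element a ≟ 0# | element b ≟ 0#
      ... | yes a≈0 | yes b≈0 = trans a≈0 (sym b≈0)
      ... | no a≉0  | no b≉0  = trans (one a≉0) (sym (one b≉0))

  -- The constant vector 1 serves unless the entries of κ sum to zero. In that case, replacing the 1
  -- at j by some x other than 0 and 1 changes the sum by (x - 1) κ_j, which is nonzero.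
  nonzero-scaling : 2 ℕ.< q → ∀ {n} (κ : Vector Carrier n) {j} → ¬ (κ j ≈ 0#) →
    ∃ λ ε → (∀ i → ¬ (ε i ≈ 0#)) × ¬ (⟨ κ , ε ⟩ ≈ 0#)
  nonzero-scaling 2<q {n} κ {j} κⱼ≉0 = by-cases (⟨ κ , (λ _ → 1#) ⟩ ≟ 0#)
    where
    x : Carrier
    x = proj₁ (third-element 2<q)

    ε : Vector Carrier n
    ε i = 1# + (x - 1#) * unit (toℕ j) i

    ε≉0 : ∀ i → Dec (toℕ i ≡ toℕ j) → ¬ (ε i ≈ 0#)
    ε≉0 i (yes i≡j) εᵢ≈0 = proj₁ (proj₂ (third-element 2<q)) (begin
      x                                   ≈⟨ +-identityʳ x ⟨
      x + 0#                              ≈⟨ +-congˡ (-‿inverseˡ 1#) ⟨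
      x + (- 1# + 1#)                     ≈⟨ +-assoc x (- 1#) 1# ⟨
      x - 1# + 1#                         ≈⟨ +-comm _ 1# ⟩
      1# + (x - 1#)                       ≈⟨ +-congˡ (*-identityʳ _) ⟨
      1# + (x - 1#) * 1#                  ≈⟨ +-congˡ (*-congˡ (≡.subst (λ l → unit l i ≈ 1#) i≡j (unit-diagonal i))) ⟨
      ε i                                 ≈⟨ εᵢ≈0 ⟩
      0#                                  ∎)
    ε≉0 i (no i≢j) εᵢ≈0 = 0≉1 (begin
      0#                                  ≈⟨ εᵢ≈0 ⟨
      ε i                                 ≈⟨ +-congˡ (trans (*-congˡ (unit-off-diagonal i i≢j)) (zeroʳ _)) ⟩
      1# + 0#                             ≈⟨ +-identityʳ 1# ⟩
      1#                                  ∎)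

    by-cases : Dec (⟨ κ , (λ _ → 1#) ⟩ ≈ 0#) → ∃ λ ε → (∀ i → ¬ (ε i ≈ 0#)) × ¬ (⟨ κ , ε ⟩ ≈ 0#)
    by-cases (no κ1≉0)  = (λ _ → 1#) , (λ _ 1≈0 → 0≉1 (sym 1≈0)) , κ1≉0
    by-cases (yes κ1≈0) = ε , (λ i → ε≉0 i (toℕ i ℕ.≟ toℕ j)) , λ κε≈0 →
      *-nonzero (proj₂ (proj₂ (third-element 2<q)) ∘ x∙y⁻¹≈ε⇒x≈y x 1#) κⱼ≉0 (begin
        (x - 1#) * κ j
          ≈⟨ *-congˡ (⟨,unit⟩ κ j) ⟨
        (x - 1#) * ⟨ κ , unit (toℕ j) ⟩
          ≈⟨ ⟨⟩-*ʳ (x - 1#) κ (unit (toℕ j)) ⟨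
        ⟨ κ , (λ i → (x - 1#) * unit (toℕ j) i) ⟩
          ≈⟨ x+y≈0⇒y≈0 κ1≈0 (trans (sym (⟨⟩-+ʳ κ (λ _ → 1#) (λ i → (x - 1#) * unit (toℕ j) i))) κε≈0) ⟩
        0# ∎)

  -- The leading coefficient of a polynomial is Σ μ a times its value at a.
  leading : ∃ λ μ → ∀ i → ⟨ reedSolomon q i , μ ⟩ ≈ unit (q ℕ.∸ 1) i
  leading = column-solve reedSolomon-independent ≡.refl (unit (q ℕ.∸ 1))

  μ : Vector Carrier q
  μ = proj₁ leading

  μ≉0 : Nontrivial μ
  μ≉0 μ≈0 = 0≉1 (begin
    0#                                    ≈⟨ ⟨,0⟩ (reedSolomon q last) μ≈0 ⟨
    ⟨ reedSolomon q last , μ ⟩            ≈⟨ proj₂ leading last ⟩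
    unit (q ℕ.∸ 1) last                   ≡⟨ ≡.cong (λ l → unit l last) (Fin.toℕ-fromℕ< q-1<q) ⟨
    unit (toℕ last) last                  ≈⟨ unit-diagonal last ⟩
    1#                                    ∎)
    where
    q-1<q : q ℕ.∸ 1 ℕ.< q
    q-1<q = ℕ.∸-monoʳ-< (s≤s z≤n) (ℕ.<⇒≤ 1<q)

    last : Fin q
    last = fromℕ< q-1<q

  tail-columns : ∀ {k} → Matrix k (2 ℕ.+ q) → Matrix k q
  tail-columns M i j = M i (suc (suc j))

  -- Independence of the functionals given by the first two columns and by the leading coefficient.
  InGeneralPosition : ∀ {k} → Matrix k (2 ℕ.+ q) → Set _
  InGeneralPosition {k} M = ∀ x y z →
    (∀ i → x * M i zero + (y * M i (suc zero) + z * ⟨ tail-columns M i , μ ⟩) ≈ 0#) →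
    x ≈ 0# × y ≈ 0# × z ≈ 0#

  module Lift {k} (k<q : k ℕ.< q) (M : Matrix k (2 ℕ.+ q))
    (¬comb : ¬ HasCombinationWithZeros M k) (general : InGeneralPosition M) where
    private
      d : ℕ
      d = q ℕ.∸ k

      d+k≡q : d ℕ.+ k ≡ q
      d+k≡q = ℕ.m∸n+n≡m (ℕ.<⇒≤ k<q)

    open Positions q d

    interpolation : ∀ i → ∃ λ p → ∀ j → (p ᵥ* reedSolomon q) j ≈ tail-columns M i j
    interpolation i = row-solve reedSolomon-independent ℕ.≤-refl (tail-columns M i)

    P : Matrix k q
    P i = proj₁ (interpolation i)

    -- A relation between the polynomials is a combination that vanishes in all of the last q
    -- columns, and q ≥ k.
    P-independent : Independent P
    P-independent = independent λ (L , L≉0 , LP≈0) → ¬comb (combinationWithZeros {M = M} L L≉0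
      {λ t → suc (suc (inject≤ t (ℕ.<⇒≤ k<q)))}
      (λ eq → Fin.inject≤-injective _ _ _ _ (Fin.suc-injective (Fin.suc-injective eq)))
      λ t → let j = inject≤ t (ℕ.<⇒≤ k<q) in begin
        (L ᵥ* M) (suc (suc j))
          ≈⟨ ⟨⟩-congˡ L (λ i → proj₂ (interpolation i) j) ⟨
        ⟨ L , (λ i → ⟨ P i , (λ l → reedSolomon q l j) ⟩) ⟩
          ≈⟨ ᵥ*-⟨⟩ L P (λ l → reedSolomon q l j) ⟨
        ⟨ L ᵥ* P , (λ l → reedSolomon q l j) ⟩
          ≈⟨ ⟨0,⟩ (λ l → reedSolomon q l j) LP≈0 ⟩
        0# ∎)

    extension : ∃ λ (X : Matrix (d ℕ.+ k) q) → Independent X × ∀ i j → X (d ↑ʳ i) j ≈ P i j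
    extension = extend-independent d P-independent (ℕ.≤-reflexive d+k≡q)

    X : Matrix (d ℕ.+ k) q
    X = proj₁ extension

    δ : Fin d → Vector Carrier d
    δ i = unit (toℕ i)

    none : ∀ n → Vector Carrier n
    none _ _ = 0#

    -- Each b_j is prescribed by its pairings with the basis `X`, whose last k rows `P` span W. The
    -- first d vanish on `P` and are dual to the other rows, so they form a basis of the annihilator
    -- of W.
    kernel-target : Vector (Vector Carrier (d ℕ.+ k)) d
    kernel-target i = δ i ++ none k

    -- The first two columns of `M` prescribe the functionals on W only; on the complementary rows
    -- of `X` they are set to zero.
    extra-target : Vector (Vector Carrier (d ℕ.+ k)) 2
    extra-target t = none d ++ λ i → M i (t ↑ˡ q)

    target : Vector (Vector Carrier (d ℕ.+ k)) (d ℕ.+ 2)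
    target = kernel-target ++ extra-target

    b-solution : ∀ j → ∃ λ x → ∀ r → ⟨ X r , x ⟩ ≈ target j r
    b-solution j = column-solve (proj₁ (proj₂ extension)) d+k≡q (target j)

    b : Vector (Vector Carrier q) (d ℕ.+ 2)
    b j = proj₁ (b-solution j)

    X-b-kernel : ∀ r i → ⟨ X r , b (i ↑ˡ 2) ⟩ ≈ kernel-target i r
    X-b-kernel r i = trans (proj₂ (b-solution (i ↑ˡ 2)) r)
      (reflexive (≡.cong (λ w → w r) (lookup-++ˡ kernel-target extra-target i)))

    X-b-extra : ∀ r t → ⟨ X r , b (d ↑ʳ t) ⟩ ≈ extra-target t r
    X-b-extra r t = trans (proj₂ (b-solution (d ↑ʳ t)) r)
      (reflexive (≡.cong (λ w → w r) (lookup-++ʳ kernel-target extra-target t)))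

    R∪B : Matrix q (q ℕ.+ (d ℕ.+ 2))
    R∪B = transpose (transpose (reedSolomon q) ++ b)

    R∪B-R : ∀ v j → ⟨ v , (λ l → R∪B l (j ↑ˡ (d ℕ.+ 2))) ⟩ ≈ ⟨ v , (λ l → reedSolomon q l j) ⟩
    R∪B-R v j = ⟨⟩-congˡ v λ l → reflexive (≡.cong (λ w → w l) (lookup-++ˡ (transpose (reedSolomon q)) b j))

    R∪B-b : ∀ v j → ⟨ v , (λ l → R∪B l (q ↑ʳ j)) ⟩ ≈ ⟨ v , b j ⟩
    R∪B-b v j = ⟨⟩-congˡ v λ l → reflexive (≡.cong (λ w → w l) (lookup-++ʳ (transpose (reedSolomon q)) b j))

    -- On W, the columns of R ∪ B outside b₁, ..., b_d act as the columns of `M`: the last two b's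
    -- by choice, those of R because they evaluate polynomials.
    P-R∪B : ∀ i j → ⟨ X (d ↑ʳ i) , (λ l → R∪B l (encode (inj₂ j))) ⟩ ≈ M i j
    P-R∪B i zero          = trans (R∪B-b (X (d ↑ʳ i)) (d ↑ʳ zero)) (trans (X-b-extra (d ↑ʳ i) zero)
      (reflexive (lookup-++ʳ (none d) (λ i → M i zero) i)))
    P-R∪B i (suc zero)    = trans (R∪B-b (X (d ↑ʳ i)) (d ↑ʳ suc zero)) (trans (X-b-extra (d ↑ʳ i) (suc zero))
      (reflexive (lookup-++ʳ (none d) (λ i → M i (suc zero)) i)))
    P-R∪B i (suc (suc j)) = trans (R∪B-R (X (d ↑ʳ i)) j) (trans
      (⟨⟩-congʳ (λ l → reedSolomon q l j) (proj₂ (proj₂ extension) i)) (proj₂ (interpolation i) j))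

    module _ (L : Vector Carrier q) (L≉0 : Nontrivial L) (Lb≈0 : ∀ i → (L ᵥ* R∪B) (encode (inj₁ i)) ≈ 0#) where
      private
        coordinates : ∃ λ ξ → ∀ j → (ξ ᵥ* X) j ≈ L j
        coordinates = row-solve (proj₁ (proj₂ extension)) (ℕ.≤-reflexive (≡.sym d+k≡q)) L

        ξ : Vector Carrier (d ℕ.+ k)
        ξ = proj₁ coordinates

        L-dot : ∀ v → ⟨ L , v ⟩ ≈ ⟨ ξ , (λ r → ⟨ X r , v ⟩) ⟩
        L-dot v = trans (⟨⟩-congʳ v (λ j → sym (proj₂ coordinates j))) (ᵥ*-⟨⟩ ξ X v)

        -- Pairing with b_i reads off the i-th coordinate of `L` in the basis `X`. As `L` kills
        -- these b_i, only coordinates along `P` remain, so `L` lies in W.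
        ξ≈0 : ∀ i → ξ (i ↑ˡ k) ≈ 0#
        ξ≈0 i = begin
          ξ (i ↑ˡ k)
            ≈⟨ ⟨,unit⟩ (ξ ∘ (_↑ˡ k)) i ⟨
          ⟨ ξ ∘ (_↑ˡ k) , δ i ⟩
            ≈⟨ +-identityʳ _ ⟨
          ⟨ ξ ∘ (_↑ˡ k) , δ i ⟩ + 0#
            ≈⟨ +-cong (⟨⟩-congˡ (ξ ∘ (_↑ˡ k)) (λ r → reflexive (lookup-++ˡ (δ i) (none k) r)))
                      (⟨,0⟩ (ξ ∘ (d ↑ʳ_)) (λ r → reflexive (lookup-++ʳ (δ i) (none k) r))) ⟨
          ⟨ ξ ∘ (_↑ˡ k) , kernel-target i ∘ (_↑ˡ k) ⟩ + ⟨ ξ ∘ (d ↑ʳ_) , kernel-target i ∘ (d ↑ʳ_) ⟩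
            ≈⟨ ⟨⟩-split d ξ (kernel-target i) ⟨
          ⟨ ξ , kernel-target i ⟩
            ≈⟨ ⟨⟩-congˡ ξ (λ r → X-b-kernel r i) ⟨
          ⟨ ξ , (λ r → ⟨ X r , b (i ↑ˡ 2) ⟩) ⟩
            ≈⟨ L-dot (b (i ↑ˡ 2)) ⟨
          ⟨ L , b (i ↑ˡ 2) ⟩
            ≈⟨ R∪B-b L (i ↑ˡ 2) ⟨
          (L ᵥ* R∪B) (encode (inj₁ i))
            ≈⟨ Lb≈0 i ⟩
          0# ∎

      message : Vector Carrier k
      message i = ξ (d ↑ʳ i)

      message≉0 : Nontrivial message
      message≉0 message≈0 = L≉0 λ j → trans (sym (proj₂ coordinates j))
        (⟨0,⟩ (λ i → X i j) (∀-split d ξ≈0 message≈0))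

      message-codeword : ∀ j → (message ᵥ* M) j ≈ (L ᵥ* R∪B) (encode (inj₂ j))
      message-codeword j = begin
        (message ᵥ* M) j
          ≈⟨ ⟨⟩-congˡ message (λ i → P-R∪B i j) ⟨
        ⟨ message , (λ i → ⟨ X (d ↑ʳ i) , column ⟩) ⟩
          ≈⟨ +-identityˡ _ ⟨
        0# + ⟨ message , (λ i → ⟨ X (d ↑ʳ i) , column ⟩) ⟩
          ≈⟨ +-congʳ (⟨0,⟩ (λ i → ⟨ X (i ↑ˡ k) , column ⟩) ξ≈0) ⟨
        ⟨ ξ ∘ (_↑ˡ k) , (λ i → ⟨ X (i ↑ˡ k) , column ⟩) ⟩ + ⟨ message , (λ i → ⟨ X (d ↑ʳ i) , column ⟩) ⟩
          ≈⟨ ⟨⟩-split d ξ (λ r → ⟨ X r , column ⟩) ⟨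
        ⟨ ξ , (λ r → ⟨ X r , column ⟩) ⟩
          ≈⟨ L-dot column ⟨
        (L ᵥ* R∪B) (encode (inj₂ j)) ∎
        where
        column : Vector Carrier q
        column l = R∪B l (encode (inj₂ j))

    -- A vanishing minor yields `L` ≠ 0 that kills q columns of R ∪ B, b₁, ..., b_d among them. At
    -- most d of the q are such b's; the others are zeros of a combination of the rows of `M`, which
    -- therefore has at least q - d = k zeros.
    minors≉0 : (f : Fin q → Fin (q ℕ.+ (d ℕ.+ 2))) → StrictlyIncreasing f →
      (∀ i → ∃ λ j → f j ≡ q ↑ʳ (i ↑ˡ 2)) → ¬ (det (columns R∪B f) ≈ 0#)
    minors≉0 f f-inc f-b det≈0 = ¬comb (w , message≉0 L L≉0 Lb≈0 , k≤z)
      where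
      singular : Singular (columns R∪B f)
      singular = det≈0⇒singular (columns R∪B f) det≈0

      L : Vector Carrier q
      L = proj₁ singular

      L≉0 : Nontrivial L
      L≉0 = proj₁ (proj₂ singular)

      Lf≈0 : ∀ j → (L ᵥ* R∪B) (f j) ≈ 0#
      Lf≈0 = proj₂ (proj₂ singular)

      Lb≈0 : ∀ i → (L ᵥ* R∪B) (encode (inj₁ i)) ≈ 0#
      Lb≈0 i = let j , fⱼ≡ = f-b i in ≡.subst (λ x → (L ᵥ* R∪B) x ≈ 0#) fⱼ≡ (Lf≈0 j)

      w : Vector Carrier k
      w = message L L≉0 Lb≈0

      z : ℕ
      z = zeros (w ᵥ* M)

      open Enumeration (zero-positions (w ᵥ* M)) using (position; complete)

      place : Fin (d ℕ.+ z) → Fin (q ℕ.+ (d ℕ.+ 2))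
      place = encode ∘ Sum.map₂ position ∘ splitAt d

      place-encode : ∀ y → (L ᵥ* R∪B) (encode y) ≈ 0# → ∃ λ t → place t ≡ encode y
      place-encode (inj₁ i) _    = i ↑ˡ z , ≡.cong (encode ∘ Sum.map₂ position) (Fin.splitAt-↑ˡ d i z)
      place-encode (inj₂ j) Lj≈0 =
        let i , pᵢ≡j = complete j (trans (message-codeword L L≉0 Lb≈0 j) Lj≈0)
        in d ↑ʳ i , ≡.trans (≡.cong (encode ∘ Sum.map₂ position) (Fin.splitAt-↑ʳ d z i)) (≡.cong (encode ∘ inj₂) pᵢ≡j)

      place-surjective : ∀ x → (L ᵥ* R∪B) x ≈ 0# → ∃ λ t → place t ≡ x
      place-surjective x Lx≈0 =
        let t , eq = place-encode (decode x) (≡.subst (λ y → (L ᵥ* R∪B) y ≈ 0#) (≡.sym (encode-decode x)) Lx≈0)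
        in t , ≡.trans eq (encode-decode x)

      preimage : Fin q → Fin (d ℕ.+ z)
      preimage j = proj₁ (place-surjective (f j) (Lf≈0 j))

      preimage-injective : Injective _≡_ _≡_ preimage
      preimage-injective {i} {j} eq = increasing⇒injective f-inc
        (≡.trans (≡.sym (proj₂ (place-surjective (f i) (Lf≈0 i))))
          (≡.trans (≡.cong place eq) (proj₂ (place-surjective (f j) (Lf≈0 j)))))

      k≤z : k ℕ.≤ z
      k≤z = ℕ.+-cancelˡ-≤ d k z (≡.subst (ℕ._≤ d ℕ.+ z) (≡.sym d+k≡q) (Fin.injective⇒≤ preimage-injective))

    e : Vector (Vector Carrier q) 1
    e = unit (q ℕ.∸ 1) Vector.∷ Vector.[]

    -- The last unit vector acts on W as the leading coefficient, which `μ` computes from values.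
    P-e : ∀ i → ⟨ X (d ↑ʳ i) , unit (q ℕ.∸ 1) ⟩ ≈ ⟨ tail-columns M i , μ ⟩
    P-e i = begin
      ⟨ X (d ↑ʳ i) , unit (q ℕ.∸ 1) ⟩                      ≈⟨ ⟨⟩-cong (proj₂ (proj₂ extension) i) (λ l → sym (proj₂ leading l)) ⟩
      ⟨ P i , (λ l → ⟨ reedSolomon q l , μ ⟩) ⟩            ≈⟨ ᵥ*-⟨⟩ (P i) (reedSolomon q) μ ⟨
      ⟨ P i ᵥ* reedSolomon q , μ ⟩                         ≈⟨ ⟨⟩-congʳ μ (proj₂ (interpolation i)) ⟩
      ⟨ tail-columns M i , μ ⟩                             ∎

    -- A relation is paired with the rows of `X`. On `P` the first d vectors drop out, and general
    -- position makes the last three coefficients zero; the complementary rows then read off the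
    -- first d coefficients.
    b∪e-independent : LinearAlgebra.LinearlyIndependent (columnSpace q) (b ++ e)
    b∪e-independent = independent⇒linearlyIndependent (is-independent λ a a≈0 → vanishing a a≈0)
      where
      module _ (a : Vector Carrier (d ℕ.+ 2 ℕ.+ 1)) (a≈0 : Annihilates a (b ++ e)) where
        α : Vector Carrier d
        α i = a ((i ↑ˡ 2) ↑ˡ 1)

        x y z : Carrier
        x = a ((d ↑ʳ zero) ↑ˡ 1)
        y = a ((d ↑ʳ suc zero) ↑ˡ 1)
        z = a ((d ℕ.+ 2) ↑ʳ zero)

        -- The summands `0#` end the unfolded sums over `Fin 2` and `Fin 1`.
        relation : ∀ r → (⟨ α , (λ i → kernel-target i r) ⟩ + (x * extra-target zero r + (y * extra-target (suc zero) r + 0#)))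
          + (z * ⟨ X r , unit (q ℕ.∸ 1) ⟩ + 0#) ≈ 0#
        relation r = begin
          (⟨ α , (λ i → kernel-target i r) ⟩ + (x * extra-target zero r + (y * extra-target (suc zero) r + 0#)))
            + (z * ⟨ X r , unit (q ℕ.∸ 1) ⟩ + 0#)
            ≈⟨ +-cong (+-cong (⟨⟩-congˡ α (λ i → X-b-kernel r i))
                              (+-cong (*-congˡ (X-b-extra r zero)) (+-congʳ (*-congˡ (X-b-extra r (suc zero))))))
                      (+-congʳ refl) ⟨
          (⟨ α , (λ i → ⟨ X r , b (i ↑ˡ 2) ⟩) ⟩ + ⟨ (λ t → a ((d ↑ʳ t) ↑ˡ 1)) , (λ t → ⟨ X r , b (d ↑ʳ t) ⟩) ⟩)
            + ⟨ (λ t → a ((d ℕ.+ 2) ↑ʳ t)) , (λ t → ⟨ X r , e t ⟩) ⟩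
            ≈⟨ +-congʳ (⟨⟩-split d (a ∘ (_↑ˡ 1)) (λ j → ⟨ X r , b j ⟩)) ⟨
          ⟨ a ∘ (_↑ˡ 1) , (λ j → ⟨ X r , b j ⟩) ⟩ + ⟨ (λ t → a ((d ℕ.+ 2) ↑ʳ t)) , (λ t → ⟨ X r , e t ⟩) ⟩
            ≈⟨ +-cong (⟨⟩-congˡ (a ∘ (_↑ˡ 1)) (λ j → dot (lookup-++ˡ b e j)))
                      (⟨⟩-congˡ (λ t → a ((d ℕ.+ 2) ↑ʳ t)) (λ t → dot (lookup-++ʳ b e t))) ⟨
          ⟨ a ∘ (_↑ˡ 1) , (λ j → ⟨ (b ++ e) (j ↑ˡ 1) , X r ⟩) ⟩
            + ⟨ (λ t → a ((d ℕ.+ 2) ↑ʳ t)) , (λ t → ⟨ (b ++ e) ((d ℕ.+ 2) ↑ʳ t) , X r ⟩) ⟩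
            ≈⟨ ⟨⟩-split (d ℕ.+ 2) a (λ j → ⟨ (b ++ e) j , X r ⟩) ⟨
          ⟨ a , (λ j → ⟨ (b ++ e) j , X r ⟩) ⟩
            ≈⟨ ᵥ*-⟨⟩ a (b ++ e) (X r) ⟨
          ⟨ a ᵥ* (b ++ e) , X r ⟩
            ≈⟨ ⟨0,⟩ (X r) a≈0 ⟩
          0# ∎
          where
          dot : ∀ {u v : Vector Carrier q} → u ≡ v → ⟨ u , X r ⟩ ≈ ⟨ X r , v ⟩
          dot {u} ≡.refl = ⟨⟩-comm u (X r)

        xyz≈0 : x ≈ 0# × y ≈ 0# × z ≈ 0#
        xyz≈0 = general x y z λ i → begin
          x * M i zero + (y * M i (suc zero) + z * ⟨ tail-columns M i , μ ⟩)
            ≈⟨ +-assoc _ _ _ ⟨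
          x * M i zero + y * M i (suc zero) + z * ⟨ tail-columns M i , μ ⟩
            ≈⟨ +-congʳ (+-identityˡ _) ⟨
          0# + (x * M i zero + y * M i (suc zero)) + z * ⟨ tail-columns M i , μ ⟩
            ≈⟨ +-cong (+-cong (⟨,0⟩ α (λ j → reflexive (lookup-++ʳ (δ j) (none k) i)))
                 (+-cong (*-congˡ (reflexive (lookup-++ʳ (none d) (λ i → M i zero) i)))
                   (trans (+-identityʳ _) (*-congˡ (reflexive (lookup-++ʳ (none d) (λ i → M i (suc zero)) i))))))
                 (trans (+-identityʳ _) (*-congˡ (P-e i))) ⟨
          _ ≈⟨ relation (d ↑ʳ i) ⟩
          0# ∎

        α≈0 : ∀ i → α i ≈ 0#
        α≈0 i = begin
          α i
            ≈⟨ ⟨,unit⟩ α i ⟨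
          ⟨ α , unit (toℕ i) ⟩
            ≈⟨ ⟨⟩-congˡ α (λ j → trans (reflexive (lookup-++ˡ (δ j) (none k) i)) (unit-sym j i)) ⟨
          ⟨ α , (λ j → kernel-target j (i ↑ˡ k)) ⟩
            ≈⟨ x+y≈0⇒x≈0 (trans (+-cong (kill (proj₁ xyz≈0)) (trans (+-identityʳ _) (kill (proj₁ (proj₂ xyz≈0))))) (+-identityʳ 0#))
                 (x+y≈0⇒x≈0 (trans (+-identityʳ _) (kill (proj₂ (proj₂ xyz≈0)))) (relation (i ↑ˡ k))) ⟩
          0# ∎
          where
          kill : ∀ {x y} → x ≈ 0# → x * y ≈ 0#
          kill x≈0 = trans (*-congʳ x≈0) (zeroˡ _)

        vanishing : ∀ i → a i ≈ 0#
        vanishing = ∀-split (d ℕ.+ 2)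
          (∀-split d α≈0 (λ { zero → proj₁ xyz≈0 ; (suc zero) → proj₁ (proj₂ xyz≈0) }))
          (λ { zero → proj₂ (proj₂ xyz≈0) })

    ¬statement₅ : ¬ Statement₅ k
    ¬statement₅ stmt₅ = stmt₅ (q , k<q , ℕ.≤-refl , b , minors≉0 , b∪e-independent)

-- General position by scaling columns, and the conclusion of (2) from (5).

transpose-injective : ∀ {n} (i j : Fin n) → Injective _≡_ _≡_ (Permutation.transpose i j)
transpose-injective i j {x} {y} eq = ≡.trans (≡.sym (Permutation.transpose-inverse j i))
  (≡.trans (≡.cong (Permutation.transpose j i) eq) (Permutation.transpose-inverse j i))

transpose-first : ∀ {n} (i j : Fin n) → Permutation.transpose i j i ≡ j
transpose-first i j rewrite dec-true (i Fin.≟ i) ≡.refl = ≡.refl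

module Scaling {c ℓ q} (F : FiniteField c ℓ q) where
  open FiniteField F hiding (zero)
  open Codes F
  open FieldProperties F
  open MatrixProperties F
  open Equivalences F
  open ExtremeDimensions F
  open FifthToSecond F
  open SetoidReasoning setoid

  module _ {k} (3+k<q : 3 ℕ.+ k ℕ.< q) (M : Matrix (3 ℕ.+ k) (2 ℕ.+ q))
    (¬comb : ¬ HasCombinationWithZeros M (3 ℕ.+ k)) where
    private
      k<q : suc k ℕ.≤ q
      k<q = ℕ.≤-trans (ℕ.m≤n+m (suc k) 3) 3+k<q

      2<q : 2 ℕ.< q
      2<q = ℕ.≤-trans (s≤s (s≤s (s≤s z≤n))) (ℕ.<⇒≤ 3+k<q)

      j₀ : Fin q
      j₀ = proj₁ (nonzero-entry μ≉0)

      -- Three of these k + 3 columns matter: the first two and the one of j₀.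
      g : Fin (3 ℕ.+ k) → Fin (2 ℕ.+ q)
      g zero          = zero
      g (suc zero)    = suc zero
      g (suc (suc t)) = suc (suc (Permutation.transpose (inject≤ zero k<q) j₀ (inject≤ t k<q)))

      g-injective : Injective _≡_ _≡_ g
      g-injective {zero}        {zero}        _  = ≡.refl
      g-injective {zero}        {suc zero}    ()
      g-injective {zero}        {suc (suc _)} ()
      g-injective {suc zero}    {zero}        ()
      g-injective {suc zero}    {suc zero}    _  = ≡.refl
      g-injective {suc zero}    {suc (suc _)} ()
      g-injective {suc (suc _)} {zero}        ()
      g-injective {suc (suc _)} {suc zero}    ()
      g-injective {suc (suc s)} {suc (suc t)} eq = ≡.cong (λ l → suc (suc l)) (Fin.inject≤-injective k<q k<q s t
        (transpose-injective (inject≤ zero k<q) j₀ (Fin.suc-injective (Fin.suc-injective eq))))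

      -- For n = 0, 1, 2 these combinations are dual to the first two columns and that of `j₀`,
      -- which the transposition in `g` puts third.
      dual : ∀ n → ∃ λ E → ∀ j → (E ᵥ* columns M g) j ≈ unit n j
      dual n = row-solve (columns-independent M ¬comb g-injective) ℕ.≤-refl (unit n)

      E : ℕ → Vector Carrier (3 ℕ.+ k)
      E n = proj₁ (dual n)

      -- Chosen so that ⟨κ, ε⟩ is the leading coefficient of the combination `E 2` once the last q
      -- columns are scaled by ε. At `j₀` the combination has entry 1 and `μ` is nonzero.
      κ : Vector Carrier q
      κ j = (E 2 ᵥ* M) (suc (suc j)) * μ j

      κ≉0 : ¬ (κ j₀ ≈ 0#)
      κ≉0 = *-nonzero (λ Eⱼ≈0 → 0≉1 (trans (sym Eⱼ≈0)
        (≡.subst (λ j → (E 2 ᵥ* M) (suc (suc j)) ≈ 1#) (transpose-first (inject≤ zero k<q) j₀) (proj₂ (dual 2) (suc (suc zero))))))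
        (proj₂ (nonzero-entry μ≉0))

      scaling : ∃ λ ε → (∀ i → ¬ (ε i ≈ 0#)) × ¬ (⟨ κ , ε ⟩ ≈ 0#)
      scaling = nonzero-scaling 2<q κ κ≉0

      ε : Vector Carrier q
      ε = proj₁ scaling

      scale : Vector Carrier (2 ℕ.+ q)
      scale zero          = 1#
      scale (suc zero)    = 1#
      scale (suc (suc j)) = ε j

      scale≉0 : ∀ j → ¬ (scale j ≈ 0#)
      scale≉0 zero          1≈0 = 0≉1 (sym 1≈0)
      scale≉0 (suc zero)    1≈0 = 0≉1 (sym 1≈0)
      scale≉0 (suc (suc j))     = proj₁ (proj₂ scaling) j

    scaled : Matrix (3 ℕ.+ k) (2 ℕ.+ q)
    scaled i j = scale j * M i j

    scaled-codeword : ∀ L j → (L ᵥ* scaled) j ≈ scale j * (L ᵥ* M) j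
    scaled-codeword L j = ⟨⟩-*ʳ (scale j) L (λ i → M i j)

    scaled-¬combination : ¬ HasCombinationWithZeros scaled (3 ℕ.+ k)
    scaled-¬combination (L , L≉0 , k≤zeros) = ¬comb (L , L≉0 , ℕ.≤-trans k≤zeros
      (zeros-mono {u = L ᵥ* scaled} λ j eq → *-cancel-0 (scale≉0 j) (trans (sym (scaled-codeword L j)) eq)))

    -- The relation is paired with `E 2`, which vanishes in the first two columns: z times ⟨κ, ε⟩ is
    -- zero, and the scaling was chosen to make ⟨κ, ε⟩ nonzero. Then `E 0` and `E 1` isolate x and
    -- y.
    scaled-general : InGeneralPosition scaled
    scaled-general x y z relation = x≈0 , y≈0 , z≈0
      where
      lead : Vector Carrier (3 ℕ.+ k)
      lead i = ⟨ tail-columns scaled i , μ ⟩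

      E₀ : ∀ n → (E n ᵥ* scaled) zero ≈ unit {3 ℕ.+ k} n zero
      E₀ n = trans (scaled-codeword (E n) zero) (trans (*-identityˡ _) (proj₂ (dual n) zero))

      E₁ : ∀ n → (E n ᵥ* scaled) (suc zero) ≈ unit {3 ℕ.+ k} n (suc zero)
      E₁ n = trans (scaled-codeword (E n) (suc zero)) (trans (*-identityˡ _) (proj₂ (dual n) (suc zero)))

      dotted : ∀ n → x * unit {3 ℕ.+ k} n zero + (y * unit {3 ℕ.+ k} n (suc zero) + z * ⟨ E n , lead ⟩) ≈ 0#
      dotted n = begin
        x * unit {3 ℕ.+ k} n zero + (y * unit {3 ℕ.+ k} n (suc zero) + z * ⟨ E n , lead ⟩)
          ≈⟨ +-cong (*-congˡ (E₀ n)) (+-congʳ (*-congˡ (E₁ n))) ⟨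
        x * (E n ᵥ* scaled) zero + (y * (E n ᵥ* scaled) (suc zero) + z * ⟨ E n , lead ⟩)
          ≈⟨ +-cong (⟨⟩-*ʳ x (E n) (λ i → scaled i zero))
                    (+-cong (⟨⟩-*ʳ y (E n) (λ i → scaled i (suc zero))) (⟨⟩-*ʳ z (E n) lead)) ⟨
        ⟨ E n , (λ i → x * scaled i zero) ⟩ + (⟨ E n , (λ i → y * scaled i (suc zero)) ⟩ + ⟨ E n , (λ i → z * lead i) ⟩)
          ≈⟨ +-congˡ (⟨⟩-+ʳ (E n) (λ i → y * scaled i (suc zero)) (λ i → z * lead i)) ⟨
        ⟨ E n , (λ i → x * scaled i zero) ⟩ + ⟨ E n , (λ i → y * scaled i (suc zero) + z * lead i) ⟩
          ≈⟨ ⟨⟩-+ʳ (E n) (λ i → x * scaled i zero) (λ i → y * scaled i (suc zero) + z * lead i) ⟨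
        ⟨ E n , (λ i → x * scaled i zero + (y * scaled i (suc zero) + z * lead i)) ⟩
          ≈⟨ ⟨,0⟩ (E n) relation ⟩
        0# ∎

      E₂-lead : ⟨ E 2 , lead ⟩ ≈ ⟨ κ , ε ⟩
      E₂-lead = trans (sym (ᵥ*-⟨⟩ (E 2) (tail-columns scaled) μ)) (sum-cong-≋ λ j → begin
        (E 2 ᵥ* scaled) (suc (suc j)) * μ j           ≈⟨ *-congʳ (scaled-codeword (E 2) (suc (suc j))) ⟩
        ε j * (E 2 ᵥ* M) (suc (suc j)) * μ j          ≈⟨ *-assoc _ _ _ ⟩
        ε j * κ j                                     ≈⟨ *-comm _ _ ⟩
        κ j * ε j                                     ∎)
        where open SemiringSum semiring using (sum-cong-≋)

      z≈0 : z ≈ 0#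
      z≈0 = *-cancel-0 (proj₂ (proj₂ scaling)) (begin
        ⟨ κ , ε ⟩ * z       ≈⟨ *-congʳ E₂-lead ⟨
        ⟨ E 2 , lead ⟩ * z  ≈⟨ *-comm _ _ ⟩
        z * ⟨ E 2 , lead ⟩  ≈⟨ x+y≈0⇒y≈0 (zeroʳ y) (x+y≈0⇒y≈0 (zeroʳ x) (dotted 2)) ⟩
        0#                  ∎)

      z-term≈0 : ∀ {w} → z * w ≈ 0#
      z-term≈0 = trans (*-congʳ z≈0) (zeroˡ _)

      x≈0 : x ≈ 0#
      x≈0 = trans (sym (*-identityʳ x))
        (x+y≈0⇒x≈0 (trans (+-cong (zeroʳ y) z-term≈0) (+-identityˡ 0#)) (dotted 0))

      y≈0 : y ≈ 0#
      y≈0 = trans (sym (*-identityʳ y)) (x+y≈0⇒x≈0 z-term≈0 (x+y≈0⇒y≈0 (zeroʳ x) (dotted 1)))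

  statement₅⇒statement₂ : ∀ {k} → 2 ℕ.≤ k → k ℕ.≤ q → Statement₅ k → Statement₂ k
  statement₅⇒statement₂ {suc (suc zero)} _ _ _ = dimension-2
  statement₅⇒statement₂ {suc (suc (suc k))} _ k≤q stmt₅ = by-cases (3 ℕ.+ k ℕ.≟ q)
    where
    by-cases : Dec (3 ℕ.+ k ≡ q) → Statement₂ (3 ℕ.+ k)
    by-cases (yes k≡q)  = ≡.subst Statement₂ (≡.sym k≡q) dimension-q
    by-cases (no k≢q) M = hasCombinationWithZeros-stable M λ ¬comb →
      Lift.¬statement₅ k<q (scaled k<q M ¬comb) (scaled-¬combination k<q M ¬comb) (scaled-general k<q M ¬comb) stmt₅
      where
      k<q : 3 ℕ.+ k ℕ.< q
      k<q = ℕ.≤∧≢⇒< k≤q k≢q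
  statement₅⇒statement₂ {suc zero} (s≤s ()) _ _

-- From (2) to (4): subspaces as kernels of functionals, and root counts.

count-tail : ∀ {a p} {A : Set a} {P : Pred A p} (P? : Decidable P) {n} (v : Vector A (suc n)) →
  Vec.count P? (Vec.tabulate v) ℕ.≤ suc (Vec.count P? (Vec.tabulate (v ∘ suc)))
count-tail P? v with P? (v zero)
... | yes _ = ℕ.≤-refl
... | no _  = ℕ.n≤1+n _

count-tail-¬ : ∀ {a p} {A : Set a} {P : Pred A p} (P? : Decidable P) {n} (v : Vector A (suc n)) →
  ¬ P (v zero) → Vec.count P? (Vec.tabulate v) ≡ Vec.count P? (Vec.tabulate (v ∘ suc))
count-tail-¬ P? v ¬Pv₀ with P? (v zero)
... | yes Pv₀ = contradiction Pv₀ ¬Pv₀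
... | no _    = ≡.refl

-- As integers, k - (d + 1) ≤ (d + r) - (d + 1) < (d + r) - d = r. This covers the negative index
-- that occurs for k = 2.
⊖-bound : ∀ {k} d {r} → k ℕ.≤ d ℕ.+ r → ¬ (+ r ℤ.≤ k ⊖ suc d)
⊖-bound {k} d {r} k≤d+r r≤k⊖1+d = ℤ.<-irrefl ≡.refl (ℤ.≤-<-trans r≤k⊖1+d
  (ℤ.≤-<-trans (ℤ.⊖-monoˡ-≤ (suc d) k≤d+r) (ℤ.<-≤-trans (ℤ.⊖-monoʳ->-< (d ℕ.+ r) (ℕ.n<1+n d))
    (ℤ.≤-reflexive (≡.trans (ℤ.⊖-≥ (ℕ.m≤m+n d r)) (≡.cong +_ (ℕ.m+n∸m≡n d r)))))))

module Subspaces {c ℓ q m ℓm} (F : FiniteField c ℓ q) (V : LeftModule (FiniteField.ring F) m ℓm) where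
  open FiniteField F using (Carrier; 0#; 1#; _≈_; _+_; _*_)
  open Codes F using (Matrix; _ᵥ*_)
  open MatrixProperties F
  open LeftModule V
  open LinearAlgebra V
  open CommutativeSemigroupProperties (CommutativeMonoid.commutativeSemigroup +ᴹ-commutativeMonoid) using (interchange)
  open SetoidReasoning ≈ᴹ-setoid

  combination-cong : ∀ {n} {a a′ : Vector Carrier n} {v v′ : Vector Carrierᴹ n} →
    (∀ i → a i ≈ a′ i) → (∀ i → v i ≈ᴹ v′ i) → combination a v ≈ᴹ combination a′ v′
  combination-cong {zero}  a≈a′ v≈v′ = ≈ᴹ-refl
  combination-cong {suc n} a≈a′ v≈v′ =
    +ᴹ-cong (*ₗ-cong (a≈a′ zero) (v≈v′ zero)) (combination-cong (a≈a′ ∘ suc) (v≈v′ ∘ suc))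

  combination-0 : ∀ {n} {a : Vector Carrier n} (v : Vector Carrierᴹ n) → (∀ i → a i ≈ 0#) → combination a v ≈ᴹ 0ᴹ
  combination-0 {zero}  v a≈0 = ≈ᴹ-refl
  combination-0 {suc n} v a≈0 = ≈ᴹ-trans
    (+ᴹ-cong (≈ᴹ-trans (*ₗ-cong (a≈0 zero) ≈ᴹ-refl) (*ₗ-zeroˡ _)) (combination-0 (v ∘ suc) (a≈0 ∘ suc))) (+ᴹ-identityˡ 0ᴹ)

  combination-* : ∀ {n} x (a : Vector Carrier n) (v : Vector Carrierᴹ n) →
    combination (λ i → x * a i) v ≈ᴹ x *ₗ combination a v
  combination-* {zero}  x a v = ≈ᴹ-sym (*ₗ-zeroʳ x)
  combination-* {suc n} x a v = ≈ᴹ-trans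
    (+ᴹ-cong (*ₗ-assoc x (a zero) (v zero)) (combination-* x (a ∘ suc) (v ∘ suc))) (≈ᴹ-sym (*ₗ-distribˡ x _ _))

  combination-+ : ∀ {n} (a a′ : Vector Carrier n) (v : Vector Carrierᴹ n) →
    combination (λ i → a i + a′ i) v ≈ᴹ combination a v +ᴹ combination a′ v
  combination-+ {zero}  a a′ v = ≈ᴹ-sym (+ᴹ-identityˡ 0ᴹ)
  combination-+ {suc n} a a′ v = ≈ᴹ-trans
    (+ᴹ-cong (*ₗ-distribʳ (v zero) (a zero) (a′ zero)) (combination-+ (a ∘ suc) (a′ ∘ suc) (v ∘ suc))) (interchange _ _ _ _)

  combination-ᵥ* : ∀ {n o} (L : Vector Carrier n) (A : Matrix n o) (v : Vector Carrierᴹ o) →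
    combination (L ᵥ* A) v ≈ᴹ combination L (λ i → combination (A i) v)
  combination-ᵥ* {zero}  L A v = combination-0 v (λ _ → FiniteField.refl F)
  combination-ᵥ* {suc n} L A v = begin
    combination (λ j → L zero * A zero j + ((L ∘ suc) ᵥ* (A ∘ suc)) j) v
      ≈⟨ combination-+ (λ j → L zero * A zero j) ((L ∘ suc) ᵥ* (A ∘ suc)) v ⟩
    combination (λ j → L zero * A zero j) v +ᴹ combination ((L ∘ suc) ᵥ* (A ∘ suc)) v
      ≈⟨ +ᴹ-cong (combination-* (L zero) (A zero) v) (combination-ᵥ* (L ∘ suc) (A ∘ suc) v) ⟩
    combination L (λ i → combination (A i) v) ∎

  combination-closed : ∀ {p n} {Y : Pred Carrierᴹ p} → IsSubspace Y → (a : Vector Carrier n) {v : Vector Carrierᴹ n} →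
    (∀ i → v i ∈ Y) → combination a v ∈ Y
  combination-closed {n = zero}  Y-sub a v∈Y = IsSubspace.0-closed Y-sub
  combination-closed {n = suc n} Y-sub a v∈Y = IsSubspace.+-closed Y-sub
    (IsSubspace.*ₗ-closed Y-sub (a zero) (v∈Y zero)) (combination-closed Y-sub (a ∘ suc) (v∈Y ∘ suc))

  ⊆-span : ∀ {p} {S : Pred Carrierᴹ p} → S ⊆ Span S
  ⊆-span {x = u} u∈S = 1 , (λ _ → 1#) , (λ _ → u) , (λ _ → u∈S) ,
    ≈ᴹ-sym (≈ᴹ-trans (+ᴹ-identityʳ _) (*ₗ-identityˡ u))

  module _ {p} {Y Z : Pred Carrierᴹ p} (Y-sub : IsSubspace Y) (Z-sub : IsSubspace Z) where
    private
      module Y = IsSubspace Y-sub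
      module Z = IsSubspace Z-sub

    -- The span of the union with two summands in place of a combination of arbitrary length, which
    -- makes closure under the operations immediate.
    Sumset : Pred Carrierᴹ (m ⊔ ℓm ⊔ p)
    Sumset u = ∃₂ λ y z → y ∈ Y × z ∈ Z × u ≈ᴹ y +ᴹ z

    sum-isSubspace : IsSubspace Sumset
    sum-isSubspace = record
      { respects  = λ { u≈v (y , z , y∈Y , z∈Z , eq) → y , z , y∈Y , z∈Z , ≈ᴹ-trans (≈ᴹ-sym u≈v) eq }
      ; 0-closed  = 0ᴹ , 0ᴹ , Y.0-closed , Z.0-closed , ≈ᴹ-sym (+ᴹ-identityˡ 0ᴹ)
      ; +-closed  = λ { (y , z , y∈Y , z∈Z , eq) (y′ , z′ , y′∈Y , z′∈Z , eq′) →
                        y +ᴹ y′ , z +ᴹ z′ , Y.+-closed y∈Y y′∈Y , Z.+-closed z∈Z z′∈Z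
                        , ≈ᴹ-trans (+ᴹ-cong eq eq′) (interchange y z y′ z′) }
      ; *ₗ-closed = λ { a (y , z , y∈Y , z∈Z , eq) →
                        a *ₗ y , a *ₗ z , Y.*ₗ-closed a y∈Y , Z.*ₗ-closed a z∈Z
                        , ≈ᴹ-trans (*ₗ-cong (FiniteField.refl F) eq) (*ₗ-distribˡ a y z) }
      }

    span⊆sum : Span (Y ∪ Z) ⊆ Sumset
    span⊆sum (n , a , v , v∈Y∪Z , u≈av) = IsSubspace.respects sum-isSubspace (≈ᴹ-sym u≈av)
      (combination-closed sum-isSubspace a λ i → [ (λ v∈Y → v i , 0ᴹ , v∈Y , Z.0-closed , ≈ᴹ-sym (+ᴹ-identityʳ _))
                                                 , (λ v∈Z → 0ᴹ , v i , Y.0-closed , v∈Z , ≈ᴹ-sym (+ᴹ-identityˡ _)) ]′ (v∈Y∪Z i))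

    sum⊆span : Sumset ⊆ Span (Y ∪ Z)
    sum⊆span (y , z , y∈Y , z∈Z , u≈y+z) = 2 , (λ _ → 1#) , (y Vector.∷ z Vector.∷ Vector.[])
      , (λ { zero → inj₁ y∈Y ; (suc zero) → inj₂ z∈Z })
      , ≈ᴹ-trans u≈y+z (+ᴹ-cong (≈ᴹ-sym (*ₗ-identityˡ y)) (≈ᴹ-sym (≈ᴹ-trans (+ᴹ-identityʳ _) (*ₗ-identityˡ z))))

    span-combination : ∀ {n} (a : Vector Carrier n) {v : Vector Carrierᴹ n} →
      (∀ i → v i ∈ Span (Y ∪ Z)) → combination a v ∈ Span (Y ∪ Z)
    span-combination a {v} v∈ = sum⊆span (combination-closed sum-isSubspace a {v} (λ i → span⊆sum (v∈ i)))

  -- The coordinates of a basis of `Y` with respect to `b` form n independent rows of length n + 1,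
  -- to which `hyperplane` applies.
  subspace-functional : ∀ {p n} {Y : Pred Carrierᴹ p} {b : Vector Carrierᴹ (suc n)} → IsSubspace Y → HasDimension Y n →
    LinearlyIndependent b → (∀ {u} → u ∈ Y → ∃ λ a → u ≈ᴹ combination a b) →
    ∃ λ η → ∀ u → ⟨ u , η ⟩ ≈ 0# → combination u b ∈ Y
  subspace-functional {n = n} {Y} {b} Y-sub (y , y∈Y , y-ind , _) b-ind b-span =
    proj₁ (hyperplane A-ind) , λ u uη≈0 → let L , LA≈u = proj₂ (hyperplane A-ind) u uη≈0 in
      IsSubspace.respects Y-sub (begin
        combination L y          ≈⟨ combination-y L ⟩
        combination (L ᵥ* A) b   ≈⟨ combination-cong {v = b} LA≈u (λ _ → ≈ᴹ-refl) ⟩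
        combination u b          ∎) (combination-closed Y-sub L {y} y∈Y)
    where
    A : Matrix n (suc n)
    A i = proj₁ (b-span (y∈Y i))

    combination-y : ∀ L → combination L y ≈ᴹ combination (L ᵥ* A) b
    combination-y L = ≈ᴹ-trans (combination-cong (λ _ → FiniteField.refl F) (λ i → proj₂ (b-span (y∈Y i))))
      (≈ᴹ-sym (combination-ᵥ* L A b))

    A-ind : Independent A
    A-ind = is-independent λ L LA≈0 → y-ind L (≈ᴹ-trans (combination-y L) (combination-0 b LA≈0))

module SecondToFourth {c ℓ q} (F : FiniteField c ℓ q) where
  open FiniteField F hiding (zero)
  open Codes F
  open Polynomials commutativeRing using (Poly; eval; _⊕_; _·_)
  open MatrixProperties F
  open Equivalences F
  open LinearAlgebra 𝒫
  open Subspaces F 𝒫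
  open LeftModule 𝒫 using (_≈ᴹ_; 0ᴹ)
  open CommutativeSemigroupProperties +-commutativeSemigroup using (interchange)
  open CommutativeSemigroupProperties *-commutativeSemigroup using (x∙yz≈y∙xz)
  open SetoidReasoning setoid

  eval-⊕ : ∀ f g x → eval (f ⊕ g) x ≈ eval f x + eval g x
  eval-⊕ []      g       x = sym (+-identityˡ _)
  eval-⊕ (a ∷ f) []      x = sym (+-identityʳ _)
  eval-⊕ (a ∷ f) (b ∷ g) x = begin
    a + b + x * eval (f ⊕ g) x             ≈⟨ +-congˡ (trans (*-congˡ (eval-⊕ f g x)) (distribˡ x _ _)) ⟩
    a + b + (x * eval f x + x * eval g x)  ≈⟨ interchange a b _ _ ⟩
    eval (a ∷ f) x + eval (b ∷ g) x        ∎

  eval-· : ∀ a f x → eval (a · f) x ≈ a * eval f x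
  eval-· a []      x = sym (zeroʳ a)
  eval-· a (b ∷ f) x = begin
    a * b + x * eval (a · f) x    ≈⟨ +-congˡ (trans (*-congˡ (eval-· a f x)) (x∙yz≈y∙xz x a _)) ⟩
    a * b + a * (x * eval f x)    ≈⟨ distribˡ a b _ ⟨
    a * eval (b ∷ f) x            ∎

  eval-combination : ∀ {n} (a : Vector Carrier n) (v : Vector Poly n) x → eval (combination a v) x ≈ ⟨ a , (λ i → eval (v i) x) ⟩
  eval-combination {zero}  a v x = refl
  eval-combination {suc n} a v x = trans (eval-⊕ (a zero · v zero) (combination (a ∘ suc) (v ∘ suc)) x)
    (+-cong (eval-· (a zero) (v zero) x) (eval-combination (a ∘ suc) (v ∘ suc) x))

  𝒪-many-roots : ∀ {k} d {f} → k ℕ.≤ d ℕ.+ roots f → f ∈ 𝒪 (k ⊖ suc d) → f ≈ᴹ 0ᴹ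
  𝒪-many-roots d k≤d+roots (inj₁ f≈0)   = f≈0
  𝒪-many-roots d k≤d+roots (inj₂ roots≤) = contradiction roots≤ (⊖-bound d k≤d+roots)

  -- Let f be the member of ⟨Y, Z⟩ given by a combination `w` with k zeros. According to which of
  -- the first two entries of `w` vanish, f lies in Y ∩ Z, Y, Z or ⟨Y, Z⟩ and has at least k - 2, k
  -- - 1, k - 1 or k roots. Each time this is one root more than (e), (d) or (c) allows a nonzero f,
  -- so f = 0 against the independence of `b`.
  statement₂⇒statement₄ : ∀ {k} p → 2 ℕ.≤ k → Statement₂ k → Statement₄ k p
  statement₂⇒statement₄ {suc n} p 2≤k stmt₂
    (Y , Z , Y-sub , Z-sub , _ , (b , b∈ , b-ind , b-span) , Y-dim , Z-dim , W⊆𝒪 , Y∪Z⊆𝒪 , Y∩Z⊆𝒪) =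
    proj₁ (proj₂ comb) (b-ind L (vanishing (w zero ≟ 0#) (w (suc zero) ≟ 0#)))
    where
    Y-functional : ∃ λ η → ∀ u → ⟨ u , η ⟩ ≈ 0# → combination u b ∈ Y
    Y-functional = subspace-functional {b = b} Y-sub Y-dim b-ind (λ u∈Y → b-span (⊆-span {S = Y ∪ Z} (inj₁ u∈Y)))

    Z-functional : ∃ λ ζ → ∀ u → ⟨ u , ζ ⟩ ≈ 0# → combination u b ∈ Z
    Z-functional = subspace-functional {b = b} Z-sub Z-dim b-ind (λ u∈Z → b-span (⊆-span {S = Y ∪ Z} (inj₂ u∈Z)))

    M : Matrix (suc n) (2 ℕ.+ q)
    M i zero          = proj₁ Y-functional i
    M i (suc zero)    = proj₁ Z-functional i
    M i (suc (suc j)) = eval (b i) (element j)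

    comb : HasCombinationWithZeros M (suc n)
    comb = stmt₂ M

    L : Vector Carrier (suc n)
    L = proj₁ comb

    w : Vector Carrier (2 ℕ.+ q)
    w = L ᵥ* M

    evaluations : Vector Carrier q
    evaluations j = w (suc (suc j))

    f : Poly
    f = combination L b

    f∈W : f ∈ Span (Y ∪ Z)
    f∈W = span-combination Y-sub Z-sub L {b} b∈

    k≤zeros : suc n ℕ.≤ zeros w
    k≤zeros = proj₂ (proj₂ comb)

    roots-f : zeros evaluations ≡ roots f
    roots-f = zeros-cong {u = evaluations} λ j → sym (eval-combination L b (element j))

    zeros-tail : ∀ {n} (v : Vector Carrier (suc n)) → zeros v ℕ.≤ suc (zeros (v ∘ suc))
    zeros-tail = count-tail (_≟ 0#)

    zeros-tail-≉ : ∀ {n} (v : Vector Carrier (suc n)) → ¬ (v zero ≈ 0#) → zeros v ℕ.≤ zeros (v ∘ suc)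
    zeros-tail-≉ v v₀≉0 = ℕ.≤-reflexive (count-tail-¬ (_≟ 0#) v v₀≉0)

    bound : ∀ d → zeros w ℕ.≤ d ℕ.+ zeros evaluations → suc n ℕ.≤ d ℕ.+ roots f
    bound d ≤ = ℕ.≤-trans k≤zeros (ℕ.≤-trans ≤ (ℕ.≤-reflexive (≡.cong (d ℕ.+_) roots-f)))

    vanishing : Dec (w zero ≈ 0#) → Dec (w (suc zero) ≈ 0#) → f ≈ᴹ 0ᴹ
    vanishing (yes w₀≈0) (yes w₁≈0) = 𝒪-many-roots 2 (bound 2 (ℕ.≤-trans (zeros-tail w) (s≤s (zeros-tail (w ∘ suc)))))
      (Y∩Z⊆𝒪 (proj₂ Y-functional L w₀≈0 , proj₂ Z-functional L w₁≈0))
    vanishing (yes w₀≈0) (no w₁≉0)  = 𝒪-many-roots 1 (bound 1 (ℕ.≤-trans (zeros-tail w) (s≤s (zeros-tail-≉ (w ∘ suc) w₁≉0))))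
      (Y∪Z⊆𝒪 (inj₁ (proj₂ Y-functional L w₀≈0)))
    vanishing (no w₀≉0)  (yes w₁≈0) = 𝒪-many-roots 1 (bound 1 (ℕ.≤-trans (zeros-tail-≉ w w₀≉0) (zeros-tail (w ∘ suc))))
      (Y∪Z⊆𝒪 (inj₂ (proj₂ Z-functional L w₁≈0)))
    vanishing (no w₀≉0)  (no w₁≉0)  = 𝒪-many-roots 0 (bound 0 (ℕ.≤-trans (zeros-tail-≉ w w₀≉0) (zeros-tail-≉ (w ∘ suc) w₁≉0)))
      (W⊆𝒪 f∈W)

open import Data.Nat.Base using (_≤_; _<_; _^_; _∸_)

theorem1p4 : ∀ {c ℓ} (ℓ′ : Level) (p r q k : ℕ) → Prime p → 0 < r → q ≡ p ^ r →
    2 ≤ k → k ≤ q →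
    (¬ (2 ∣ q)) ⊎ (2 ∣ q × k ≢ 3 × k ≢ q ∸ 1) →
    (F : FiniteField c ℓ q) →
    let open Codes F in
    ((Statement₁ k ⇔ Statement₂ k) × (Statement₁ k ⇔ Statement₃ k) × (Statement₁ k ⇔ Statement₅ k)) ×
    (Statement₃ k → Statement₄ k ℓ′)
theorem1p4 ℓ′ p r q k _ _ _ 2≤k k≤q parity F =
  ( mk⇔ 1⇒2 2⇒1
  , mk⇔ (λ stmt₁ → statement₂⇒statement₃ (1⇒2 stmt₁)) (λ stmt₃ → 2⇒1 (3⇒2 stmt₃))
  , mk⇔ (λ stmt₁ → statement₂⇒statement₅ (1⇒2 stmt₁)) (λ stmt₅ → 2⇒1 (statement₅⇒statement₂ 2≤k k≤q stmt₅)))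
  , λ stmt₃ → statement₂⇒statement₄ ℓ′ 2≤k (3⇒2 stmt₃)
  where
  open Codes F
  open Equivalences F
  open SecondToFifth F
  open Scaling F
  open SecondToFourth F

  ¬exceptional : ¬ Exceptional k
  ¬exceptional (2∣q , k≡3∨k≡q-1) =
    [ (λ 2∤q → 2∤q 2∣q) , (λ (_ , k≢3 , k≢q-1) → [ k≢3 , k≢q-1 ]′ k≡3∨k≡q-1) ]′ parity

  1⇒2 : Statement₁ k → Statement₂ k
  1⇒2 = statement₁⇒statement₂ ¬exceptional

  2⇒1 : Statement₂ k → Statement₁ k
  2⇒1 = statement₂⇒statement₁ ¬exceptional

  3⇒2 : Statement₃ k → Statement₂ k
  3⇒2 = statement₃⇒statement₂ 2≤k k≤q
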